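{- Let $q$ be a prime power and let $\alpha\in\mathbb{F}_{q^6}$ with $\mathrm{N}_{q^6/q^3}(\alpha)\ne0,1$. The $\mathbb{F}_q$-linear set \[ L_{f_3}=\{\langle(x,x^{q^5}+\alpha x^{q^2})\rangle_{\mathbb{F}_{q^6}}\colon x\in\mathbb{F}_{q^6}^*\} \] of $\mathrm{PG}(1,q^6)$ is scattered if and only if the equation \[ Y^2-(\mathrm{Tr}_{q^3/q}(A)-1)Y+\mathrm{N}_{q^3/q}(A)=0,\qquad A=\frac{ -\alpha^{q^3+1}}{1-\alpha^{q^3+1}}, \] admits two (distinct) roots in $\mathbb{F}_q$. In particular, for any $q>2$ there always exists such an $\alpha$ (that is, an $\alpha\in\mathbb{F}_{q^6}$ with $\mathrm{N}_{q^6/q^3}(\alpha)\ne0,1$ for which $L_{f_3}$ is scattered).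
   Context: $\mathrm{N}_{q^6/q^3}(\alpha)=\alpha^{q^3+1}$; $\mathrm{Tr}_{q^3/q}$ and $\mathrm{N}_{q^3/q}$ are the trace and norm from $\mathbb{F}_{q^3}$ to $\mathbb{F}_q$ (note $A\in\mathbb{F}_{q^3}$). With $U=\{(x,x^{q^5}+\alpha x^{q^2})\colon x\in\mathbb{F}_{q^6}\}$, the weight of a point $\langle\mathbf{u}\rangle_{\mathbb{F}_{q^6}}$ is $\dim_{\mathbb{F}_q}(U\cap\langle\mathbf{u}\rangle_{\mathbb{F}_{q^6}})$. $L_{f_3}$ is called scattered if all of its points have weight one, equivalently $|L_{f_3}|=(q^6-1)/(q-1)$. -}

module Defs where

open import Level using (_⊔_; suc)
open import Algebra.Bundles using (CommutativeRing; Semiring)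
open import Algebra.Module.Bundles using (Module)
import Algebra.Module.Construct.DirectProduct as DirectProduct
import Algebra.Module.Construct.TensorUnit as TensorUnit
import Algebra.Definitions as Definitions
import Algebra.Definitions.RawMonoid as RawMonoidDefinitions
import Algebra.Definitions.RawSemiring as RawSemiringDefinitions
import Algebra.Properties.Group as GroupProperties
open import Data.Fin.Base using (Fin; toℕ)
open import Data.Nat.Base as ℕ using (ℕ; _≤_)
open import Data.Nat.Primality using (Prime)
open import Data.Product.Base using (_×_; _,_; ∃; ∃₂; proj₁)
open import Data.Vec.Functional using (Vector)
open import Function.Bundles using (Inverse)
open import Relation.Binary.PropositionalEquality as ≡ using (_≡_)
open import Relation.Nullary.Negation using (¬_)
open import Relation.Unary using (Pred; _∈_; _∩_; _≐_)

IsPrimePower : ℕ → Set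
IsPrimePower q = ∃₂ λ p k → Prime p × 1 ≤ k × q ≡ p ℕ.^ k

-- The bijection with Fin n, which respects _≈_, makes _≈_ decidable, so no
-- apartness relation is needed to say that a nonzero element is invertible.
record FiniteField c ℓ (n : ℕ) : Set (suc (c ⊔ ℓ)) where
  field
    commutativeRing : CommutativeRing c ℓ

  open CommutativeRing commutativeRing public

  field
    0≉1        : 0# ≉ 1#
    invertible : ∀ x → x ≉ 0# → Definitions.Invertible _≈_ 1# _*_ x
    enumerate  : Inverse setoid (≡.setoid (Fin n))

  divide : ∀ x y → y ≉ 0# → Carrier
  divide x y y≉0 = x * proj₁ (invertible y y≉0)

  x≉y⇒y-x≉0 : ∀ {x y} → x ≉ y → y - x ≉ 0#
  x≉y⇒y-x≉0 {x} {y} x≉y y-x≈0 = x≉y (sym (x∙y⁻¹≈ε⇒x≈y y x y-x≈0))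
    where open GroupProperties +-group using (x∙y⁻¹≈ε⇒x≈y)

-- W is meant to be closed under addition and under multiplication by the
-- scalars in K, where K is a subfield of R; then HasDimension d says that
-- dim_K W = d.
module _ {r ℓr m ℓm k w} {R : CommutativeRing r ℓr} (M : Module R m ℓm)
         (K : Pred (CommutativeRing.Carrier R) k)
         (W : Pred (Module.Carrierᴹ M) w) where

  open CommutativeRing R using (_≈_; 0#) renaming (Carrier to Scalar)
  open Module M using (Carrierᴹ; _≈ᴹ_; 0ᴹ; _*ₗ_; +ᴹ-rawMonoid)
  open RawMonoidDefinitions +ᴹ-rawMonoid using (sum)

  combination : ∀ {d} → Vector Scalar d → Vector Carrierᴹ d → Carrierᴹ
  combination a b = sum (λ i → a i *ₗ b i)

  record IsBasis {d} (b : Vector Carrierᴹ d) : Set (r ⊔ ℓr ⊔ m ⊔ ℓm ⊔ k ⊔ w) where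
    field
      contained   : ∀ i → b i ∈ W
      independent : ∀ (a : Vector Scalar d) → (∀ i → a i ∈ K) →
                    combination a b ≈ᴹ 0ᴹ → ∀ i → a i ≈ 0#
      spanning    : ∀ v → v ∈ W →
                    ∃ λ (a : Vector Scalar d) → (∀ i → a i ∈ K) × v ≈ᴹ combination a b

  HasDimension : ℕ → Set (r ⊔ ℓr ⊔ m ⊔ ℓm ⊔ k ⊔ w)
  HasDimension d = ∃ λ (b : Vector Carrierᴹ d) → IsBasis b

module _ {c ℓ} (q : ℕ) (F : FiniteField c ℓ (q ℕ.^ 6)) where

  open FiniteField F
  open RawSemiringDefinitions (Semiring.rawSemiring semiring) using (_^_; sum; product)

  -- The subfield of order q of a field of order q⁶ is the set of fixed points
  -- of x ↦ x^q.
  𝔽q : Pred Carrier ℓ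
  𝔽q x = x ^ q ≈ x

  -- The conjugates over 𝔽q of an element of 𝔽q³ are x, x^q and x^(q²), so on
  -- 𝔽q³ these are the trace and the norm from 𝔽q³ to 𝔽q.
  Tr[q³/q] : Carrier → Carrier
  Tr[q³/q] x = sum {3} (λ i → x ^ (q ℕ.^ toℕ i))

  N[q³/q] : Carrier → Carrier
  N[q³/q] x = product {3} (λ i → x ^ (q ℕ.^ toℕ i))

  N[q⁶/q³] : Carrier → Carrier
  N[q⁶/q³] x = x ^ (q ℕ.^ 3 ℕ.+ 1)

  plane : Module commutativeRing c ℓ
  plane = DirectProduct.⟨module⟩ TensorUnit.⟨module⟩ TensorUnit.⟨module⟩

  open Module plane using (Carrierᴹ; _≈ᴹ_; 0ᴹ; _*ₗ_)

  ⟨_⟩ : Carrierᴹ → Pred Carrierᴹ (c ⊔ ℓ)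
  ⟨ u ⟩ v = ∃ λ a → v ≈ᴹ a *ₗ u

  -- A point of PG(1, q⁶) is given by a nonzero vector; u and v give the same
  -- point when ⟨ u ⟩ ≐ ⟨ v ⟩.
  record Point : Set (c ⊔ ℓ) where
    field
      vector  : Carrierᴹ
      nonzero : ¬ vector ≈ᴹ 0ᴹ

    line : Pred Carrierᴹ (c ⊔ ℓ)
    line = ⟨ vector ⟩

  module _ (f : Carrier → Carrier) where

    graph : Pred Carrierᴹ (c ⊔ ℓ)
    graph v = ∃ λ x → v ≈ᴹ (x , f x)

    linearSet : Pred Point (c ⊔ ℓ)
    linearSet P = ∃ λ x → x ≉ 0# × Point.line P ≐ ⟨ (x , f x) ⟩

    HasWeight : Point → ℕ → Set (c ⊔ ℓ)
    HasWeight P = HasDimension plane 𝔽q (graph ∩ Point.line P)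

    IsScattered : Set (c ⊔ ℓ)
    IsScattered = ∀ P → P ∈ linearSet → HasWeight P 1

  f₃ : Carrier → Carrier → Carrier
  f₃ α x = x ^ (q ℕ.^ 5) + α * x ^ (q ℕ.^ 2)

  A : ∀ α → N[q⁶/q³] α ≉ 1# → Carrier
  A α N≉1 = divide (- N[q⁶/q³] α) (1# - N[q⁶/q³] α) (x≉y⇒y-x≉0 N≉1)

  IsRoot : Carrier → Carrier → Set ℓ
  IsRoot a y = y ^ 2 - (Tr[q³/q] a - 1#) * y + N[q³/q] a ≈ 0#

  HasTwoRootsIn𝔽q : Carrier → Set (c ⊔ ℓ)
  HasTwoRootsIn𝔽q a = ∃₂ λ y z → y ∈ 𝔽q × z ∈ 𝔽q × y ≉ z × IsRoot a y × IsRoot a z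

{-# OPTIONS --safe #-}
module Submission where

-- Write xᵢ for x^(qⁱ) and δ for the norm of α. The points of x and lx coincide if
-- and only if (l₅ − l)x₅ = −α(l₂ − l)x₂; by Hilbert 90 such an x ≠ 0 exists for a
-- given l ∉ 𝔽q exactly when (l₅ − l)(l₂ − l₃) = δ(l₂ − l)(l₅ − l₃), that is, when A
-- is the cross-ratio (l − l₅)(l₂ − l₃) / (l₃ − l)(l₅ − l₂) of four conjugates of l.
-- For such an l the roots of the quadratic equation are the two products of
-- alternate sides of the hexagon l, l₁, …, l₅ divided by the product of its long
-- diagonals. Frobenius interchanges them, so they are not distinct elements of 𝔽q.
--
-- Conversely, if the equation does not have two roots in 𝔽q then its roots are
-- y and y^q for some y. Choosing u and v with u u₃ = A^q, u u₂ u₄ = y and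
-- v v₁ = u₁ − u u₂, the q-polynomial M = uX₁ − vX₂ + X₃ + v₄X₄ + u₅X₅ has its image
-- in the kernel of vX₅ − u₅X₂ + X, and l is a quotient of two values of M.
--
-- The example comes from hexagons on which Frobenius acts by l → l₁ → l₂ → l and
-- m → m₁ → m₂ → m, with l ∈ 𝔽q³ generic and m = 1/(1 − l): then it fixes both roots.

open import Defs
open import Level using (_⊔_)
open import Algebra.Bundles using (AbelianGroup; CommutativeRing)
import Algebra.Construct.DirectProduct as DirectProduct
open import Algebra.Solver.Ring.AlmostCommutativeRing using (fromCommutativeRing; _-Raw-AlmostCommutative⟶_)
open import Data.Fin.Base using (Fin; zero; suc; toℕ; fromℕ; inject₁; punchIn; inject≤)
open import Data.Fin.Permutation using (Permutation; permutation; _⟨$⟩ʳ_; remove; punchIn-permute)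
import Data.Fin.Properties as Fin
open import Data.Integer.Base as ℤ using (ℤ; +_; -[1+_]; _⊖_)
import Data.Integer.Properties as ℤ
open import Data.Maybe.Base using (Maybe; just; nothing)
open import Data.Nat.Base as ℕ using (ℕ; zero; suc; _≤_; _<_; z≤n; s≤s; _∸_; _!)
open import Data.Nat.Combinatorics using (_C_; nCk≡n!/k![n-k]!; k![n∸k]!∣n!; nCn≡1)
open import Data.Nat.DivMod using (m/n*n≡m)
open import Data.Nat.Divisibility using (_∣_; divides; ∣⇒≤; m∣m*n)
open import Data.Nat.Primality using (Prime; euclidsLemma; prime⇒nonZero; prime⇒nonTrivial)
import Data.Nat.Properties as ℕ
open import Data.Nat.Properties using (_!*_!≢0)
open import Data.Nat.Solver using (module +-*-Solver)
open import Data.Product.Base using (_×_; _,_; ∃; ∃₂; proj₁; proj₂)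
open import Data.Sum.Base as Sum using (_⊎_; inj₁; inj₂; [_,_]′)
open import Data.Vec.Base using (Vec; []; _∷_)
open import Function.Base using (_∘_)
open import Function.Bundles using (_⇔_; mk⇔; Equivalence; Inverse)
open import Relation.Binary.Core using (_Preserves_⟶_)
open import Relation.Binary.Definitions using (_Respects_)
open import Relation.Binary.PropositionalEquality as ≡ using (_≡_)
open import Relation.Nullary using (¬_; Dec; yes; no; contradiction; ¬?; _×-dec_)
open import Relation.Nullary.Decidable using (map′; decidable-stable)
open import Relation.Unary using (Pred; Decidable)

-- `L_{f₃}` fails to be scattered when some `X₅ + αX₂ − mX` has two zeros independent over 𝔽q.
-- Replacing x by cx multiplies α by c₂/c₅, of norm 1 to 𝔽q³, so only δ matters and the converse may
-- use any convenient multiple: `vX₅ − u₅X₂ + X` with u₂u₅ = A and vv₃ = A - 1, since A/(A - 1) = δ.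
-- The cross-ratio carries the result back to α. The obstacle is to make the kernel at least
-- two-dimensional. It contains the image of M once three coefficients of the composite vanish: vv₅
-- = u - u₅u₁, vv₃ = u₂u₅ - 1 and u₄v + v₄ + v₂u₅ = 0. All three, and the solvability of vv₁ = w for
-- w = u₁ - uu₂, rest on the identity ww₂ = (A - 1)w₁, which is where y + y^q = Tr(A) - 1 enters.
-- The equation yy^q = N(A) makes the two norm conditions on u compatible. Existence always comes
-- from one fact: a polynomial of degree below the order of the field with nonzero leading
-- coefficient has a nonzero value. It yields Hilbert 90 and the surjectivity of norms, the root y,
-- the nonzero values of M and the generic l.

-- Arithmetic of binomial coefficients and exponents.

prime∤! : ∀ {p} → Prime p → ∀ k → k < p → ¬ p ∣ k !
prime∤! {p} pp zero 0<p p∣1 = ℕ.<⇒≱ (ℕ.nonTrivial⇒n>1 p {{prime⇒nonTrivial pp}}) (∣⇒≤ p∣1)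
prime∤! pp (suc k) k<p p∣k! with euclidsLemma (suc k) (k !) pp p∣k!
... | inj₁ p∣k  = ℕ.<⇒≱ k<p (∣⇒≤ p∣k)
... | inj₂ p∣k! = prime∤! pp k (ℕ.<-trans (ℕ.n<1+n k) k<p) p∣k!

prime∣C : ∀ {p} → Prime p → ∀ {k} → 1 ≤ k → k < p → p ∣ p C k
prime∣C {p} pp {k} 1≤k k<p
  with euclidsLemma (p C k) (k ! ℕ.* (p ∸ k) !) pp (≡.subst (p ∣_) (≡.sym C*d≡p!) p∣p!)
  where
  k≤p = ℕ.<⇒≤ k<p
  instance _ = k !* (p ∸ k) !≢0
  C*d≡p! : (p C k) ℕ.* (k ! ℕ.* (p ∸ k) !) ≡ p !
  C*d≡p! = ≡.trans (≡.cong (ℕ._* (k ! ℕ.* (p ∸ k) !)) (nCk≡n!/k![n-k]! k≤p)) (m/n*n≡m (k![n∸k]!∣n! k≤p))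
  p∣p! : p ∣ p !
  p∣p! = ≡.subst (λ n → n ∣ n !) (ℕ.suc-pred p {{prime⇒nonZero pp}}) (m∣m*n _)
... | inj₁ p∣C = p∣C
... | inj₂ p∣d with euclidsLemma (k !) ((p ∸ k) !) pp p∣d
...   | inj₁ p∣k! = contradiction p∣k! (prime∤! pp k k<p)
...   | inj₂ p∣r! = contradiction p∣r! (prime∤! pp (p ∸ k) (ℕ.∸-monoʳ-< {p} {k} {0} 1≤k (ℕ.<⇒≤ k<p)))

[1+m][m∸1]≡m²∸1 : ∀ m → 1 ≤ m → suc m ℕ.* (m ∸ 1) ≡ m ℕ.* m ∸ 1
[1+m][m∸1]≡m²∸1 (suc k) _ = solve 1 (λ k → (con 2 :+ k) :* k := k :+ k :* (con 1 :+ k)) ≡.refl k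
  where open +-*-Solver

[1+m+m²][m∸1]≡m³∸1 : ∀ m → 1 ≤ m → suc (m ℕ.+ m ℕ.* m) ℕ.* (m ∸ 1) ≡ m ℕ.* (m ℕ.* m) ∸ 1
[1+m+m²][m∸1]≡m³∸1 (suc k) _ = solve 1 (λ k → let m = con 1 :+ k in
    (con 1 :+ m :+ m :* m) :* k := k :+ k :* m :+ k :* (m :* m)) ≡.refl k
  where open +-*-Solver

-- The left side is the degree of the polynomial in `generic` that must not vanish on the whole
-- field. It equals q³(2q² + q + 4), and q + 4 < q² for q ≥ 3 brings it below 3q⁵ ≤ q⁶. At q = 2 it
-- is 112 against 64.
degree<q⁶ : ∀ q → 2 < q →
  q ℕ.^ 4 ℕ.+ ((q ℕ.^ 3 ℕ.+ q ℕ.^ 5) ℕ.+ ((q ℕ.^ 3 ℕ.+ q ℕ.^ 5) ℕ.+ (q ℕ.^ 3 ℕ.+ q ℕ.^ 3))) < q ℕ.^ 6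
degree<q⁶ q 2<q = begin-strict
  q ℕ.* m ℕ.+ ((m ℕ.+ q ℕ.* (q ℕ.* m)) ℕ.+ ((m ℕ.+ q ℕ.* (q ℕ.* m)) ℕ.+ (m ℕ.+ m)))
    ≡⟨ solve 2 (λ q m → q :* m :+ ((m :+ q :* (q :* m)) :+ ((m :+ q :* (q :* m)) :+ (m :+ m))) :=
         m :* (con 2 :* (q :* q) :+ (q :+ con 4))) ≡.refl q m ⟩
  m ℕ.* (2 ℕ.* (q ℕ.* q) ℕ.+ (q ℕ.+ 4))
    <⟨ ℕ.*-monoʳ-< m {{ℕ.>-nonZero (ℕ.m^n>0 q {{ℕ.>-nonZero 0<q}} 3)}} (ℕ.+-monoʳ-< (2 ℕ.* (q ℕ.* q)) q+4<q²) ⟩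
  m ℕ.* (2 ℕ.* (q ℕ.* q) ℕ.+ q ℕ.* q)
    ≡⟨ solve 2 (λ q m → m :* (con 2 :* (q :* q) :+ q :* q) := con 3 :* (q :* (q :* m))) ≡.refl q m ⟩
  3 ℕ.* (q ℕ.* (q ℕ.* m))
    ≤⟨ ℕ.*-monoˡ-≤ (q ℕ.* (q ℕ.* m)) 2<q ⟩
  q ℕ.* (q ℕ.* (q ℕ.* m)) ∎
  where
  open ℕ.≤-Reasoning
  open +-*-Solver
  m = q ℕ.^ 3
  0<q : 0 < q
  0<q = ℕ.<-trans (s≤s z≤n) 2<q
  q+4<q² : q ℕ.+ 4 < q ℕ.* q
  q+4<q² = begin-strict
    q ℕ.+ 4                <⟨ ℕ.+-monoʳ-< q (s≤s (s≤s (s≤s (s≤s (s≤s z≤n))))) ⟩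
    q ℕ.+ 2 ℕ.* 3          ≤⟨ ℕ.+-monoʳ-≤ q (ℕ.*-monoʳ-≤ 2 2<q) ⟩
    q ℕ.+ 2 ℕ.* q          ≤⟨ ℕ.*-monoˡ-≤ q 2<q ⟩
    q ℕ.* q                ∎

-- Integer coefficients let the solver compare constants in an arbitrary commutative ring, where
-- `_≈_` need not be decidable.
module IntegerSolver {c ℓ} (R : CommutativeRing c ℓ) where
  open CommutativeRing R
  open import Algebra.Properties.Ring ring using (-‿distribˡ-*; -0#≈0#; -‿involutive)
  open import Algebra.Properties.AbelianGroup +-abelianGroup using (⁻¹-∙-comm)
  open import Algebra.Properties.Semiring.Mult.TCOptimised semiring
    using (×-homo-+; ×1-homo-*; 1+×) renaming (_×_ to _·_)
  open import Relation.Binary.Reasoning.Setoid setoid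

  fromℤ : ℤ → Carrier
  fromℤ (+ n)    = n · 1#
  fromℤ -[1+ n ] = - (suc n · 1#)

  private
    cancel : ∀ x y z → x + y - (x + z) ≈ y - z
    cancel x y z = begin
      x + y - (x + z)      ≈⟨ +-congˡ (⁻¹-∙-comm x z) ⟨
      x + y + (- x - z)    ≈⟨ +-assoc _ _ _ ⟨
      x + y - x - z        ≈⟨ +-congʳ (+-congʳ (+-comm x y)) ⟩
      y + x - x - z        ≈⟨ +-congʳ (+-assoc _ _ _) ⟩
      y + (x - x) - z      ≈⟨ +-congʳ (+-congˡ (-‿inverseʳ x)) ⟩
      y + 0# - z           ≈⟨ +-congʳ (+-identityʳ y) ⟩
      y - z                ∎

  ⊖-homo : ∀ m n → fromℤ (m ⊖ n) ≈ m · 1# - n · 1#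
  ⊖-homo m zero = sym (trans (+-congˡ -0#≈0#) (+-identityʳ _))
  ⊖-homo zero (suc n) = sym (+-identityˡ _)
  ⊖-homo (suc m) (suc n) = begin
    fromℤ (suc m ⊖ suc n)        ≡⟨ ≡.cong fromℤ (ℤ.[1+m]⊖[1+n]≡m⊖n m n) ⟩
    fromℤ (m ⊖ n)                ≈⟨ ⊖-homo m n ⟩
    m · 1# - n · 1#              ≈⟨ cancel 1# _ _ ⟨
    1# + m · 1# - (1# + n · 1#)  ≈⟨ +-cong (1+× m 1#) (-‿cong (1+× n 1#)) ⟨
    suc m · 1# - suc n · 1#      ∎

  fromℤ-+ : ∀ i j → fromℤ (i ℤ.+ j) ≈ fromℤ i + fromℤ j
  fromℤ-+ (+ m)    (+ n)    = ×-homo-+ 1# m n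
  fromℤ-+ (+ m)    -[1+ n ] = ⊖-homo m (suc n)
  fromℤ-+ -[1+ m ] (+ n)    = trans (⊖-homo n (suc m)) (+-comm _ _)
  fromℤ-+ -[1+ m ] -[1+ n ] = begin
    - (suc (suc (m ℕ.+ n)) · 1#)      ≡⟨ ≡.cong (λ k → - (suc k · 1#)) (≡.sym (ℕ.+-suc m n)) ⟩
    - ((suc m ℕ.+ suc n) · 1#)        ≈⟨ -‿cong (×-homo-+ 1# (suc m) (suc n)) ⟩
    - (suc m · 1# + suc n · 1#)       ≈⟨ ⁻¹-∙-comm _ _ ⟨
    - (suc m · 1#) - suc n · 1#       ∎

  fromℤ-neg : ∀ i → fromℤ (ℤ.- i) ≈ - fromℤ i
  fromℤ-neg (+ zero)  = sym -0#≈0#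
  fromℤ-neg (+ suc n) = refl
  fromℤ-neg -[1+ n ]  = sym (-‿involutive _)

  fromℤ-+* : ∀ m j → fromℤ (+ m ℤ.* j) ≈ m · 1# * fromℤ j
  fromℤ-+* m (+ n) = begin
    fromℤ (+ m ℤ.* + n)   ≡⟨ ≡.cong fromℤ (ℤ.pos-* m n) ⟨
    (m ℕ.* n) · 1#        ≈⟨ ×1-homo-* m n ⟩
    m · 1# * (n · 1#)     ∎
  fromℤ-+* m -[1+ n ] = begin
    fromℤ (+ m ℤ.* -[1+ n ])            ≡⟨ ≡.cong fromℤ (ℤ.neg-distribʳ-* (+ m) (+ suc n)) ⟨
    fromℤ (ℤ.- (+ m ℤ.* + suc n))       ≈⟨ fromℤ-neg (+ m ℤ.* + suc n) ⟩
    - fromℤ (+ m ℤ.* + suc n)           ≈⟨ -‿cong (fromℤ-+* m (+ suc n)) ⟩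
    - (m · 1# * (suc n · 1#))           ≈⟨ -‿distribʳ-* _ _ ⟩
    m · 1# * - (suc n · 1#)             ∎
    where open import Algebra.Properties.Ring ring using (-‿distribʳ-*)

  fromℤ-* : ∀ i j → fromℤ (i ℤ.* j) ≈ fromℤ i * fromℤ j
  fromℤ-* (+ m)    j = fromℤ-+* m j
  fromℤ-* -[1+ m ] j = begin
    fromℤ (-[1+ m ] ℤ.* j)          ≡⟨ ≡.cong fromℤ (ℤ.neg-distribˡ-* (+ suc m) j) ⟨
    fromℤ (ℤ.- (+ suc m ℤ.* j))     ≈⟨ fromℤ-neg (+ suc m ℤ.* j) ⟩
    - fromℤ (+ suc m ℤ.* j)         ≈⟨ -‿cong (fromℤ-+* (suc m) j) ⟩
    - (suc m · 1# * fromℤ j)        ≈⟨ -‿distribˡ-* _ _ ⟩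
    - (suc m · 1#) * fromℤ j        ∎

  morphism : ℤ.+-*-rawRing -Raw-AlmostCommutative⟶ fromCommutativeRing R
  morphism = record
    { ⟦_⟧    = fromℤ
    ; +-homo = fromℤ-+
    ; *-homo = fromℤ-*
    ; -‿homo = fromℤ-neg
    ; 0-homo = refl
    ; 1-homo = refl
    }

  _coeff≟_ : ∀ i j → Maybe (fromℤ i ≈ fromℤ j)
  i coeff≟ j with i ℤ.≟ j
  ... | yes ≡.refl = just refl
  ... | no  _      = nothing

  open import Algebra.Solver.Ring ℤ.+-*-rawRing (fromCommutativeRing R) morphism _coeff≟_ public
    using (solve; _:+_; _:*_; _:-_; :-_; _:=_; con; Polynomial)

-- Additivity of the Frobenius map in characteristic p.

module Frobenius {c ℓ} (R : CommutativeRing c ℓ) where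
  open CommutativeRing R hiding (zero)
  open import Algebra.Properties.Semiring.Mult semiring renaming (_×_ to _·_)
  open import Algebra.Properties.CommutativeSemiring.Exp commutativeSemiring
  open import Algebra.Properties.Monoid.Sum +-monoid
  open import Algebra.Properties.CommutativeSemiring.Binomial commutativeSemiring
    using (binomialTerm; theorem)
  open import Relation.Binary.Reasoning.Setoid setoid

  ∣⇒×≈0 : ∀ {p n} → p · 1# ≈ 0# → p ∣ n → ∀ x → n · x ≈ 0#
  ∣⇒×≈0 {p} p1≈0 (divides m ≡.refl) x = begin
    (m ℕ.* p) · x          ≈⟨ ×-assocˡ x m p ⟨
    m · (p · x)            ≈⟨ ×-congʳ m (×-congʳ p (*-identityˡ x)) ⟨
    m · (p · (1# * x))     ≈⟨ ×-congʳ m (×-assoc-* p 1# x) ⟨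
    m · ((p · 1#) * x)     ≈⟨ ×-congʳ m (trans (*-congʳ p1≈0) (zeroˡ x)) ⟩
    m · 0#                 ≈⟨ trans (×-congʳ m (sym (zeroʳ 0#))) (trans (sym (×-comm-* m 0# 0#)) (zeroˡ _)) ⟩
    0#                     ∎

  -- Every inner binomial coefficient is a multiple of p, so only the two outer terms of the
  -- expansion survive.
  frobenius-+ : ∀ {p} → Prime p → p · 1# ≈ 0# → ∀ x y → (x + y) ^ p ≈ x ^ p + y ^ p
  frobenius-+ {zero}  pp _ x y = contradiction ≡.refl (ℕ.≢-nonZero⁻¹ 0 {{prime⇒nonZero pp}})
  frobenius-+ {p@(suc n)} pp p1≈0 x y = begin
    (x + y) ^ p                                  ≈⟨ theorem p x y ⟩
    t zero + sum (λ i → t (suc i))               ≈⟨ +-cong first (sum-init-last (λ i → t (suc i))) ⟩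
    y ^ p + (sum middle + t (fromℕ p))           ≈⟨ +-congˡ (+-cong middle≈0 final) ⟩
    y ^ p + (0# + x ^ p)                         ≈⟨ +-congˡ (+-identityˡ _) ⟩
    y ^ p + x ^ p                                ≈⟨ +-comm _ _ ⟩
    x ^ p + y ^ p                                ∎
    where
    t = binomialTerm x y p
    middle : Fin n → Carrier
    middle i = t (suc (inject₁ i))
    first : t zero ≈ y ^ p
    first = trans (+-identityʳ _) (*-identityˡ _)
    final : t (fromℕ p) ≈ x ^ p
    final rewrite Fin.toℕ-fromℕ n | nCn≡1 p | ℕ.n∸n≡0 n = trans (+-identityʳ _) (*-identityʳ _)
    middle≈0 : sum middle ≈ 0#
    middle≈0 = trans (sum-cong-≋ λ i → ∣⇒×≈0 p1≈0 (prime∣C pp {toℕ (suc (inject₁ i))} (s≤s z≤n)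
                        (s≤s (≡.subst (_< n) (≡.sym (Fin.toℕ-inject₁ i)) (Fin.toℕ<n i)))) _)
                     (sum-replicate-zero n)

  frobenius-+^ : ∀ {p} → Prime p → p · 1# ≈ 0# → ∀ k x y → (x + y) ^ (p ℕ.^ k) ≈ x ^ (p ℕ.^ k) + y ^ (p ℕ.^ k)
  frobenius-+^ pp p1≈0 zero x y = trans (*-identityʳ _) (+-cong (sym (*-identityʳ _)) (sym (*-identityʳ _)))
  frobenius-+^ {p} pp p1≈0 (suc k) x y = begin
    (x + y) ^ (p ℕ.* p ℕ.^ k)                        ≈⟨ ^-assocʳ (x + y) p _ ⟨
    ((x + y) ^ p) ^ (p ℕ.^ k)                        ≈⟨ ^-congˡ (p ℕ.^ k) (frobenius-+ pp p1≈0 x y) ⟩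
    (x ^ p + y ^ p) ^ (p ℕ.^ k)                      ≈⟨ frobenius-+^ pp p1≈0 k _ _ ⟩
    (x ^ p) ^ (p ℕ.^ k) + (y ^ p) ^ (p ℕ.^ k)        ≈⟨ +-cong (^-assocʳ x p _) (^-assocʳ y p _) ⟩
    x ^ (p ℕ.* p ℕ.^ k) + y ^ (p ℕ.* p ℕ.^ k)        ∎

-- Quadratic extensions and conjugate roots.

-- The ring R[Y]/(Y² − sY − e), with (u , v) standing for u + vY.
module QuadraticExtension {c ℓ} (R : CommutativeRing c ℓ) (s e : CommutativeRing.Carrier R) where
  open CommutativeRing R
  open IntegerSolver R
  private additive = DirectProduct.abelianGroup +-abelianGroup +-abelianGroup

  extension : CommutativeRing c ℓ
  extension = record
    { Carrier = Carrier × Carrier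
    ; _≈_ = AbelianGroup._≈_ additive
    ; _+_ = AbelianGroup._∙_ additive
    ; _*_ = λ (u , v) (u′ , v′) → u * u′ + e * (v * v′) , u * v′ + v * u′ + s * (v * v′)
    ; -_  = AbelianGroup._⁻¹ additive
    ; 0#  = 0# , 0#
    ; 1#  = 1# , 0#
    ; isCommutativeRing = record
      { isRing = record
        { +-isAbelianGroup = AbelianGroup.isAbelianGroup additive
        ; *-cong = λ (p , q) (p′ , q′) →
            +-cong (*-cong p p′) (*-congˡ (*-cong q q′)) ,
            +-cong (+-cong (*-cong p q′) (*-cong q p′)) (*-congˡ (*-cong q q′))
        ; *-assoc = λ (a , b) (a′ , b′) (a″ , b″) →
            solve 8 (λ s e a b a′ b′ a″ b″ → re s e (mul s e (mul s e (a , b) (a′ , b′)) (a″ , b″))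
                                          := re s e (mul s e (a , b) (mul s e (a′ , b′) (a″ , b″)))) refl s e a b a′ b′ a″ b″ ,
            solve 8 (λ s e a b a′ b′ a″ b″ → im s e (mul s e (mul s e (a , b) (a′ , b′)) (a″ , b″))
                                          := im s e (mul s e (a , b) (mul s e (a′ , b′) (a″ , b″)))) refl s e a b a′ b′ a″ b″
        ; *-identity =
            (λ (a , b) → solve 3 (λ e a b → con ℤ.1ℤ :* a :+ e :* (con ℤ.0ℤ :* b) := a) refl e a b ,
                         solve 3 (λ s a b → con ℤ.1ℤ :* b :+ con ℤ.0ℤ :* a :+ s :* (con ℤ.0ℤ :* b) := b) refl s a b) ,
            (λ (a , b) → solve 3 (λ e a b → a :* con ℤ.1ℤ :+ e :* (b :* con ℤ.0ℤ) := a) refl e a b ,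
                         solve 3 (λ s a b → a :* con ℤ.0ℤ :+ b :* con ℤ.1ℤ :+ s :* (b :* con ℤ.0ℤ) := b) refl s a b)
        ; distrib =
            (λ (a , b) (a′ , b′) (a″ , b″) →
              solve 7 (λ e a b a′ b′ a″ b″ → a :* (a′ :+ a″) :+ e :* (b :* (b′ :+ b″))
                := (a :* a′ :+ e :* (b :* b′)) :+ (a :* a″ :+ e :* (b :* b″))) refl e a b a′ b′ a″ b″ ,
              solve 7 (λ s a b a′ b′ a″ b″ → a :* (b′ :+ b″) :+ b :* (a′ :+ a″) :+ s :* (b :* (b′ :+ b″))
                := (a :* b′ :+ b :* a′ :+ s :* (b :* b′)) :+ (a :* b″ :+ b :* a″ :+ s :* (b :* b″))) refl s a b a′ b′ a″ b″) ,
            (λ (a , b) (a′ , b′) (a″ , b″) →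
              solve 7 (λ e a b a′ b′ a″ b″ → (a′ :+ a″) :* a :+ e :* ((b′ :+ b″) :* b)
                := (a′ :* a :+ e :* (b′ :* b)) :+ (a″ :* a :+ e :* (b″ :* b))) refl e a b a′ b′ a″ b″ ,
              solve 7 (λ s a b a′ b′ a″ b″ → (a′ :+ a″) :* b :+ (b′ :+ b″) :* a :+ s :* ((b′ :+ b″) :* b)
                := (a′ :* b :+ b′ :* a :+ s :* (b′ :* b)) :+ (a″ :* b :+ b″ :* a :+ s :* (b″ :* b))) refl s a b a′ b′ a″ b″)
        }
      ; *-comm = λ (a , b) (a′ , b′) →
          solve 5 (λ e a b a′ b′ → a :* a′ :+ e :* (b :* b′) := a′ :* a :+ e :* (b′ :* b)) refl e a b a′ b′ ,
          solve 5 (λ s a b a′ b′ → a :* b′ :+ b :* a′ :+ s :* (b :* b′) := a′ :* b :+ b′ :* a :+ s :* (b′ :* b)) refl s a b a′ b′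
      }
    }
    where
    module _ {k : ℕ} where
      Pair = Polynomial k × Polynomial k
      mul : (s e : Polynomial k) → Pair → Pair → Pair
      mul s e (u , v) (u′ , v′) = u :* u′ :+ e :* (v :* v′) , u :* v′ :+ v :* u′ :+ s :* (v :* v′)
      re im : (s e : Polynomial k) → Pair → Polynomial k
      re _ _ = proj₁
      im _ _ = proj₂

  module E = CommutativeRing extension

  Y : E.Carrier
  Y = 0# , 1#

  ι : Carrier → E.Carrier
  ι a = a , 0#

  -- This is the product of u + vY and its conjugate u + v(s - Y), expanded by Y(s - Y) = -e.
  norm : E.Carrier → Carrier
  norm (u , v) = u * u + s * (u * v) - e * (v * v)

  norm-* : ∀ a b → norm (a E.* b) ≈ norm a * norm b
  norm-* (a , b) (a′ , b′) = solve 6 (λ s e a b a′ b′ →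
    let u = a :* a′ :+ e :* (b :* b′); v = a :* b′ :+ b :* a′ :+ s :* (b :* b′) in
    u :* u :+ s :* (u :* v) :- e :* (v :* v) :=
    (a :* a :+ s :* (a :* b) :- e :* (b :* b)) :* (a′ :* a′ :+ s :* (a′ :* b′) :- e :* (b′ :* b′)))
    refl s e a b a′ b′

  norm-cong : ∀ {a b} → a E.≈ b → norm a ≈ norm b
  norm-cong (p , q) = +-cong (+-cong (*-cong p p) (*-congˡ (*-cong p q))) (-‿cong (*-congˡ (*-cong q q)))

  norm-0 : norm E.0# ≈ 0#
  norm-0 = solve 2 (λ s e → con ℤ.0ℤ :* con ℤ.0ℤ :+ s :* (con ℤ.0ℤ :* con ℤ.0ℤ) :- e :* (con ℤ.0ℤ :* con ℤ.0ℤ) := con ℤ.0ℤ) refl s e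

  Y*Y≈sY+e : Y E.* Y E.≈ ι s E.* Y E.+ ι e
  Y*Y≈sY+e =
    solve 2 (λ s e → con ℤ.0ℤ :* con ℤ.0ℤ :+ e :* (con ℤ.1ℤ :* con ℤ.1ℤ) := s :* con ℤ.0ℤ :+ e :* (con ℤ.0ℤ :* con ℤ.1ℤ) :+ e) refl s e ,
    solve 1 (λ s → con ℤ.0ℤ :* con ℤ.1ℤ :+ con ℤ.1ℤ :* con ℤ.0ℤ :+ s :* (con ℤ.1ℤ :* con ℤ.1ℤ) := s :* con ℤ.1ℤ :+ con ℤ.0ℤ :* con ℤ.0ℤ :+ s :* (con ℤ.0ℤ :* con ℤ.1ℤ) :+ con ℤ.0ℤ) refl s

  Y*[u,v] : ∀ u v → Y E.* (u , v) E.≈ (e * v , u + s * v)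
  Y*[u,v] u v =
    solve 3 (λ e u v → con ℤ.0ℤ :* u :+ e :* (con ℤ.1ℤ :* v) := e :* v) refl e u v ,
    solve 3 (λ s u v → con ℤ.0ℤ :* v :+ con ℤ.1ℤ :* u :+ s :* (con ℤ.1ℤ :* v) := u :+ s :* v) refl s u v

  open import Algebra.Properties.Semiring.Mult semiring renaming (_×_ to _·_)
  open import Algebra.Properties.CommutativeSemiring.Exp commutativeSemiring
  open import Algebra.Properties.CommutativeSemiring.Exp E.commutativeSemiring using () renaming (_^_ to _^ᴱ_)
  open import Algebra.Properties.Semiring.Mult E.semiring using () renaming (_×_ to _·ᴱ_)

  ι-* : ∀ a b → ι (a * b) E.≈ ι a E.* ι b
  ι-* a b = solve 3 (λ e a b → a :* b := a :* b :+ e :* (con ℤ.0ℤ :* con ℤ.0ℤ)) refl e a b ,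
            solve 3 (λ s a b → con ℤ.0ℤ := a :* con ℤ.0ℤ :+ con ℤ.0ℤ :* b :+ s :* (con ℤ.0ℤ :* con ℤ.0ℤ)) refl s a b

  ι-^ : ∀ a k → ι (a ^ k) E.≈ ι a ^ᴱ k
  ι-^ a zero    = E.refl
  ι-^ a (suc k) = E.trans (ι-* a (a ^ k)) (E.*-congˡ (ι-^ a k))

  ι-characteristic : ∀ {p} → p · 1# ≈ 0# → p ·ᴱ E.1# E.≈ E.0#
  ι-characteristic {p} p1≈0 = E.trans (ι-× p) (p1≈0 , refl)
    where
    ι-× : ∀ k → k ·ᴱ E.1# E.≈ ι (k · 1#)
    ι-× zero    = E.refl
    ι-× (suc k) = E.trans (E.+-congˡ (ι-× k)) (refl , +-identityʳ 0#)

-- Kept general because it serves twice: in the field itself, for the roots of the quadratic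
-- equation, and in the extension that would be a domain if there were no root.
module QuadraticConjugate {c ℓ} (R : CommutativeRing c ℓ) where
  open CommutativeRing R hiding (zero)
  open IntegerSolver R
  open import Algebra.Properties.CommutativeSemiring.Exp commutativeSemiring
  open import Algebra.Properties.Group +-group using (∙-cancelˡ; x∙y⁻¹≈ε⇒x≈y)
  open import Relation.Binary.Reasoning.Setoid setoid

  difference-factors : ∀ {x y s e} → x * x ≈ s * x + e → y * y ≈ s * y + e → (x - y) * (x + y - s) ≈ 0#
  difference-factors {x} {y} {s} {e} x-root y-root = begin
    (x - y) * (x + y - s)
      ≈⟨ solve 4 (λ x y s e → (x :- y) :* (x :+ y :- s) :=
            (x :* x :- (s :* x :+ e)) :- (y :* y :- (s :* y :+ e))) refl x y s e ⟩
    (x * x - (s * x + e)) - (y * y - (s * y + e))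
      ≈⟨ +-cong (+-congʳ x-root) (-‿cong (+-congʳ y-root)) ⟩
    ((s * x + e) - (s * x + e)) - ((s * y + e) - (s * y + e))
      ≈⟨ solve 2 (λ a b → (a :- a) :- (b :- b) := con ℤ.0ℤ) refl _ _ ⟩
    0# ∎

  fixed-iterate : ∀ {x m} → x ^ m ≈ x → ∀ k → x ^ (m ℕ.^ k) ≈ x
  fixed-iterate             eq zero    = *-identityʳ _
  fixed-iterate {x} {m} eq (suc k) = trans (sym (^-assocʳ x m (m ℕ.^ k)))
    (trans (^-congˡ (m ℕ.^ k) eq) (fixed-iterate eq k))

  module _ {q} (frobenius : ∀ x y → (x + y) ^ q ≈ x ^ q + y ^ q)
           (zero-product : ∀ {x y} → x * y ≈ 0# → x ≈ 0# ⊎ y ≈ 0#) where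

    module _ {y s e} (y-root : y * y ≈ s * y + e) (s^q≈s : s ^ q ≈ s) (e^q≈e : e ^ q ≈ e) where

      conjugate-root : y ^ q * y ^ q ≈ s * y ^ q + e
      conjugate-root = begin
        y ^ q * y ^ q              ≈⟨ ^-distrib-* y y q ⟨
        (y * y) ^ q                ≈⟨ ^-congˡ q y-root ⟩
        (s * y + e) ^ q            ≈⟨ frobenius _ _ ⟩
        (s * y) ^ q + e ^ q        ≈⟨ +-cong (^-distrib-* s y q) e^q≈e ⟩
        s ^ q * y ^ q + e          ≈⟨ +-congʳ (*-congʳ s^q≈s) ⟩
        s * y ^ q + e              ∎

      conjugate-cases : y ^ q ≈ y ⊎ y ^ q + y ≈ s
      conjugate-cases = Sum.map (x∙y⁻¹≈ε⇒x≈y _ _) (x∙y⁻¹≈ε⇒x≈y _ _)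
        (zero-product (difference-factors conjugate-root y-root))

      conjugate-involutive : (y ^ q) ^ q ≈ y
      conjugate-involutive = [ (λ y^q≈y → trans (^-congˡ q y^q≈y) y^q≈y) , swapped ]′ conjugate-cases
        where
        swapped : y ^ q + y ≈ s → (y ^ q) ^ q ≈ y
        swapped y^q+y≈s = ∙-cancelˡ (y ^ q) _ _ (begin
          y ^ q + (y ^ q) ^ q      ≈⟨ +-comm _ _ ⟩
          (y ^ q) ^ q + y ^ q      ≈⟨ frobenius _ _ ⟨
          (y ^ q + y) ^ q          ≈⟨ ^-congˡ q y^q+y≈s ⟩
          s ^ q                    ≈⟨ s^q≈s ⟩
          s                        ≈⟨ y^q+y≈s ⟨
          y ^ q + y                ∎)

      root-fixed : ∀ k → y ^ ((q ℕ.^ 2) ℕ.^ k) ≈ y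
      root-fixed = fixed-iterate (begin
        y ^ (q ℕ.* (q ℕ.* 1))    ≡⟨ ≡.cong (λ m → y ^ (q ℕ.* m)) (ℕ.*-identityʳ q) ⟩
        y ^ (q ℕ.* q)            ≈⟨ ^-assocʳ y q q ⟨
        (y ^ q) ^ q              ≈⟨ conjugate-involutive ⟩
        y                        ∎)

-- Finite fields: characteristic and multiplicative order.

module FieldProperties {c ℓ n} (F : FiniteField c ℓ n) where
  open FiniteField F hiding (zero)
  open Inverse enumerate
  open import Algebra.Properties.CommutativeSemiring.Exp commutativeSemiring
  open import Algebra.Properties.Semiring.Mult semiring renaming (_×_ to _·_)
  import Algebra.Properties.CommutativeMonoid.Sum +-commutativeMonoid as Addition
  import Algebra.Properties.CommutativeMonoid.Sum *-commutativeMonoid as Multiplication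
  open import Algebra.Properties.Group +-group using (∙-cancelˡ; x∙y⁻¹≈ε⇒x≈y)
  open import Relation.Binary.Reasoning.Setoid setoid
  open IntegerSolver commutativeRing

  infix 4 _≟_
  _≟_ : ∀ x y → Dec (x ≈ y)
  x ≟ y = map′ (λ eq → trans (sym (strictlyInverseʳ x)) (trans (reflexive (≡.cong from eq)) (strictlyInverseʳ y)))
               to-cong (to x Fin.≟ to y)

  any? : ∀ {p} {P : Pred Carrier p} → P Respects _≈_ → Decidable P → Dec (∃ P)
  any? resp P? = map′ (λ (i , pi) → from i , pi)
                      (λ (x , px) → to x , resp (sym (strictlyInverseʳ x)) px)
                      (Fin.any? (P? ∘ from))

  ¬∀⇒∃≉0 : ∀ {f : Carrier → Carrier} → f Preserves _≈_ ⟶ _≈_ → ¬ (∀ x → f x ≈ 0#) → ∃ λ x → f x ≉ 0#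
  ¬∀⇒∃≉0 {f} f-cong ¬all with any? (λ x≈y fx≉0 fy≈0 → fx≉0 (trans (f-cong x≈y) fy≈0)) (λ x → ¬? (f x ≟ 0#))
  ... | yes p = p
  ... | no ¬p = contradiction (λ x → decidable-stable (f x ≟ 0#) (λ fx≉0 → ¬p (x , fx≉0))) ¬all

  infix 9 _⁻¹⟨_⟩
  _⁻¹⟨_⟩ : ∀ x → x ≉ 0# → Carrier
  x ⁻¹⟨ x≉0 ⟩ = proj₁ (invertible x x≉0)

  ⁻¹-inverseˡ : ∀ {x} (x≉0 : x ≉ 0#) → x ⁻¹⟨ x≉0 ⟩ * x ≈ 1#
  ⁻¹-inverseˡ x≉0 = proj₁ (proj₂ (invertible _ x≉0))

  ⁻¹-inverseʳ : ∀ {x} (x≉0 : x ≉ 0#) → x * x ⁻¹⟨ x≉0 ⟩ ≈ 1#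
  ⁻¹-inverseʳ x≉0 = proj₂ (proj₂ (invertible _ x≉0))

  divide-* : ∀ x {y} (y≉0 : y ≉ 0#) → divide x y y≉0 * y ≈ x
  divide-* x y≉0 = trans (*-assoc _ _ _) (trans (*-congˡ (⁻¹-inverseˡ y≉0)) (*-identityʳ x))

  *-cancelˡ : ∀ {x y z} → x ≉ 0# → x * y ≈ x * z → y ≈ z
  *-cancelˡ {x} {y} {z} x≉0 xy≈xz = begin
    y                       ≈⟨ *-identityˡ y ⟨
    1# * y                  ≈⟨ *-congʳ (⁻¹-inverseˡ x≉0) ⟨
    x ⁻¹⟨ x≉0 ⟩ * x * y     ≈⟨ *-assoc _ _ _ ⟩
    x ⁻¹⟨ x≉0 ⟩ * (x * y)   ≈⟨ *-congˡ xy≈xz ⟩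
    x ⁻¹⟨ x≉0 ⟩ * (x * z)   ≈⟨ *-assoc _ _ _ ⟨
    x ⁻¹⟨ x≉0 ⟩ * x * z     ≈⟨ *-congʳ (⁻¹-inverseˡ x≉0) ⟩
    1# * z                  ≈⟨ *-identityˡ z ⟩
    z                       ∎

  *-cancelˡ-0 : ∀ {x y} → x ≉ 0# → x * y ≈ 0# → y ≈ 0#
  *-cancelˡ-0 x≉0 xy≈0 = *-cancelˡ x≉0 (trans xy≈0 (sym (zeroʳ _)))

  *-≉0 : ∀ {x y} → x ≉ 0# → y ≉ 0# → x * y ≉ 0#
  *-≉0 x≉0 y≉0 xy≈0 = y≉0 (*-cancelˡ-0 x≉0 xy≈0)

  zero-product : ∀ {x y} → x * y ≈ 0# → x ≈ 0# ⊎ y ≈ 0#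
  zero-product {x} xy≈0 with x ≟ 0#
  ... | yes x≈0 = inj₁ x≈0
  ... | no  x≉0 = inj₂ (*-cancelˡ-0 x≉0 xy≈0)

  ^-≉0 : ∀ {x} → x ≉ 0# → ∀ k → x ^ k ≉ 0#
  ^-≉0 x≉0 zero    = 0≉1 ∘ sym
  ^-≉0 x≉0 (suc k) = *-≉0 x≉0 (^-≉0 x≉0 k)

  x≈0⇒x^n≈0 : ∀ {x} k → 1 ≤ k → x ≈ 0# → x ^ k ≈ 0#
  x≈0⇒x^n≈0 (suc k) _ x≈0 = trans (*-congʳ x≈0) (zeroˡ _)

  ≉⇒-≉0 : ∀ {x y} → x ≉ y → x - y ≉ 0#
  ≉⇒-≉0 x≉y x-y≈0 = x≉y (x∙y⁻¹≈ε⇒x≈y _ _ x-y≈0)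

  private
    -- Carries a bijection of the field over to the index set, under whose permutations sums and
    -- products are invariant.
    reindex : (g h : Carrier → Carrier) → g Preserves _≈_ ⟶ _≈_ → h Preserves _≈_ ⟶ _≈_ →
              (∀ x → g (h x) ≈ x) → (∀ x → h (g x) ≈ x) → Permutation n n
    reindex g h g-cong h-cong gh hg = permutation (to ∘ g ∘ from) (to ∘ h ∘ from)
      (roundTrip g-cong gh) (roundTrip h-cong hg)
      where
      roundTrip : ∀ {g h : Carrier → Carrier} → g Preserves _≈_ ⟶ _≈_ → (∀ x → g (h x) ≈ x) →
                  ∀ i → to (g (from (to (h (from i))))) ≡ i
      roundTrip {g} {h} g-cong gh i = ≡.trans
        (to-cong (trans (g-cong (strictlyInverseʳ (h (from i)))) (gh (from i))))
        (strictlyInverseˡ i)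

  -- Adding 1 permutes the field, so the sum S of all elements satisfies S + n·1 = S.
  order·1≈0 : n · 1# ≈ 0#
  order·1≈0 = ∙-cancelˡ (Addition.sum from) _ _ (begin
    Addition.sum from + n · 1#                            ≈⟨ +-congˡ (Addition.sum-replicate n) ⟨
    Addition.sum from + Addition.sum {n} (λ _ → 1#)            ≈⟨ Addition.∑-distrib-+ from (λ _ → 1#) ⟨
    Addition.sum (λ i → from i + 1#)                      ≈⟨ Addition.sum-cong-≋ (λ i → strictlyInverseʳ (from i + 1#)) ⟨
    Addition.sum (λ i → from (π ⟨$⟩ʳ i))                  ≈⟨ Addition.sum-permute from π ⟨
    Addition.sum from                                     ≈⟨ +-identityʳ _ ⟨
    Addition.sum from + 0#                                ∎)
    where
    π = reindex (_+ 1#) (_- 1#) +-congʳ +-congʳ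
          (solve 1 (λ x → x :- con ℤ.1ℤ :+ con ℤ.1ℤ := x) refl)
          (solve 1 (λ x → x :+ con ℤ.1ℤ :- con ℤ.1ℤ := x) refl)

  -- Since n·1 is the k-th power of p·1 and a field has no nilpotents, p·1 vanishes together with
  -- n·1.
  characteristic : ∀ {p} k → n ≡ p ℕ.^ k → p · 1# ≈ 0#
  characteristic {p} k n≡p^k = decidable-stable (p · 1# ≟ 0#) λ p1≉0 → ^-≉0 p1≉0 k
    (trans (sym (power k)) (trans (×-congˡ (≡.sym n≡p^k)) order·1≈0))
    where
    power : ∀ k → (p ℕ.^ k) · 1# ≈ (p · 1#) ^ k
    power zero    = +-identityʳ 1#
    power (suc k) = trans (×1-homo-* p (p ℕ.^ k)) (*-congˡ (power k))

  order≥1 : 1 ≤ n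
  order≥1 = ℕ.≤-trans (s≤s z≤n) (Fin.toℕ<n (to 0#))

  private
    -- Multiplication by x fixes 0 and hence permutes the m nonzero elements. Their product is
    -- therefore x^m times itself, and it can be cancelled.
    lagrange : ∀ {m} → n ≡ suc m → ∀ {x} → x ≉ 0# → x ^ m ≈ 1#
    lagrange {m} ≡.refl {x} x≉0 = sym (*-cancelˡ (∏≉0 m units units≉0) (begin
      Multiplication.sum units * 1#                            ≈⟨ *-identityʳ _ ⟩
      Multiplication.sum units                                 ≈⟨ Multiplication.sum-permute units (remove i₀ π) ⟩
      Multiplication.sum (λ j → units (remove i₀ π ⟨$⟩ʳ j))    ≈⟨ Multiplication.sum-cong-≋ permuted ⟩
      Multiplication.sum (λ j → x * units j)                   ≈⟨ Multiplication.∑-distrib-+ (λ _ → x) units ⟩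
      Multiplication.sum {m} (λ _ → x) * Multiplication.sum units     ≈⟨ *-congʳ (Multiplication.sum-replicate m) ⟩
      x ^ m * Multiplication.sum units                         ≈⟨ *-comm _ _ ⟩
      Multiplication.sum units * x ^ m                         ∎))
      where
      i₀ = to 0#
      units : Fin m → Carrier
      units j = from (punchIn i₀ j)
      units≉0 : ∀ j → units j ≉ 0#
      units≉0 j eq = Fin.punchInᵢ≢i i₀ j (≡.trans (≡.sym (strictlyInverseˡ _)) (to-cong eq))
      ∏≉0 : ∀ k (f : Fin k → Carrier) → (∀ i → f i ≉ 0#) → Multiplication.sum f ≉ 0#
      ∏≉0 zero    f f≉0 = 0≉1 ∘ sym
      ∏≉0 (suc k) f f≉0 = *-≉0 (f≉0 zero) (∏≉0 k (f ∘ suc) (f≉0 ∘ suc))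
      cancelInverse : ∀ {a b} → a * b ≈ 1# → ∀ y → a * (b * y) ≈ y
      cancelInverse ab≈1 y = trans (sym (*-assoc _ _ _)) (trans (*-congʳ ab≈1) (*-identityˡ y))
      π = reindex (x *_) (x ⁻¹⟨ x≉0 ⟩ *_) *-congˡ *-congˡ
            (cancelInverse (⁻¹-inverseʳ x≉0)) (cancelInverse (⁻¹-inverseˡ x≉0))
      π-fixes-i₀ : π ⟨$⟩ʳ i₀ ≡ i₀
      π-fixes-i₀ = to-cong (trans (*-congˡ (strictlyInverseʳ 0#)) (zeroʳ x))
      permuted : ∀ j → units (remove i₀ π ⟨$⟩ʳ j) ≈ x * units j
      permuted j = begin
        from (punchIn i₀ (remove i₀ π ⟨$⟩ʳ j))           ≡⟨ ≡.cong (λ i → from (punchIn i (remove i₀ π ⟨$⟩ʳ j))) π-fixes-i₀ ⟨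
        from (punchIn (π ⟨$⟩ʳ i₀) (remove i₀ π ⟨$⟩ʳ j))  ≡⟨ ≡.cong from (punchIn-permute π i₀ j) ⟨
        from (π ⟨$⟩ʳ punchIn i₀ j)                       ≈⟨ strictlyInverseʳ _ ⟩
        x * units j                                      ∎

  x^[order-1]≈1 : ∀ {x} → x ≉ 0# → x ^ (n ∸ 1) ≈ 1#
  x^[order-1]≈1 = lagrange (≡.sym (ℕ.m+[n∸m]≡n order≥1))

  x^order≈x : ∀ x → x ^ n ≈ x
  x^order≈x x with x ≟ 0#
  ... | yes x≈0 = trans (x≈0⇒x^n≈0 n order≥1 x≈0) (sym x≈0)
  ... | no  x≉0 = begin
    x ^ n               ≡⟨ ≡.cong (x ^_) (ℕ.m+[n∸m]≡n order≥1) ⟨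
    x * x ^ (n ∸ 1)     ≈⟨ *-congˡ (x^[order-1]≈1 x≉0) ⟩
    x * 1#              ≈⟨ *-identityʳ x ⟩
    x                   ∎

  -- Polynomial functions and their leading coefficients.

  horner : ∀ {d} → Carrier → Vec Carrier d → Carrier → Carrier
  horner a []       x = a
  horner a (c ∷ cs) x = c + x * horner a cs x

  -- f is a polynomial function of formal degree at most d, with coefficient a at X^d.
  HasTop : ℕ → Carrier → (Carrier → Carrier) → Set (c ⊔ ℓ)
  HasTop d a f = ∃ λ (cs : Vec Carrier d) → ∀ x → f x ≈ horner a cs x

  divide-root : ∀ {d} a (cs : Vec Carrier (suc d)) r →
    ∃ λ (ds : Vec Carrier d) → ∀ x → horner a cs x ≈ horner a cs r + (x - r) * horner a ds x
  divide-root a (c ∷ []) r = [] ,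
    λ x → solve 4 (λ a c r x → c :+ x :* a := c :+ r :* a :+ (x :- r) :* a) refl a c r x
  divide-root a (c ∷ cs@(_ ∷ _)) r with ds , eq ← divide-root a cs r =
    horner a cs r ∷ ds , λ x → trans (+-congˡ (*-congˡ (eq x)))
      (solve 5 (λ c r x h k → c :+ x :* (h :+ (x :- r) :* k) := c :+ r :* h :+ (x :- r) :* (h :+ x :* k))
         refl c r x (horner a cs r) (horner a ds x))

  too-many-roots : ∀ {d a} (cs : Vec Carrier d) (r : Fin (suc d) → Carrier) →
    (∀ {i j} → r i ≈ r j → i ≡ j) → (∀ i → horner a cs (r i) ≈ 0#) → a ≈ 0#
  too-many-roots []          r r-inj roots = roots zero
  too-many-roots {a = a} cs@(_ ∷ _) r r-inj roots with ds , eq ← divide-root a cs (r zero) =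
    too-many-roots ds (r ∘ suc) (Fin.suc-injective ∘ r-inj) λ i → *-cancelˡ-0
      (≉⇒-≉0 (λ eq → Fin.0≢1+n (≡.sym (r-inj eq))))
      (begin
        (r (suc i) - r zero) * horner a ds (r (suc i))                           ≈⟨ +-identityˡ _ ⟨
        0# + (r (suc i) - r zero) * horner a ds (r (suc i))                      ≈⟨ +-congʳ (roots zero) ⟨
        horner a cs (r zero) + (r (suc i) - r zero) * horner a ds (r (suc i))    ≈⟨ eq (r (suc i)) ⟨
        horner a cs (r (suc i))                                                  ≈⟨ roots (suc i) ⟩
        0#                                                                       ∎)

  -- The first d + 1 elements of the enumeration are already too many roots. Read contrapositively,
  -- this finds points where a function does not vanish from its leading coefficient and its degree
  -- alone.
  vanishing⇒top≈0 : ∀ {d a f} → HasTop d a f → d < n → (∀ x → f x ≈ 0#) → a ≈ 0#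
  vanishing⇒top≈0 (cs , f≈) d<n f≈0 = too-many-roots cs (λ i → from (inject≤ i d<n))
    (λ eq → Fin.inject≤-injective d<n d<n _ _ (≡.trans (≡.sym (strictlyInverseˡ _)) (≡.trans (to-cong eq) (strictlyInverseˡ _))))
    (λ i → trans (sym (f≈ _)) (f≈0 _))

  top-const : ∀ a → HasTop 0 a (λ _ → a)
  top-const a = [] , λ _ → refl

  top-cong : ∀ {d a b f g} → a ≈ b → (∀ x → f x ≈ g x) → HasTop d a f → HasTop d b g
  top-cong {d} a≈b f≈g (cs , f≈) = cs , λ x → trans (sym (f≈g x)) (trans (f≈ x) (horner-cong cs x))
    where
    horner-cong : ∀ {d} (cs : Vec Carrier d) x → horner _ cs x ≈ horner _ cs x
    horner-cong []       x = a≈b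
    horner-cong (c ∷ cs) x = +-congˡ (*-congˡ (horner-cong cs x))

  top-raise : ∀ {d e a f} → d < e → HasTop d a f → HasTop e 0# f
  top-raise d<e (cs , f≈) = let ds , eq = pad _ d<e cs in ds , λ x → trans (f≈ x) (eq x)
    where
    zeros : ∀ e → ∃ λ (ds : Vec Carrier e) → ∀ x → horner 0# ds x ≈ 0#
    zeros zero    = [] , λ _ → refl
    zeros (suc e) with ds , eq ← zeros e = 0# ∷ ds , λ x → trans (+-identityˡ _) (trans (*-congˡ (eq x)) (zeroʳ x))
    pad : ∀ {d e} a → d < e → (cs : Vec Carrier d) → ∃ λ (ds : Vec Carrier e) → ∀ x → horner a cs x ≈ horner 0# ds x
    pad {e = suc e} a _ [] with ds , eq ← zeros e =
      a ∷ ds , λ x → sym (trans (+-congˡ (trans (*-congˡ (eq x)) (zeroʳ x))) (+-identityʳ a))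
    pad a (s≤s d<e) (c ∷ cs) with ds , eq ← pad a d<e cs = c ∷ ds , λ x → +-congˡ (*-congˡ (eq x))

  top-+ : ∀ {d a b f g} → HasTop d a f → HasTop d b g → HasTop d (a + b) (λ x → f x + g x)
  top-+ {a = a} {b} (cs , f≈) (ds , g≈) = let es , eq = add cs ds in es , λ x → trans (+-cong (f≈ x) (g≈ x)) (eq x)
    where
    add : ∀ {d} (cs ds : Vec Carrier d) → ∃ λ (es : Vec Carrier d) → ∀ x → horner a cs x + horner b ds x ≈ horner (a + b) es x
    add [] [] = [] , λ _ → refl
    add (c ∷ cs) (d ∷ ds) with es , eq ← add cs ds = c + d ∷ es , λ x → trans
      (solve 5 (λ c d x h k → c :+ x :* h :+ (d :+ x :* k) := c :+ d :+ x :* (h :+ k)) refl c d x _ _)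
      (+-congˡ (*-congˡ (eq x)))

  top-scale : ∀ {d a f} b → HasTop d a f → HasTop d (b * a) (λ x → b * f x)
  top-scale {a = a} b (cs , f≈) = let ds , eq = scale cs in ds , λ x → trans (*-congˡ (f≈ x)) (eq x)
    where
    scale : ∀ {d} (cs : Vec Carrier d) → ∃ λ (ds : Vec Carrier d) → ∀ x → b * horner a cs x ≈ horner (b * a) ds x
    scale [] = [] , λ _ → refl
    scale (c ∷ cs) with ds , eq ← scale cs = b * c ∷ ds , λ x → trans
      (solve 4 (λ b c x h → b :* (c :+ x :* h) := b :* c :+ x :* (b :* h)) refl b c x _)
      (+-congˡ (*-congˡ (eq x)))

  top-X* : ∀ {d a f} → HasTop d a f → HasTop (suc d) a (λ x → x * f x)
  top-X* (cs , f≈) = 0# ∷ cs , λ x → trans (*-congˡ (f≈ x)) (sym (+-identityˡ _))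

  top-neg : ∀ {d a f} → HasTop d a f → HasTop d (- a) (λ x → - f x)
  top-neg {a = a} {f} top = top-cong (neg a) (λ x → neg (f x)) (top-scale (- 1#) top)
    where
    neg : ∀ x → - 1# * x ≈ - x
    neg = solve 1 (λ x → (:- con ℤ.1ℤ) :* x := :- x) refl

  top-+ʳ : ∀ {d e a b f g} → d < e → HasTop d a f → HasTop e b g → HasTop e b (λ x → f x + g x)
  top-+ʳ d<e f-top g-top = top-cong (+-identityˡ _) (λ _ → refl) (top-+ (top-raise d<e f-top) g-top)

  top-* : ∀ {d e a b f g} → HasTop d a f → HasTop e b g → HasTop (d ℕ.+ e) (a * b) (λ x → f x * g x)
  top-* {e = e} {a} {b} {g = g} (cs , f≈) gTop = top-cong refl (λ x → *-congʳ (sym (f≈ x))) (mul cs)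
    where
    mul : ∀ {d} (cs : Vec Carrier d) → HasTop (d ℕ.+ e) (a * b) (λ x → horner a cs x * g x)
    mul [] = top-scale a gTop
    mul {suc d} (c ∷ cs) = top-cong (+-identityˡ _)
      (λ x → solve 4 (λ c x h g → c :* g :+ x :* (h :* g) := (c :+ x :* h) :* g) refl c x (horner a cs x) (g x))
      (top-+ (top-raise (s≤s (ℕ.m≤n+m e d)) (top-scale c gTop)) (top-X* (mul cs)))

  top-^ : ∀ k → HasTop k 1# (_^ k)
  top-^ zero    = top-const 1#
  top-^ (suc k) = top-X* (top-^ k)

  -- Roots of X^b - δ and of quadratic polynomials.

  -- X^(ba) − δ^a = (X^b − δ) h(X) with deg h = b(a − 1), so h does not vanish
  -- identically on the nonzero elements, on all of which the left side vanishes.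
  power-root : ∀ a b {δ} → 1 ≤ b → b ℕ.* a ≡ n ∸ 1 → δ ^ a ≈ 1# → ∃ λ x → x ≉ 0# × x ^ b ≈ δ
  power-root a b {δ} 1≤b b*a≡n-1 δ^a≈1 with a
  ... | zero = contradiction (ℕ.≤-trans 2≤n (ℕ.≤-reflexive n≡1)) (ℕ.<⇒≱ (ℕ.n<1+n 1))
    where
    n≡1 : n ≡ 1
    n≡1 = ≡.trans (≡.sym (ℕ.m+[n∸m]≡n order≥1)) (≡.cong suc (≡.trans (≡.sym b*a≡n-1) (ℕ.*-zeroʳ b)))
    2≤n : 2 ≤ n
    2≤n = ℕ.≰⇒> λ n≤1 → 0≉1 (begin
      0#             ≈⟨ order·1≈0 ⟨
      n · 1#         ≡⟨ ≡.cong (_· 1#) n≡1 ⟩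
      1 · 1#         ≈⟨ +-identityʳ 1# ⟩
      1#             ∎)
  ... | suc a′ = x , x≉0 , x∙y⁻¹≈ε⇒x≈y _ _ (*-cancelˡ-0 h≉0 (trans (*-comm _ _) (begin
      (x ^ b - δ) * quotient (suc a′) (x ^ b)     ≈⟨ quotient-* (suc a′) (x ^ b) ⟩
      (x ^ b) ^ suc a′ - δ ^ suc a′               ≈⟨ +-cong (^-assocʳ x b (suc a′)) (-‿cong δ^a≈1) ⟩
      x ^ (b ℕ.* suc a′) - 1#                     ≡⟨ ≡.cong (λ k → x ^ k - 1#) b*a≡n-1 ⟩
      x ^ (n ∸ 1) - 1#                            ≈⟨ +-congʳ (x^[order-1]≈1 x≉0) ⟩
      1# - 1#                                     ≈⟨ -‿inverseʳ 1# ⟩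
      0#                                          ∎)))
    where
    quotient : ℕ → Carrier → Carrier
    quotient zero    z = 0#
    quotient (suc k) z = z * quotient k z + δ ^ k
    quotient-* : ∀ k z → (z - δ) * quotient k z ≈ z ^ k - δ ^ k
    quotient-* zero    z = trans (zeroʳ _) (sym (-‿inverseʳ 1#))
    quotient-* (suc k) z = begin
      (z - δ) * (z * quotient k z + δ ^ k)
        ≈⟨ solve 4 (λ z d h e → (z :- d) :* (z :* h :+ e) := z :* ((z :- d) :* h) :+ (z :- d) :* e) refl z δ _ _ ⟩
      z * ((z - δ) * quotient k z) + (z - δ) * δ ^ k
        ≈⟨ +-congʳ (*-congˡ (quotient-* k z)) ⟩
      z * (z ^ k - δ ^ k) + (z - δ) * δ ^ k
        ≈⟨ solve 4 (λ z d h e → z :* (h :- e) :+ (z :- d) :* e := z :* h :- d :* e) refl z δ _ _ ⟩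
      z ^ suc k - δ ^ suc k ∎
    quotient-cong : ∀ k {z w} → z ≈ w → quotient k z ≈ quotient k w
    quotient-cong zero    z≈w = refl
    quotient-cong (suc k) z≈w = +-congʳ (*-cong z≈w (quotient-cong k z≈w))
    quotient-top : ∀ k → HasTop (b ℕ.* k) 1# (λ x → quotient (suc k) (x ^ b))
    quotient-top zero rewrite ℕ.*-zeroʳ b =
      top-cong refl (λ x → sym (trans (+-congʳ (zeroʳ _)) (+-identityˡ _))) (top-const 1#)
    quotient-top (suc k) rewrite ℕ.*-suc b k =
      top-cong (trans (+-identityʳ _) (*-identityʳ _)) (λ x → refl)
        (top-+ (top-* (top-^ b) (quotient-top k))
               (top-raise (ℕ.<-≤-trans 1≤b (ℕ.m≤m+n b _)) (top-const (δ ^ suc k))))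
    -- The additional factor X makes the point found nonzero. The degree b(a - 1) + 1 still stays
    -- below n, as b ≥ 1 and ba = n - 1.
    nonroot : ∃ λ x → x * quotient (suc a′) (x ^ b) ≉ 0#
    nonroot = ¬∀⇒∃≉0 (λ x≈y → *-cong x≈y (quotient-cong (suc a′) (^-congˡ b x≈y)))
      λ all≈0 → 0≉1 (sym (vanishing⇒top≈0 (top-X* (quotient-top a′)) degree<n all≈0))
      where
      degree<n : suc (b ℕ.* a′) < n
      degree<n = ℕ.≤-trans (s≤s (≡.subst (b ℕ.* a′ <_) (≡.trans (≡.sym (ℕ.*-suc b a′)) b*a≡n-1) (ℕ.m<n+m _ 1≤b)))
                           (ℕ.≤-reflexive (ℕ.m+[n∸m]≡n order≥1))
    x = proj₁ nonroot
    x≉0 : x ≉ 0#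
    x≉0 x≈0 = proj₂ nonroot (trans (*-congʳ x≈0) (zeroˡ _))
    h≉0 : quotient (suc a′) (x ^ b) ≉ 0#
    h≉0 h≈0 = proj₂ nonroot (trans (*-congˡ h≈0) (zeroʳ x))

  -- If there were no root, then F[Y]/(Y² − sY − e) would be a domain in which the
  -- Frobenius map permutes the roots Y and s − Y of the polynomial; hence Y^n = Y,
  -- that is, the polynomial divides X^n − X, which vanishes on F.
  quadratic-root : ∀ {p q} j → Prime p → p · 1# ≈ 0# → q ≡ p ℕ.^ j →
    ∀ k → n ≡ (q ℕ.^ 2) ℕ.^ k → 2 ≤ n →
    ∀ {s e} → s ^ q ≈ s → e ^ q ≈ e → ∃ λ y → y * y ≈ s * y + e
  quadratic-root {p} {q} j pp p1≈0 q≡p^j k n≡ 2≤n {s} {e} s^q≈s e^q≈e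
    with any? {P = λ y → y * y ≈ s * y + e}
      (λ x≈y eq → trans (sym (*-cong x≈y x≈y)) (trans eq (+-congʳ (*-congˡ x≈y)))) (λ y → (y * y) ≟ (s * y + e))
  ... | yes root = root
  ... | no ¬root = contradiction (sym 1≈0) 0≉1
    where
    open QuadraticExtension commutativeRing s e
    open E using () renaming (_≈_ to _≈ᴱ_; _*_ to _*ᴱ_)
    open import Algebra.Properties.CommutativeSemiring.Exp E.commutativeSemiring using () renaming (_^_ to _^ᴱ_)

    frobenius : ∀ x y → (x E.+ y) ^ᴱ q ≈ᴱ x ^ᴱ q E.+ y ^ᴱ q
    frobenius x y = ≡.subst (λ m → (x E.+ y) ^ᴱ m ≈ᴱ x ^ᴱ m E.+ y ^ᴱ m) (≡.sym q≡p^j)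
      (Frobenius.frobenius-+^ extension pp (ι-characteristic {p} p1≈0) j x y)

    ι-fixed : ∀ {a} → a ^ q ≈ a → ι a ^ᴱ q ≈ᴱ ι a
    ι-fixed {a} a^q≈a = E.trans {ι a ^ᴱ q} {ι (a ^ q)} {ι a} (E.sym {ι (a ^ q)} {ι a ^ᴱ q} (ι-^ a q)) (a^q≈a , refl)

    -- For v ≠ 0, dividing u² + suv - ev² = 0 by v² would make -u/v a root in the field. For v = 0
    -- the norm is u².
    norm≈0⇒≈0 : ∀ a → norm a ≈ 0# → a ≈ᴱ E.0#
    norm≈0⇒≈0 (u , v) norm≈0 with v ≟ 0#
    ... | yes v≈0 = [ (λ u≈0 → u≈0) , (λ u≈0 → u≈0) ]′ (zero-product (begin
        u * u                                    ≈⟨ solve 3 (λ s e u → u :* u := u :* u :+ s :* (u :* con ℤ.0ℤ) :- e :* (con ℤ.0ℤ :* con ℤ.0ℤ)) refl s e u ⟩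
        u * u + s * (u * 0#) - e * (0# * 0#)     ≈⟨ norm-cong (refl {u} , v≈0) ⟨
        norm (u , v)                             ≈⟨ norm≈0 ⟩
        0#                                       ∎)) , v≈0
    ... | no v≉0 = contradiction (y , x∙y⁻¹≈ε⇒x≈y _ _ (begin
        y * y - (s * y + e)
          ≈⟨ solve 5 (λ s e u w z → (:- (u :* w)) :* (:- (u :* w)) :- (s :* (:- (u :* w)) :+ e) :=
                w :* w :* (u :* u) :+ s :* (w :* u) :- e) refl s e u w v ⟩
        w * w * (u * u) + s * (w * u) - e
          ≈⟨ solve 3 (λ a b e → a :+ b :- e := a :+ b :* con ℤ.1ℤ :- e :* (con ℤ.1ℤ :* con ℤ.1ℤ)) refl _ _ e ⟩
        w * w * (u * u) + s * (w * u) * 1# - e * (1# * 1#)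
          ≈⟨ +-cong (+-congˡ (*-congˡ wv≈1)) (-‿cong (*-congˡ (*-cong wv≈1 wv≈1))) ⟨
        w * w * (u * u) + s * (w * u) * (w * v) - e * ((w * v) * (w * v))
          ≈⟨ solve 5 (λ s e u v w → w :* w :* (u :* u) :+ s :* (w :* u) :* (w :* v) :- e :* ((w :* v) :* (w :* v)) :=
                w :* w :* (u :* u :+ s :* (u :* v) :- e :* (v :* v))) refl s e u v w ⟩
        w * w * norm (u , v)
          ≈⟨ trans (*-congˡ norm≈0) (zeroʳ _) ⟩
        0# ∎)) ¬root
      where
      w = v ⁻¹⟨ v≉0 ⟩
      wv≈1 = ⁻¹-inverseˡ v≉0
      y = - (u * w)

    zero-productᴱ : ∀ {a b} → a *ᴱ b ≈ᴱ E.0# → a ≈ᴱ E.0# ⊎ b ≈ᴱ E.0#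
    zero-productᴱ {a} {b} ab≈0 = Sum.map (norm≈0⇒≈0 a) (norm≈0⇒≈0 b)
      (zero-product (trans (sym (norm-* a b)) (trans (norm-cong {a *ᴱ b} {E.0#} ab≈0) norm-0)))

    Y^n≈Y : Y ^ᴱ n ≈ᴱ Y
    Y^n≈Y = ≡.subst (λ m → Y ^ᴱ m ≈ᴱ Y) (≡.sym n≡)
      (QuadraticConjugate.root-fixed extension {q} frobenius
        (λ {a} {b} → zero-productᴱ {a} {b}) {Y} {ι s} {ι e} Y*Y≈sY+e (ι-fixed s^q≈s) (ι-fixed e^q≈e) k)

    -- Long division of X^(2+m) by X² - sX - e. The remainder u + vX and the value of Y^(2+m) in the
    -- extension obey the same recursion, so knowing that power of Y determines the remainder.
    division : ∀ m → ∃₂ λ u v → Y ^ᴱ (2 ℕ.+ m) ≈ᴱ (u , v) ×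
      ∃ λ h → HasTop m 1# h × ∀ x → x ^ (2 ℕ.+ m) ≈ (x * x - (s * x + e)) * h x + (u + v * x)
    division zero = e , s , Y² , (λ _ → 1#) , top-const 1# ,
        solve 3 (λ s e x → x :* (x :* con ℤ.1ℤ) := (x :* x :- (s :* x :+ e)) :* con ℤ.1ℤ :+ (e :+ s :* x)) refl s e
      where
      Y² : Y ^ᴱ 2 ≈ᴱ (e , s)
      Y² = E.trans {Y ^ᴱ 2} {Y *ᴱ Y} {e , s} (E.*-congˡ {Y} {Y ^ᴱ 1} {Y} (E.*-identityʳ Y))
             (E.trans {Y *ᴱ Y} {e * 1# , 0# + s * 1#} {e , s} (Y*[u,v] 0# 1#)
               (*-identityʳ e , trans (+-identityˡ _) (*-identityʳ s)))
    division (suc m) with u , v , eq , h , h-top , h-eq ← division m =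
      e * v , u + s * v ,
      E.trans {Y ^ᴱ (3 ℕ.+ m)} {Y *ᴱ (u , v)} {e * v , u + s * v} (E.*-congˡ {Y} {Y ^ᴱ (2 ℕ.+ m)} {u , v} eq) (Y*[u,v] u v) ,
      (λ x → x * h x + v) ,
      top-cong (+-identityʳ 1#) (λ _ → refl) (top-+ (top-X* h-top) (top-raise (s≤s z≤n) (top-const v))) ,
      λ x → trans (*-congˡ (h-eq x))
        (solve 6 (λ s e x h u v → x :* ((x :* x :- (s :* x :+ e)) :* h :+ (u :+ v :* x)) :=
           (x :* x :- (s :* x :+ e)) :* (x :* h :+ v) :+ (e :* v :+ (u :+ s :* v) :* x)) refl s e x (h x) u v)

    -- By `Y^n≈Y` the remainder of X^n is X. The quadratic factor is never 0 on the field, so the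
    -- monic quotient of degree n - 2 would have to vanish at all n elements.
    contradiction-from : ∃₂ (λ u v → Y ^ᴱ n ≈ᴱ (u , v) ×
      ∃ λ h → HasTop (n ∸ 2) 1# h × ∀ x → x ^ n ≈ (x * x - (s * x + e)) * h x + (u + v * x)) → 1# ≈ 0#
    contradiction-from (u , v , eq , h , h-top , h-eq) =
      vanishing⇒top≈0 h-top (ℕ.∸-monoʳ-< {n} {2} {0} (s≤s z≤n) 2≤n) λ x →
        *-cancelˡ-0 (λ root → ¬root (x , x∙y⁻¹≈ε⇒x≈y _ _ root)) (begin
          (x * x - (s * x + e)) * h x
            ≈⟨ solve 2 (λ a x → a := a :+ (con ℤ.0ℤ :+ con ℤ.1ℤ :* x) :- x) refl _ x ⟩
          (x * x - (s * x + e)) * h x + (0# + 1# * x) - x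
            ≈⟨ +-congʳ (+-congˡ (+-cong (trans (sym (proj₁ Y^n≈Y)) (proj₁ eq)) (*-congʳ (trans (sym (proj₂ Y^n≈Y)) (proj₂ eq))))) ⟩
          (x * x - (s * x + e)) * h x + (u + v * x) - x
            ≈⟨ +-congʳ (h-eq x) ⟨
          x ^ n - x
            ≈⟨ +-congʳ (x^order≈x x) ⟩
          x - x
            ≈⟨ -‿inverseʳ x ⟩
          0# ∎)

    1≈0 : 1# ≈ 0#
    1≈0 = contradiction-from (≡.subst
      (λ m → ∃₂ (λ u v → Y ^ᴱ m ≈ᴱ (u , v) ×
        ∃ λ h → HasTop (n ∸ 2) 1# h × ∀ x → x ^ m ≈ (x * x - (s * x + e)) * h x + (u + v * x)))
      (ℕ.m+[n∸m]≡n 2≤n) (division (n ∸ 2)))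

-- The Frobenius map of the field of order q⁶.

module Sextic {c ℓ} (q : ℕ) (q-primePower : IsPrimePower q) (F : FiniteField c ℓ (q ℕ.^ 6)) where
  open FiniteField F hiding (zero)
  open FieldProperties F
  open IntegerSolver commutativeRing
  open import Algebra.Properties.CommutativeSemiring.Exp commutativeSemiring
  open import Algebra.Properties.Semiring.Mult semiring using () renaming (_×_ to _·_)
  open import Algebra.Properties.AbelianGroup +-abelianGroup using (x∙y⁻¹≈ε⇒x≈y; inverseˡ-unique)
  open import Relation.Binary.Reasoning.Setoid setoid

  private
    p = proj₁ q-primePower
    j = proj₁ (proj₂ q-primePower)
    p-prime = proj₁ (proj₂ (proj₂ q-primePower))
    q≡p^j = proj₂ (proj₂ (proj₂ (proj₂ q-primePower)))

  2≤q : 2 ≤ q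
  2≤q = ℕ.≤-trans 2≤p p≤p^j
    where
    instance _ = prime⇒nonTrivial p-prime
    2≤p = ℕ.nonTrivial⇒n>1 p
    p≤p^j = ≡.subst₂ _≤_ (ℕ.^-identityʳ p) (≡.sym q≡p^j)
      (ℕ.^-monoʳ-≤ p {{ℕ.>-nonZero (ℕ.<⇒≤ 2≤p)}} (proj₁ (proj₂ (proj₂ (proj₂ q-primePower)))))

  p·1≈0 : p · 1# ≈ 0#
  p·1≈0 = characteristic (j ℕ.* 6) (≡.trans (≡.cong (ℕ._^ 6) q≡p^j) (ℕ.^-*-assoc p j 6))

  1≤q : 1 ≤ q
  1≤q = ℕ.≤-trans (s≤s z≤n) 2≤q

  σ : Carrier → Carrier
  σ x = x ^ q

  σ-cong : ∀ {x y} → x ≈ y → σ x ≈ σ y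
  σ-cong = ^-congˡ q

  σ-* : ∀ x y → σ (x * y) ≈ σ x * σ y
  σ-* x y = ^-distrib-* x y q

  σ-+ : ∀ x y → σ (x + y) ≈ σ x + σ y
  σ-+ x y = ≡.subst (λ m → (x + y) ^ m ≈ x ^ m + y ^ m) (≡.sym q≡p^j)
    (Frobenius.frobenius-+^ commutativeRing p-prime p·1≈0 j x y)

  σ-0 : σ 0# ≈ 0#
  σ-0 = x≈0⇒x^n≈0 q 1≤q refl

  σ-1 : σ 1# ≈ 1#
  σ-1 = 1^ q
    where
    1^ : ∀ k → 1# ^ k ≈ 1#
    1^ zero    = refl
    1^ (suc k) = trans (*-identityˡ _) (1^ k)

  σ-neg : ∀ x → σ (- x) ≈ - σ x
  σ-neg x = inverseˡ-unique _ _ (begin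
    σ (- x) + σ x     ≈⟨ σ-+ (- x) x ⟨
    σ (- x + x)       ≈⟨ σ-cong (-‿inverseˡ x) ⟩
    σ 0#              ≈⟨ σ-0 ⟩
    0#                ∎)

  infixl 7 _σ*_
  infixl 6 _σ+_ _σ-_

  -- These combinators follow the shape of a term and push σ down to its leaves. There `refl` leaves
  -- σ unevaluated, while `σ⁶` or another known conjugate rewrites it.
  _σ*_ : ∀ {x y x′ y′} → σ x ≈ x′ → σ y ≈ y′ → σ (x * y) ≈ x′ * y′
  x-eq σ* y-eq = trans (σ-* _ _) (*-cong x-eq y-eq)

  _σ+_ : ∀ {x y x′ y′} → σ x ≈ x′ → σ y ≈ y′ → σ (x + y) ≈ x′ + y′
  x-eq σ+ y-eq = trans (σ-+ _ _) (+-cong x-eq y-eq)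

  σ-: : ∀ {x x′} → σ x ≈ x′ → σ (- x) ≈ - x′
  σ-: x-eq = trans (σ-neg _) (-‿cong x-eq)

  _σ-_ : ∀ {x y x′ y′} → σ x ≈ x′ → σ y ≈ y′ → σ (x - y) ≈ x′ - y′
  x-eq σ- y-eq = x-eq σ+ σ-: y-eq

  -- Applies σ to an equation whose two sides have been conjugated by the combinators above;
  -- iterating it yields all the shifted forms of a relation.
  conjugate : ∀ {x y x′ y′} → σ x ≈ x′ → σ y ≈ y′ → x ≈ y → x′ ≈ y′
  conjugate x-eq y-eq x≈y = trans (sym x-eq) (trans (σ-cong x≈y) y-eq)

  σ-≉0 : ∀ {x} → x ≉ 0# → σ x ≉ 0#
  σ-≉0 x≉0 = ^-≉0 x≉0 q

  σ² σ³ σ⁴ σ⁵ : Carrier → Carrier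
  σ² x = σ (σ x)
  σ³ x = σ (σ² x)
  σ⁴ x = σ (σ³ x)
  σ⁵ x = σ (σ⁴ x)

  ^q^suc : ∀ x k → x ^ (q ℕ.^ suc k) ≈ σ x ^ (q ℕ.^ k)
  ^q^suc x k = sym (^-assocʳ x q (q ℕ.^ k))

  ^q⁰ : ∀ x → x ^ (q ℕ.^ 0) ≈ x
  ^q⁰ = *-identityʳ

  ^q¹ : ∀ x → x ^ (q ℕ.^ 1) ≈ σ x
  ^q¹ x = trans (^q^suc x 0) (^q⁰ _)

  ^q² : ∀ x → x ^ (q ℕ.^ 2) ≈ σ² x
  ^q² x = trans (^q^suc x 1) (^q¹ _)

  ^q³ : ∀ x → x ^ (q ℕ.^ 3) ≈ σ³ x
  ^q³ x = trans (^q^suc x 2) (^q² _)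

  ^q⁴ : ∀ x → x ^ (q ℕ.^ 4) ≈ σ⁴ x
  ^q⁴ x = trans (^q^suc x 3) (^q³ _)

  ^q⁵ : ∀ x → x ^ (q ℕ.^ 5) ≈ σ⁵ x
  ^q⁵ x = trans (^q^suc x 4) (^q⁴ _)

  σ⁶ : ∀ x → σ (σ⁵ x) ≈ x
  σ⁶ x = begin
    σ⁵ (σ x)                ≈⟨ ^q⁵ (σ x) ⟨
    σ x ^ (q ℕ.^ 5)         ≈⟨ ^q^suc x 5 ⟨
    x ^ (q ℕ.^ 6)           ≈⟨ x^order≈x x ⟩
    x                       ∎

  σ-injective : ∀ {x y} → σ x ≈ σ y → x ≈ y
  σ-injective {x} {y} eq = trans (sym (σ⁶ x)) (trans (σ-cong (σ-cong (σ-cong (σ-cong (σ-cong eq))))) (σ⁶ y))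

  -- Roots of the quadratic equation attached to a cross-ratio.

  -- Denominators are cleared, so every l in 𝔽q satisfies the relation trivially. Being scattered
  -- will mean that no other l does.
  CrossRatio : Carrier → Carrier → Set ℓ
  CrossRatio a l = a * ((σ³ l - l) * (σ⁵ l - σ² l)) ≈ (l - σ⁵ l) * (σ² l - σ³ l)

  root-form : Carrier → Carrier → Carrier
  root-form a y = y * y - (a + σ a + σ² a - 1#) * y + a * σ a * σ² a

  -- The two roots of the form are N₁/D and N₂/D; since σ interchanges them, a root
  -- in 𝔽q is equal to both.
  module _ {a l} (cr : CrossRatio a l) (l∉𝔽q : σ l ≉ l) where
    private
      l₁ = σ l
      l₂ = σ² l
      l₃ = σ³ l
      l₄ = σ⁴ l
      l₅ = σ⁵ l
      l₆≈l = σ⁶ l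
      a₁ = σ a
      a₂ = σ² a
      D N₁ N₂ : Carrier
      D = (l₃ - l) * (l₅ - l₂) * (l₁ - l₄)
      N₁ = (l - l₅) * (l₂ - l₁) * (l₃ - l₄)
      N₂ = (l₁ - l) * (l₃ - l₂) * (l₅ - l₄)

      cr₁ : a₁ * ((l₄ - l₁) * (l - l₃)) ≈ (l₁ - l) * (l₃ - l₄)
      cr₁ = conjugate (refl σ* ((refl σ- refl) σ* (l₆≈l σ- refl))) ((refl σ- l₆≈l) σ* (refl σ- refl)) cr

      cr₂ : a₂ * ((l₅ - l₂) * (l₁ - l₄)) ≈ (l₂ - l₁) * (l₄ - l₅)
      cr₂ = conjugate (refl σ* ((refl σ- refl) σ* (refl σ- refl))) ((refl σ- refl) σ* (refl σ- refl)) cr₁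

      -- If l₃ = l, the left side of `cr` vanishes, so l = l₅ or l₂ = l₃, and either puts l in 𝔽q.
      -- The three factors of `D` are conjugates of l₃ - l up to sign.
      l₃≉l : l₃ ≉ l
      l₃≉l l₃≈l = [ (λ eq → l∉𝔽q (conjugate refl l₆≈l (x∙y⁻¹≈ε⇒x≈y _ _ eq)))
                  , (λ eq → l∉𝔽q (sym (σ-injective (σ-injective (x∙y⁻¹≈ε⇒x≈y _ _ eq))))) ]′
        (zero-product (begin
          (l - l₅) * (l₂ - l₃)           ≈⟨ cr ⟨
          a * ((l₃ - l) * (l₅ - l₂))     ≈⟨ *-congˡ (*-congʳ (+-congʳ l₃≈l)) ⟩
          a * ((l - l) * (l₅ - l₂))      ≈⟨ solve 3 (λ a l m → a :* ((l :- l) :* m) := con ℤ.0ℤ) refl a l _ ⟩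
          0#                             ∎))

      D≉0 : D ≉ 0#
      D≉0 = *-≉0 (*-≉0 (≉⇒-≉0 l₃≉l) (≉⇒-≉0 (l₃≉l ∘ σ-injective ∘ σ-injective)))
                 (≉⇒-≉0 (λ eq → l₃≉l (sym (σ-injective eq))))

      σD : σ D ≈ - D
      σD = trans ((refl σ- refl) σ* (l₆≈l σ- refl) σ* (refl σ- refl))
        (solve 6 (λ l l₁ l₂ l₃ l₄ l₅ → (l₄ :- l₁) :* (l :- l₃) :* (l₂ :- l₅) :=
          :- ((l₃ :- l) :* (l₅ :- l₂) :* (l₁ :- l₄))) refl l l₁ l₂ l₃ l₄ l₅)

      σN₂ : σ N₂ ≈ - N₁
      σN₂ = trans ((refl σ- refl) σ* (refl σ- refl) σ* (l₆≈l σ- refl))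
        (solve 6 (λ l l₁ l₂ l₃ l₄ l₅ → (l₂ :- l₁) :* (l₄ :- l₃) :* (l :- l₅) :=
          :- ((l :- l₅) :* (l₂ :- l₁) :* (l₃ :- l₄))) refl l l₁ l₂ l₃ l₄ l₅)

      -- Each denominator of a, a₁, a₂ consists of two of the three long diagonals in `D`. Once
      -- these are cleared, an identity remains that holds for six arbitrary elements, not only for
      -- conjugates.
      sum-of-roots : D * (a + a₁ + a₂ - 1#) ≈ N₁ + N₂
      sum-of-roots = begin
        D * (a + a₁ + a₂ - 1#)
          ≈⟨ solve 9 (λ l l₁ l₂ l₃ l₄ l₅ a a₁ a₂ → (l₃ :- l) :* (l₅ :- l₂) :* (l₁ :- l₄) :* (a :+ a₁ :+ a₂ :- con ℤ.1ℤ) :=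
               a :* ((l₃ :- l) :* (l₅ :- l₂)) :* (l₁ :- l₄) :+ a₁ :* ((l₄ :- l₁) :* (l :- l₃)) :* (l₅ :- l₂) :+
               a₂ :* ((l₅ :- l₂) :* (l₁ :- l₄)) :* (l₃ :- l) :- (l₃ :- l) :* (l₅ :- l₂) :* (l₁ :- l₄))
               refl l l₁ l₂ l₃ l₄ l₅ a a₁ a₂ ⟩
        a * ((l₃ - l) * (l₅ - l₂)) * (l₁ - l₄) + a₁ * ((l₄ - l₁) * (l - l₃)) * (l₅ - l₂) +
          a₂ * ((l₅ - l₂) * (l₁ - l₄)) * (l₃ - l) - D
          ≈⟨ +-congʳ (+-cong (+-cong (*-congʳ cr) (*-congʳ cr₁)) (*-congʳ cr₂)) ⟩
        (l - l₅) * (l₂ - l₃) * (l₁ - l₄) + (l₁ - l) * (l₃ - l₄) * (l₅ - l₂) +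
          (l₂ - l₁) * (l₄ - l₅) * (l₃ - l) - D
          ≈⟨ solve 6 (λ l l₁ l₂ l₃ l₄ l₅ → (l :- l₅) :* (l₂ :- l₃) :* (l₁ :- l₄) :+ (l₁ :- l) :* (l₃ :- l₄) :* (l₅ :- l₂) :+
               (l₂ :- l₁) :* (l₄ :- l₅) :* (l₃ :- l) :- (l₃ :- l) :* (l₅ :- l₂) :* (l₁ :- l₄) :=
               (l :- l₅) :* (l₂ :- l₁) :* (l₃ :- l₄) :+ (l₁ :- l) :* (l₃ :- l₂) :* (l₅ :- l₄)) refl l l₁ l₂ l₃ l₄ l₅ ⟩
        N₁ + N₂ ∎

      -- Among the numerators of a, a₁, a₂ each side of the hexagon occurs once; among the
      -- denominators each long diagonal occurs twice.
      product-of-roots : D * D * (a * a₁ * a₂) ≈ N₁ * N₂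
      product-of-roots = begin
        D * D * (a * a₁ * a₂)
          ≈⟨ solve 6 (λ d e f a a₁ a₂ → d :* e :* f :* (d :* e :* f) :* (a :* a₁ :* a₂) :=
               a :* (d :* e) :* (a₁ :* (:- f :* (:- d))) :* (a₂ :* (e :* f))) refl (l₃ - l) (l₅ - l₂) (l₁ - l₄) a a₁ a₂ ⟩
        a * ((l₃ - l) * (l₅ - l₂)) * (a₁ * (- (l₁ - l₄) * (- (l₃ - l)))) * (a₂ * ((l₅ - l₂) * (l₁ - l₄)))
          ≈⟨ *-congʳ (*-congˡ (*-congˡ (*-cong (-[x-y]≈y-x l₁ l₄) (-[x-y]≈y-x l₃ l)))) ⟩
        a * ((l₃ - l) * (l₅ - l₂)) * (a₁ * ((l₄ - l₁) * (l - l₃))) * (a₂ * ((l₅ - l₂) * (l₁ - l₄)))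
          ≈⟨ *-cong (*-cong cr cr₁) cr₂ ⟩
        (l - l₅) * (l₂ - l₃) * ((l₁ - l) * (l₃ - l₄)) * ((l₂ - l₁) * (l₄ - l₅))
          ≈⟨ *-cong (*-congʳ (*-congˡ (-[x-y]≈y-x l₃ l₂))) (*-congˡ (-[x-y]≈y-x l₅ l₄)) ⟨
        (l - l₅) * (- (l₃ - l₂)) * ((l₁ - l) * (l₃ - l₄)) * ((l₂ - l₁) * (- (l₅ - l₄)))
          ≈⟨ solve 6 (λ a b c d e f → a :* (:- b) :* (c :* d) :* (e :* (:- f)) := a :* e :* d :* (c :* b :* f))
               refl (l - l₅) (l₃ - l₂) (l₁ - l) (l₃ - l₄) (l₂ - l₁) (l₅ - l₄) ⟩
        N₁ * N₂ ∎
        where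
        -[x-y]≈y-x : ∀ x y → - (x - y) ≈ y - x
        -[x-y]≈y-x = solve 2 (λ x y → :- (x :- y) := y :- x) refl

    root-unique : ∀ {y} → σ y ≈ y → root-form a y ≈ 0# → D * y ≈ N₁
    root-unique {y} y∈𝔽q root = [ x∙y⁻¹≈ε⇒x≈y _ _ , (λ eq → swap (x∙y⁻¹≈ε⇒x≈y _ _ eq)) ]′
      (zero-product (begin
        (D * y - N₁) * (D * y - N₂)
          ≈⟨ solve 4 (λ d y m n → (d :* y :- m) :* (d :* y :- n) := d :* d :* (y :* y) :- d :* y :* (m :+ n) :+ m :* n) refl D y N₁ N₂ ⟩
        D * D * (y * y) - D * y * (N₁ + N₂) + N₁ * N₂
          ≈⟨ +-cong (+-congˡ (-‿cong (*-congˡ sum-of-roots))) product-of-roots ⟨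
        D * D * (y * y) - D * y * (D * (a + a₁ + a₂ - 1#)) + D * D * (a * a₁ * a₂)
          ≈⟨ solve 4 (λ d y s n → d :* d :* (y :* y) :- d :* y :* (d :* s) :+ d :* d :* n := d :* d :* (y :* y :- s :* y :+ n)) refl D y _ _ ⟩
        D * D * root-form a y
          ≈⟨ trans (*-congˡ root) (zeroʳ _) ⟩
        0# ∎))
      where
      -- Frobenius fixes y, negates `D` and sends `N₂` to `- N₁`, so the two signs cancel.
      swap : D * y ≈ N₂ → D * y ≈ N₁
      swap eq = begin
        D * y            ≈⟨ solve 2 (λ d y → d :* y := :- (:- d :* y)) refl D y ⟩
        - (- D * y)      ≈⟨ -‿cong (conjugate (σD σ* y∈𝔽q) σN₂ eq) ⟩
        - (- N₁)         ≈⟨ solve 1 (λ x → :- (:- x) := x) refl N₁ ⟩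
        N₁               ∎

    roots-equal : ∀ {y z} → σ y ≈ y → σ z ≈ z → root-form a y ≈ 0# → root-form a z ≈ 0# → y ≈ z
    roots-equal y∈𝔽q z∈𝔽q y-root z-root =
      *-cancelˡ D≉0 (trans (root-unique y∈𝔽q y-root) (sym (root-unique z∈𝔽q z-root)))

  -- Norms, Hilbert 90 and q-polynomials.

  q^k≥1 : ∀ k → 1 ≤ q ℕ.^ k
  q^k≥1 k = ℕ.m^n>0 q {{ℕ.>-nonZero 1≤q}} k

  x^[m∸1]≈1 : ∀ {x m} → 1 ≤ m → x ≉ 0# → x ^ m ≈ x → x ^ (m ∸ 1) ≈ 1#
  x^[m∸1]≈1 {x} {suc k} _ x≉0 eq = *-cancelˡ x≉0 (trans eq (sym (*-identityʳ x)))

  x^[m∸1]*x≈x^m : ∀ {m} x → 1 ≤ m → x ^ (m ∸ 1) * x ≈ x ^ m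
  x^[m∸1]*x≈x^m {suc m} x _ = *-comm _ _

  ^[1+q³] : ∀ x → x ^ suc (q ℕ.^ 3) ≈ x * σ³ x
  ^[1+q³] x = *-congˡ (^q³ x)

  ^[1+q²+q⁴] : ∀ x → x ^ suc (q ℕ.^ 2 ℕ.+ q ℕ.^ 4) ≈ x * σ² x * σ⁴ x
  ^[1+q²+q⁴] x = trans (*-congˡ (trans (^-homo-* x (q ℕ.^ 2) (q ℕ.^ 4)) (*-cong (^q² x) (^q⁴ x)))) (sym (*-assoc _ _ _))

  [1+q³][q³∸1] : suc (q ℕ.^ 3) ℕ.* (q ℕ.^ 3 ∸ 1) ≡ q ℕ.^ 6 ∸ 1
  [1+q³][q³∸1] = ≡.trans ([1+m][m∸1]≡m²∸1 (q ℕ.^ 3) (q^k≥1 3)) (≡.cong (_∸ 1) (≡.sym (ℕ.^-distribˡ-+-* q 3 3)))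

  [1+q²+q⁴][q²∸1] : suc (q ℕ.^ 2 ℕ.+ q ℕ.^ 4) ℕ.* (q ℕ.^ 2 ∸ 1) ≡ q ℕ.^ 6 ∸ 1
  [1+q²+q⁴][q²∸1] = ≡-R.begin
    suc (q ℕ.^ 2 ℕ.+ q ℕ.^ 4) ℕ.* (q ℕ.^ 2 ∸ 1)                   ≡-R.≡⟨ ≡.cong (λ k → suc (q ℕ.^ 2 ℕ.+ k) ℕ.* (q ℕ.^ 2 ∸ 1)) (ℕ.^-distribˡ-+-* q 2 2) ⟩
    suc (q ℕ.^ 2 ℕ.+ q ℕ.^ 2 ℕ.* q ℕ.^ 2) ℕ.* (q ℕ.^ 2 ∸ 1)       ≡-R.≡⟨ [1+m+m²][m∸1]≡m³∸1 (q ℕ.^ 2) (q^k≥1 2) ⟩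
    q ℕ.^ 2 ℕ.* (q ℕ.^ 2 ℕ.* q ℕ.^ 2) ∸ 1                         ≡-R.≡⟨ ≡.cong (λ k → q ℕ.^ 2 ℕ.* k ∸ 1) (ℕ.^-distribˡ-+-* q 2 2) ⟨
    q ℕ.^ 2 ℕ.* q ℕ.^ 4 ∸ 1                                       ≡-R.≡⟨ ≡.cong (_∸ 1) (ℕ.^-distribˡ-+-* q 2 4) ⟨
    q ℕ.^ 6 ∸ 1                                                   ≡-R.∎
    where module ≡-R = ≡.≡-Reasoning

  [1+q][1+q²+q⁴][q∸1] : suc q ℕ.* (suc (q ℕ.^ 2 ℕ.+ q ℕ.^ 4) ℕ.* (q ∸ 1)) ≡ q ℕ.^ 6 ∸ 1
  [1+q][1+q²+q⁴][q∸1] = ≡-R.begin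
    suc q ℕ.* (b ℕ.* (q ∸ 1))       ≡-R.≡⟨ ℕ.*-assoc (suc q) b (q ∸ 1) ⟨
    suc q ℕ.* b ℕ.* (q ∸ 1)         ≡-R.≡⟨ ≡.cong (ℕ._* (q ∸ 1)) (ℕ.*-comm (suc q) b) ⟩
    b ℕ.* suc q ℕ.* (q ∸ 1)         ≡-R.≡⟨ ℕ.*-assoc b (suc q) (q ∸ 1) ⟩
    b ℕ.* (suc q ℕ.* (q ∸ 1))       ≡-R.≡⟨ ≡.cong (b ℕ.*_) ([1+m][m∸1]≡m²∸1 q 1≤q) ⟩
    b ℕ.* (q ℕ.* q ∸ 1)             ≡-R.≡⟨ ≡.cong (λ k → b ℕ.* (q ℕ.* k ∸ 1)) (ℕ.*-identityʳ q) ⟨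
    b ℕ.* (q ℕ.^ 2 ∸ 1)             ≡-R.≡⟨ [1+q²+q⁴][q²∸1] ⟩
    q ℕ.^ 6 ∸ 1                     ≡-R.∎
    where
    module ≡-R = ≡.≡-Reasoning
    b = suc (q ℕ.^ 2 ℕ.+ q ℕ.^ 4)

  -- The norm is the power with exponent 1 + q³, and a nonzero d in 𝔽q³ is killed by the
  -- complementary exponent q³ - 1 of q⁶ - 1.
  norm-q³-surjective : ∀ {d} → d ≉ 0# → σ³ d ≈ d → ∃ λ x → x ≉ 0# × x * σ³ x ≈ d
  norm-q³-surjective {d} d≉0 σ³d≈d =
    let x , x≉0 , eq = power-root (q ℕ.^ 3 ∸ 1) (suc (q ℕ.^ 3)) (s≤s z≤n) [1+q³][q³∸1]
                         (x^[m∸1]≈1 (q^k≥1 3) d≉0 (trans (^q³ d) σ³d≈d))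
    in x , x≉0 , trans (sym (^[1+q³] x)) eq

  norm-q²-surjective : ∀ {d} → d ≉ 0# → σ² d ≈ d → ∃ λ x → x ≉ 0# × x * σ² x * σ⁴ x ≈ d
  norm-q²-surjective {d} d≉0 σ²d≈d =
    let x , x≉0 , eq = power-root (q ℕ.^ 2 ∸ 1) (suc (q ℕ.^ 2 ℕ.+ q ℕ.^ 4)) (s≤s z≤n) [1+q²+q⁴][q²∸1]
                         (x^[m∸1]≈1 (q^k≥1 2) d≉0 (trans (^q² d) σ²d≈d))
    in x , x≉0 , trans (sym (^[1+q²+q⁴] x)) eq

  -- The roles of the two factors of q⁶ - 1 are exchanged: r has trivial power 1 + q³, so it is
  -- x^(q³ - 1) = σ³x / x.
  hilbert90-q³ : ∀ {r} → r * σ³ r ≈ 1# → ∃ λ x → x ≉ 0# × σ³ x ≈ r * x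
  hilbert90-q³ {r} norm≈1 =
    let x , x≉0 , eq = power-root (suc (q ℕ.^ 3)) (q ℕ.^ 3 ∸ 1) q³∸1≥1
                         (≡.trans (ℕ.*-comm (q ℕ.^ 3 ∸ 1) _) [1+q³][q³∸1]) (trans (^[1+q³] r) norm≈1)
    in x , x≉0 , (begin
      σ³ x                    ≈⟨ ^q³ x ⟨
      x ^ (q ℕ.^ 3)           ≈⟨ x^[m∸1]*x≈x^m x (q^k≥1 3) ⟨
      x ^ (q ℕ.^ 3 ∸ 1) * x   ≈⟨ *-congʳ eq ⟩
      r * x                   ∎)
    where
    q³∸1≥1 : 1 ≤ q ℕ.^ 3 ∸ 1
    q³∸1≥1 = ℕ.∸-monoˡ-≤ 1 (ℕ.≤-trans 2≤q (≡.subst (_≤ q ℕ.^ 3) (ℕ.^-identityʳ q) (ℕ.^-monoʳ-≤ q {{ℕ.>-nonZero 1≤q}} {1} {3} (s≤s z≤n))))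

  -- The hypothesis says that d^(1 + q² + q⁴) is fixed by σ, hence is killed by q - 1. The exponent
  -- complementary to 1 + q is (1 + q² + q⁴)(q - 1).
  ^[1+q]-surjective : ∀ {d} → d ≉ 0# → d * σ² d * σ⁴ d ≈ σ d * σ³ d * σ⁵ d → ∃ λ x → x ≉ 0# × x * σ x ≈ d
  ^[1+q]-surjective {d} d≉0 eq = power-root (suc (q ℕ.^ 2 ℕ.+ q ℕ.^ 4) ℕ.* (q ∸ 1)) (suc q) (s≤s z≤n) [1+q][1+q²+q⁴][q∸1] (begin
    d ^ (suc (q ℕ.^ 2 ℕ.+ q ℕ.^ 4) ℕ.* (q ∸ 1))    ≈⟨ ^-assocʳ d (suc (q ℕ.^ 2 ℕ.+ q ℕ.^ 4)) (q ∸ 1) ⟨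
    (d ^ suc (q ℕ.^ 2 ℕ.+ q ℕ.^ 4)) ^ (q ∸ 1)      ≈⟨ ^-congˡ (q ∸ 1) (^[1+q²+q⁴] d) ⟩
    (d * σ² d * σ⁴ d) ^ (q ∸ 1)                    ≈⟨ x^[m∸1]≈1 1≤q (*-≉0 (*-≉0 d≉0 (σ-≉0 (σ-≉0 d≉0))) (σ-≉0 (σ-≉0 (σ-≉0 (σ-≉0 d≉0)))))
                                                        (trans (refl σ* refl σ* refl) (sym eq)) ⟩
    1#                                             ∎)
  q^i<q^j : ∀ {i j} → i < j → q ℕ.^ i < q ℕ.^ j
  q^i<q^j = ℕ.^-monoʳ-< q 2≤q

  top-linearised : ∀ c₀ c₁ c₂ c₃ c₄ c₅ → HasTop (q ℕ.^ 5) c₅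
    (λ t → c₀ * t + c₁ * σ t + c₂ * σ² t + c₃ * σ³ t + c₄ * σ⁴ t + c₅ * σ⁵ t)
  top-linearised c₀ c₁ c₂ c₃ c₄ c₅ = top-cong
    (solve 1 (λ c → con ℤ.0ℤ :+ con ℤ.0ℤ :+ con ℤ.0ℤ :+ con ℤ.0ℤ :+ con ℤ.0ℤ :+ c :* con ℤ.1ℤ := c) refl c₅)
    (λ t → +-cong (+-cong (+-cong (+-cong (+-cong (*-congˡ (^q⁰ t)) (*-congˡ (^q¹ t))) (*-congˡ (^q² t))) (*-congˡ (^q³ t)))
             (*-congˡ (^q⁴ t))) (*-congˡ (^q⁵ t)))
    (top-+ (top-+ (top-+ (top-+ (top-+ (lower c₀ (s≤s z≤n)) (lower c₁ (s≤s (s≤s z≤n)))) (lower c₂ (s≤s (s≤s (s≤s z≤n)))))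
       (lower c₃ (s≤s (s≤s (s≤s (s≤s z≤n)))))) (lower c₄ (ℕ.n<1+n 4))) (top-scale c₅ (top-^ (q ℕ.^ 5))))
    where
    lower : ∀ c {i} → i < 5 → HasTop (q ℕ.^ 5) 0# (λ t → c * t ^ (q ℕ.^ i))
    lower c i<5 = top-raise (q^i<q^j i<5) (top-scale c (top-^ _))

  -- The degree is q⁵ < q⁶, so the top coefficient alone prevents identical vanishing.
  linearised-nonroot : ∀ c₀ c₁ c₂ c₃ c₄ {c₅} → c₅ ≉ 0# →
    ∃ λ t → c₀ * t + c₁ * σ t + c₂ * σ² t + c₃ * σ³ t + c₄ * σ⁴ t + c₅ * σ⁵ t ≉ 0#
  linearised-nonroot c₀ c₁ c₂ c₃ c₄ {c₅} c₅≉0 = ¬∀⇒∃≉0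
    (λ eq → let eq₁ = σ-cong eq; eq₂ = σ-cong eq₁; eq₃ = σ-cong eq₂; eq₄ = σ-cong eq₃; eq₅ = σ-cong eq₄ in
      +-cong (+-cong (+-cong (+-cong (+-cong (*-congˡ eq) (*-congˡ eq₁)) (*-congˡ eq₂)) (*-congˡ eq₃)) (*-congˡ eq₄)) (*-congˡ eq₅))
    (c₅≉0 ∘ vanishing⇒top≈0 (top-linearised c₀ c₁ c₂ c₃ c₄ c₅) (q^i<q^j (ℕ.n<1+n 5)))

  -- From conjugate roots to an element with the given cross-ratio.

  module Construction {a y} (a≉0 : a ≉ 0#) (a≉1 : a ≉ 1#) (a₃≈a : σ³ a ≈ a)
    (y+σy : y + σ y ≈ a + σ a + σ² a - 1#) (yσy : y * σ y ≈ a * σ a * σ² a) where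

    private
      a₁ = σ a
      a₂ = σ² a
      n = a * a₁ * a₂
      a₁≉0 = σ-≉0 a≉0
      a₂≉0 = σ-≉0 a₁≉0

      n≉0 : n ≉ 0#
      n≉0 = *-≉0 (*-≉0 a≉0 a₁≉0) a₂≉0

      σn≈n : σ n ≈ n
      σn≈n = trans (refl σ* refl σ* a₃≈a) (solve 3 (λ a b c → b :* c :* a := a :* b :* c) refl a a₁ a₂)

      y≉0 : y ≉ 0#
      y≉0 y≈0 = n≉0 (trans (sym yσy) (trans (*-congʳ y≈0) (zeroˡ _)))

      -- Both y and σ²y are complementary to σy in the σ-invariant product n. Thus y lies in 𝔽q² and
      -- is a norm from the whole field.
      σ²y≈y : σ² y ≈ y
      σ²y≈y = *-cancelˡ (σ-≉0 y≉0) (begin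
        σ y * σ² y     ≈⟨ conjugate (refl σ* refl) σn≈n yσy ⟩
        n              ≈⟨ yσy ⟨
        y * σ y        ≈⟨ *-comm _ _ ⟩
        σ y * y        ∎)

    -- If g g₂ g₄ = y and h h₃ = a₁ then u = g g₁ g₂ / (h₁ h₂).
    norms : ∃ λ u → u ≉ 0# × u * σ³ u ≈ a₁ × u * σ² u * σ⁴ u ≈ y
    -- The norms prescribed to 𝔽q³ and 𝔽q² are compatible because both have norm n to 𝔽q. The six
    -- conjugates of g multiply to y·σy = n, which the conjugates of h in the denominator reduce to
    -- a₁ and y.
    norms = u , *-≉0 b≉0 i≉0 , norm₃ , norm₂
      where
      g-data = norm-q²-surjective y≉0 σ²y≈y
      h-data = norm-q³-surjective a₁≉0 (σ-cong a₃≈a)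
      g = proj₁ g-data
      g≉0 = proj₁ (proj₂ g-data)
      g-norm = proj₂ (proj₂ g-data)
      h = proj₁ h-data
      h≉0 = proj₁ (proj₂ h-data)
      h-norm = proj₂ (proj₂ h-data)
      b = g * σ g * σ² g
      b≉0 : b ≉ 0#
      b≉0 = *-≉0 (*-≉0 g≉0 (σ-≉0 g≉0)) (σ-≉0 (σ-≉0 g≉0))
      e = σ h * σ² h
      e≉0 : e ≉ 0#
      e≉0 = *-≉0 (σ-≉0 h≉0) (σ-≉0 (σ-≉0 h≉0))
      i = e ⁻¹⟨ e≉0 ⟩
      ie≈1 = ⁻¹-inverseˡ e≉0
      i≉0 : i ≉ 0#
      i≉0 i≈0 = 0≉1 (trans (sym (zeroˡ e)) (trans (*-congʳ (sym i≈0)) ie≈1))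
      u = b * i
      g-norm₁ : σ g * σ³ g * σ⁵ g ≈ σ y
      g-norm₁ = conjugate (refl σ* refl σ* refl) refl g-norm
      h-norm₁ : σ h * σ⁴ h ≈ a₂
      h-norm₁ = conjugate (refl σ* refl) refl h-norm
      h-norm₂ : σ² h * σ⁵ h ≈ a
      h-norm₂ = conjugate (refl σ* refl) a₃≈a h-norm₁
      σ-inverse : ∀ {x x′ z z′} → σ x ≈ x′ → σ z ≈ z′ → x * z ≈ 1# → x′ * z′ ≈ 1#
      σ-inverse x-eq z-eq = conjugate (x-eq σ* z-eq) σ-1
      ie₁ : σ i * (σ² h * σ³ h) ≈ 1#
      ie₁ = σ-inverse refl (refl σ* refl) ie≈1
      ie₂ : σ² i * (σ³ h * σ⁴ h) ≈ 1#
      ie₂ = σ-inverse refl (refl σ* refl) ie₁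
      ie₃ : σ³ i * (σ⁴ h * σ⁵ h) ≈ 1#
      ie₃ = σ-inverse refl (refl σ* refl) ie₂
      ie₄ : σ⁴ i * (σ⁵ h * h) ≈ 1#
      ie₄ = σ-inverse refl (refl σ* σ⁶ h) ie₃
      u₂ : σ² u ≈ σ² g * σ³ g * σ⁴ g * σ² i
      u₂ = trans (σ-cong (refl σ* refl σ* refl σ* refl)) (refl σ* refl σ* refl σ* refl)
      u₃ : σ³ u ≈ σ³ g * σ⁴ g * σ⁵ g * σ³ i
      u₃ = trans (σ-cong u₂) (refl σ* refl σ* refl σ* refl)
      u₄ : σ⁴ u ≈ σ⁴ g * σ⁵ g * g * σ⁴ i
      u₄ = trans (σ-cong u₃) (refl σ* refl σ* σ⁶ g σ* refl)
      norm₃ : u * σ³ u ≈ a₁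
      norm₃ = *-cancelˡ (*-≉0 a≉0 a₂≉0) (begin
        a * a₂ * (u * σ³ u)
          ≈⟨ *-cong (*-cong (sym h-norm₂) (sym h-norm₁)) (*-congˡ u₃) ⟩
        σ² h * σ⁵ h * (σ h * σ⁴ h) * (g * σ g * σ² g * i * (σ³ g * σ⁴ g * σ⁵ g * σ³ i))
          ≈⟨ solve 12 (λ h₁ h₂ h₄ h₅ g g₁ g₂ g₃ g₄ g₅ i i₃ →
                h₂ :* h₅ :* (h₁ :* h₄) :* (g :* g₁ :* g₂ :* i :* (g₃ :* g₄ :* g₅ :* i₃)) :=
                g :* g₂ :* g₄ :* (g₁ :* g₃ :* g₅) :* (i :* (h₁ :* h₂) :* (i₃ :* (h₄ :* h₅)))) refl
                (σ h) (σ² h) (σ⁴ h) (σ⁵ h) g (σ g) (σ² g) (σ³ g) (σ⁴ g) (σ⁵ g) i (σ³ i) ⟩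
        g * σ² g * σ⁴ g * (σ g * σ³ g * σ⁵ g) * (i * e * (σ³ i * (σ⁴ h * σ⁵ h)))
          ≈⟨ *-cong (trans (*-cong g-norm g-norm₁) yσy) (*-cong ie≈1 ie₃) ⟩
        n * (1# * 1#)
          ≈⟨ solve 3 (λ a b c → a :* b :* c :* (con ℤ.1ℤ :* con ℤ.1ℤ) := a :* c :* b) refl a a₁ a₂ ⟩
        a * a₂ * a₁ ∎)
      norm₂ : u * σ² u * σ⁴ u ≈ y
      norm₂ = *-cancelˡ n≉0 (begin
        n * (u * σ² u * σ⁴ u)
          ≈⟨ *-cong (*-cong (*-cong (sym h-norm₂) (sym h-norm)) (sym h-norm₁)) (*-cong (*-congˡ u₂) u₄) ⟩
        σ² h * σ⁵ h * (h * σ³ h) * (σ h * σ⁴ h) *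
          (g * σ g * σ² g * i * (σ² g * σ³ g * σ⁴ g * σ² i) * (σ⁴ g * σ⁵ g * g * σ⁴ i))
          ≈⟨ regroup ⟩
        g * σ² g * σ⁴ g * (σ g * σ³ g * σ⁵ g) * (g * σ² g * σ⁴ g) *
          (i * e * (σ² i * (σ³ h * σ⁴ h)) * (σ⁴ i * (σ⁵ h * h)))
          ≈⟨ *-cong (*-cong (trans (*-cong g-norm g-norm₁) yσy) g-norm) (*-cong (*-cong ie≈1 ie₂) ie₄) ⟩
        n * y * (1# * 1# * 1#)
          ≈⟨ solve 2 (λ n y → n :* y :* (con ℤ.1ℤ :* con ℤ.1ℤ :* con ℤ.1ℤ) := n :* y) refl n y ⟩
        n * y ∎)
        where
        regroup : _
        regroup = solve 15 (λ h h₁ h₂ h₃ h₄ h₅ g g₁ g₂ g₃ g₄ g₅ i i₂ i₄ →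
                h₂ :* h₅ :* (h :* h₃) :* (h₁ :* h₄) :* (g :* g₁ :* g₂ :* i :* (g₂ :* g₃ :* g₄ :* i₂) :* (g₄ :* g₅ :* g :* i₄)) :=
                g :* g₂ :* g₄ :* (g₁ :* g₃ :* g₅) :* (g :* g₂ :* g₄) :* (i :* (h₁ :* h₂) :* (i₂ :* (h₃ :* h₄)) :* (i₄ :* (h₅ :* h)))) refl
                h (σ h) (σ² h) (σ³ h) (σ⁴ h) (σ⁵ h) g (σ g) (σ² g) (σ³ g) (σ⁴ g) (σ⁵ g) i (σ² i) (σ⁴ i)

    module Kernel {u} (u≉0 : u ≉ 0#) (uu₃ : u * σ³ u ≈ a₁) (uu₂u₄ : u * σ² u * σ⁴ u ≈ y) where
      private
        u₁ = σ u
        u₂ = σ² u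
        u₃ = σ³ u
        u₄ = σ⁴ u
        u₅ = σ⁵ u
        w w₁ w₂ w₃ w₄ w₅ : Carrier
        w = u₁ - u * u₂
        w₁ = σ w
        w₂ = σ² w
        w₃ = σ³ w
        w₄ = σ⁴ w
        w₅ = σ⁵ w

        u₁u₄ : u₁ * u₄ ≈ a₂
        u₁u₄ = conjugate (refl σ* refl) refl uu₃

        u₂u₅ : u₂ * u₅ ≈ a
        u₂u₅ = conjugate (refl σ* refl) a₃≈a u₁u₄

        u₁u₃u₅ : u₁ * u₃ * u₅ ≈ σ y
        u₁u₃u₅ = conjugate (refl σ* refl σ* refl) refl uu₂u₄

        w₁≈ : w₁ ≈ u₂ - u₁ * u₃
        w₁≈ = refl σ- refl σ* refl

        w₂≈ : w₂ ≈ u₃ - u₂ * u₄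
        w₂≈ = trans (σ-cong w₁≈) (refl σ- refl σ* refl)

        -- Expanded in the conjugates of u, the difference of the two sides is u₂ times (uu₂u₄ +
        -- u₁u₃u₅) - (u₂u₅ + uu₃ + u₁u₄ - 1). This is zero because y + σy equals the trace of a
        -- minus 1.
        ww₂ : w * w₂ ≈ (a - 1#) * w₁
        ww₂ = begin
          w * w₂
            ≈⟨ *-congˡ w₂≈ ⟩
          (u₁ - u * u₂) * (u₃ - u₂ * u₄)
            ≈⟨ solve 6 (λ u u₁ u₂ u₃ u₄ u₅ → (u₁ :- u :* u₂) :* (u₃ :- u₂ :* u₄) :=
                 (u₂ :* u₅ :- con ℤ.1ℤ) :* (u₂ :- u₁ :* u₃) :+
                 u₂ :* ((u :* u₂ :* u₄ :+ u₁ :* u₃ :* u₅) :- (u₂ :* u₅ :+ u :* u₃ :+ u₁ :* u₄ :- con ℤ.1ℤ))) refl u u₁ u₂ u₃ u₄ u₅ ⟩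
          (u₂ * u₅ - 1#) * (u₂ - u₁ * u₃) +
            u₂ * ((u * u₂ * u₄ + u₁ * u₃ * u₅) - (u₂ * u₅ + u * u₃ + u₁ * u₄ - 1#))
            ≈⟨ +-cong (*-cong (+-congʳ u₂u₅) (sym w₁≈))
                 (*-congˡ (+-cong (trans (+-cong uu₂u₄ u₁u₃u₅) y+σy) (-‿cong (+-congʳ (+-cong (+-cong u₂u₅ uu₃) u₁u₄))))) ⟩
          (a - 1#) * w₁ + u₂ * ((a + a₁ + a₂ - 1#) - (a + a₁ + a₂ - 1#))
            ≈⟨ solve 3 (λ s u t → s :+ u :* (t :- t) := s) refl _ u₂ _ ⟩
          (a - 1#) * w₁ ∎

        w₁w₃ : w₁ * w₃ ≈ (a₁ - 1#) * w₂
        w₁w₃ = conjugate (refl σ* refl) ((refl σ- σ-1) σ* refl) ww₂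

        w₂w₄ : w₂ * w₄ ≈ (a₂ - 1#) * w₃
        w₂w₄ = conjugate (refl σ* refl) ((refl σ- σ-1) σ* refl) w₁w₃

        w₃w₅ : w₃ * w₅ ≈ (a - 1#) * w₄
        w₃w₅ = conjugate (refl σ* refl) ((a₃≈a σ- σ-1) σ* refl) w₂w₄

        -- From u₁ = uu₂ and its conjugate u₂ = u₁u₃ follows uu₃ = 1, that is a₁ = 1.
        w≉0 : w ≉ 0#
        w≉0 w≈0 = a≉1 (σ-injective (trans (trans (sym uu₃) uu₃≈1) (sym σ-1)))
          where
          u₁≈uu₂ = x∙y⁻¹≈ε⇒x≈y u₁ (u * u₂) w≈0
          u₂≈u₁u₃ : u₂ ≈ u₁ * u₃
          u₂≈u₁u₃ = conjugate refl (refl σ* refl) u₁≈uu₂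
          uu₃≈1 : u * u₃ ≈ 1#
          uu₃≈1 = *-cancelˡ (σ-≉0 (σ-≉0 u≉0)) (begin
            u₂ * (u * u₃)     ≈⟨ solve 3 (λ u v w → v :* (u :* w) := u :* v :* w) refl u u₂ u₃ ⟩
            u * u₂ * u₃       ≈⟨ *-congʳ u₁≈uu₂ ⟨
            u₁ * u₃           ≈⟨ u₂≈u₁u₃ ⟨
            u₂                ≈⟨ *-identityʳ u₂ ⟨
            u₂ * 1#           ∎)

      -- Being a (1 + q)-th power requires ww₂w₄ = w₁w₃w₅. Both products equal (a - 1)w₁w₄, by `ww₂`
      -- and its third conjugate, since a lies in 𝔽q³.
      v-data : ∃ λ v → v ≉ 0# × v * σ v ≈ w
      v-data = ^[1+q]-surjective w≉0 (begin
        w * w₂ * w₄               ≈⟨ *-congʳ ww₂ ⟩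
        (a - 1#) * w₁ * w₄        ≈⟨ solve 3 (λ a b c → a :* b :* c := b :* (a :* c)) refl (a - 1#) w₁ w₄ ⟩
        w₁ * ((a - 1#) * w₄)      ≈⟨ *-congˡ w₃w₅ ⟨
        w₁ * (w₃ * w₅)            ≈⟨ *-assoc w₁ w₃ w₅ ⟨
        w₁ * w₃ * w₅              ∎)

      module Image {v} (vv₁ : v * σ v ≈ w) where
        private
            v₁ = σ v
            v₂ = σ² v
            v₃ = σ³ v
            v₄ = σ⁴ v
            v₅ = σ⁵ v

            v₁v₂ : v₁ * v₂ ≈ w₁
            v₁v₂ = conjugate (refl σ* refl) refl vv₁

            v₂v₃ : v₂ * v₃ ≈ w₂
            v₂v₃ = conjugate (refl σ* refl) refl v₁v₂

            v₃v₄ : v₃ * v₄ ≈ w₃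
            v₃v₄ = conjugate (refl σ* refl) refl v₂v₃

            v₄v₅ : v₄ * v₅ ≈ w₄
            v₄v₅ = conjugate (refl σ* refl) refl v₃v₄

            v₅v : v₅ * v ≈ u - u₅ * u₁
            v₅v = conjugate (refl σ* σ⁶ v) σw₄ v₄v₅
              where
              w₃≈ : w₃ ≈ u₄ - u₃ * u₅
              w₃≈ = trans (σ-cong w₂≈) (refl σ- refl σ* refl)
              w₄≈ : w₄ ≈ u₅ - u₄ * u
              w₄≈ = trans (σ-cong w₃≈) (refl σ- refl σ* σ⁶ u)
              σw₄ : σ w₄ ≈ u - u₅ * u₁
              σw₄ = trans (σ-cong w₄≈) (σ⁶ u σ- refl σ* refl)

            -- Multiplication by w₁ = v₁v₂ turns vv₃ into vv₁·v₂v₃ = ww₂.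
            vv₃ : v * v₃ ≈ a - 1#
            vv₃ = *-cancelˡ (σ-≉0 w≉0) (begin
              w₁ * (v * v₃)             ≈⟨ *-congʳ v₁v₂ ⟨
              v₁ * v₂ * (v * v₃)        ≈⟨ solve 4 (λ a b c d → b :* c :* (a :* d) := a :* b :* (c :* d)) refl v v₁ v₂ v₃ ⟩
              v * v₁ * (v₂ * v₃)        ≈⟨ *-cong vv₁ v₂v₃ ⟩
              w * w₂                    ≈⟨ ww₂ ⟩
              (a - 1#) * w₁             ≈⟨ *-comm _ _ ⟩
              w₁ * (a - 1#)             ∎)

            wv₂ : w * v₂ ≈ v * w₁
            wv₂ = trans (*-congʳ (sym vv₁)) (trans (*-assoc v v₁ v₂) (*-congˡ v₁v₂))

            wv₄ : w * v₄ ≈ v * (a₁ - 1#)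
            wv₄ = *-cancelˡ (σ-≉0 (σ-≉0 w≉0)) (begin
              w₂ * (w * v₄)             ≈⟨ solve 3 (λ a b c → a :* (b :* c) := b :* (a :* c)) refl w₂ w v₄ ⟩
              w * (w₂ * v₄)             ≈⟨ *-congˡ (trans (*-congʳ (sym v₂v₃)) (trans (*-assoc v₂ v₃ v₄) (*-congˡ v₃v₄))) ⟩
              w * (v₂ * w₃)             ≈⟨ *-assoc w v₂ w₃ ⟨
              w * v₂ * w₃               ≈⟨ *-congʳ wv₂ ⟩
              v * w₁ * w₃               ≈⟨ *-assoc v w₁ w₃ ⟩
              v * (w₁ * w₃)             ≈⟨ *-congˡ w₁w₃ ⟩
              v * ((a₁ - 1#) * w₂)      ≈⟨ solve 3 (λ v a b → v :* (a :* b) := b :* (v :* a)) refl v (a₁ - 1#) w₂ ⟩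
              w₂ * (v * (a₁ - 1#))      ∎)

            -- After multiplication by w every term is v times a polynomial in the conjugates of u,
            -- and these polynomials cancel. The fourth conjugate is the form needed for M.
            linear-relation : u * v₂ + v + v₄ * u₁ ≈ 0#
            linear-relation = *-cancelˡ-0 w≉0 (begin
              w * (u * v₂ + v + v₄ * u₁)
                ≈⟨ solve 6 (λ w u u₁ v v₂ v₄ → w :* (u :* v₂ :+ v :+ v₄ :* u₁) := u :* (w :* v₂) :+ v :* w :+ w :* v₄ :* u₁)
                     refl w u u₁ v v₂ v₄ ⟩
              u * (w * v₂) + v * w + w * v₄ * u₁
                ≈⟨ +-cong (+-congʳ (*-congˡ (trans wv₂ (*-congˡ w₁≈)))) (*-congʳ (trans wv₄ (*-congˡ (+-congʳ (sym uu₃))))) ⟩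
              u * (v * (u₂ - u₁ * u₃)) + v * (u₁ - u * u₂) + v * (u * u₃ - 1#) * u₁
                ≈⟨ solve 5 (λ u u₁ u₂ u₃ v → u :* (v :* (u₂ :- u₁ :* u₃)) :+ v :* (u₁ :- u :* u₂) :+ v :* (u :* u₃ :- con ℤ.1ℤ) :* u₁
                     := con ℤ.0ℤ) refl u u₁ u₂ u₃ v ⟩
              0# ∎)

            linear-relation₄ : u₄ * v + v₄ + v₂ * u₅ ≈ 0#
            linear-relation₄ =
              conjugate (refl σ* σ⁶ v σ+ refl σ+ refl σ* refl) σ-0
              (conjugate (refl σ* refl σ+ refl σ+ refl σ* refl) σ-0
              (conjugate (refl σ* refl σ+ refl σ+ σ⁶ v σ* refl) σ-0
              (conjugate (refl σ* refl σ+ refl σ+ refl σ* refl) σ-0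
               linear-relation)))

        -- The coefficients are arranged so that in vX₅∘M + M - u₅X₂∘M the terms in t, σ²t and σ⁵t
        -- cancel for any u and v, leaving only three conditions.
        M : Carrier → Carrier
        M t = u * σ t - v * σ² t + σ³ t + v₄ * σ⁴ t + u₅ * σ⁵ t

        private
          M₁ : ∀ t → σ (M t) ≈ u₁ * σ² t - v₁ * σ³ t + σ⁴ t + v₅ * σ⁵ t + u * t
          M₁ t = refl σ* refl σ- refl σ* refl σ+ refl σ+ refl σ* refl σ+ σ⁶ u σ* σ⁶ t

          M₂ : ∀ t → σ² (M t) ≈ u₂ * σ³ t - v₂ * σ⁴ t + σ⁵ t + v * t + u₁ * σ t
          M₂ t = trans (σ-cong (M₁ t)) (refl σ* refl σ- refl σ* refl σ+ refl σ+ σ⁶ v σ* σ⁶ t σ+ refl σ* refl)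

          M₃ : ∀ t → σ³ (M t) ≈ u₃ * σ⁴ t - v₃ * σ⁵ t + t + v₁ * σ t + u₂ * σ² t
          M₃ t = trans (σ-cong (M₂ t)) (refl σ* refl σ- refl σ* refl σ+ σ⁶ t σ+ refl σ* refl σ+ refl σ* refl)

          M₄ : ∀ t → σ⁴ (M t) ≈ u₄ * σ⁵ t - v₄ * t + σ t + v₂ * σ² t + u₃ * σ³ t
          M₄ t = trans (σ-cong (M₃ t)) (refl σ* refl σ- refl σ* σ⁶ t σ+ refl σ+ refl σ* refl σ+ refl σ* refl)

          M₅ : ∀ t → σ⁵ (M t) ≈ u₅ * t - v₅ * σ t + σ² t + v₃ * σ³ t + u₄ * σ⁴ t
          M₅ t = trans (σ-cong (M₄ t)) (refl σ* σ⁶ t σ- refl σ* refl σ+ refl σ+ refl σ* refl σ+ refl σ* refl)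

        -- The remaining coefficients, of σt, σ³t and σ⁴t, vanish by `v₅v`, by `vv₃` with `u₂u₅`,
        -- and by `linear-relation₄` respectively.
        M-relation : ∀ t → v * σ⁵ (M t) + M t ≈ u₅ * σ² (M t)
        M-relation t = x∙y⁻¹≈ε⇒x≈y _ _ (begin
          v * σ⁵ (M t) + M t - u₅ * σ² (M t)
            ≈⟨ +-cong (+-congʳ (*-congˡ (M₅ t))) (-‿cong (*-congˡ (M₂ t))) ⟩
          v * (u₅ * t - v₅ * σ t + σ² t + v₃ * σ³ t + u₄ * σ⁴ t) + M t
            - u₅ * (u₂ * σ³ t - v₂ * σ⁴ t + σ⁵ t + v * t + u₁ * σ t)
            ≈⟨ collect u u₁ u₂ u₄ u₅ v v₂ v₃ v₄ v₅ t (σ t) (σ² t) (σ³ t) (σ⁴ t) (σ⁵ t) ⟩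
          ((u - u₅ * u₁) - v₅ * v) * σ t + ((v * v₃ + 1#) - u₂ * u₅) * σ³ t + (u₄ * v + v₄ + v₂ * u₅) * σ⁴ t
            ≈⟨ +-cong (+-cong (*-congʳ (+-congˡ (-‿cong v₅v))) (*-congʳ (+-cong (+-congʳ vv₃) (-‿cong u₂u₅)))) (*-congʳ linear-relation₄) ⟩
          ((u - u₅ * u₁) - (u - u₅ * u₁)) * σ t + ((a - 1# + 1#) - a) * σ³ t + 0# * σ⁴ t
            ≈⟨ solve 5 (λ z a t₁ t₃ t₄ → (z :- z) :* t₁ :+ ((a :- con ℤ.1ℤ :+ con ℤ.1ℤ) :- a) :* t₃ :+ con ℤ.0ℤ :* t₄ := con ℤ.0ℤ)
                 refl _ a (σ t) (σ³ t) (σ⁴ t) ⟩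
          0# ∎)
          where
          collect : ∀ u u₁ u₂ u₄ u₅ v v₂ v₃ v₄ v₅ t t₁ t₂ t₃ t₄ t₅ →
            v * (u₅ * t - v₅ * t₁ + t₂ + v₃ * t₃ + u₄ * t₄) + (u * t₁ - v * t₂ + t₃ + v₄ * t₄ + u₅ * t₅)
              - u₅ * (u₂ * t₃ - v₂ * t₄ + t₅ + v * t + u₁ * t₁) ≈
            ((u - u₅ * u₁) - v₅ * v) * t₁ + ((v * v₃ + 1#) - u₂ * u₅) * t₃ + (u₄ * v + v₄ + v₂ * u₅) * t₄
          collect = solve 16 (λ u u₁ u₂ u₄ u₅ v v₂ v₃ v₄ v₅ t t₁ t₂ t₃ t₄ t₅ →
            v :* (u₅ :* t :- v₅ :* t₁ :+ t₂ :+ v₃ :* t₃ :+ u₄ :* t₄) :+ (u :* t₁ :- v :* t₂ :+ t₃ :+ v₄ :* t₄ :+ u₅ :* t₅)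
              :- u₅ :* (u₂ :* t₃ :- v₂ :* t₄ :+ t₅ :+ v :* t :+ u₁ :* t₁) :=
            ((u :- u₅ :* u₁) :- v₅ :* v) :* t₁ :+ ((v :* v₃ :+ con ℤ.1ℤ) :- u₂ :* u₅) :* t₃ :+ (u₄ :* v :+ v₄ :+ v₂ :* u₅) :* t₄) refl

        M-nonzero : ∃ λ t → M t ≉ 0#
        M-nonzero = let t , nonroot = linearised-nonroot 0# u (- v) 1# v₄ (σ-≉0 (σ-≉0 (σ-≉0 (σ-≉0 (σ-≉0 u≉0))))) in
          t , λ Mt≈0 → nonroot (trans (rearrange u v v₄ u₅ t (σ t) (σ² t) (σ³ t) (σ⁴ t) (σ⁵ t)) Mt≈0)
          where
          rearrange : ∀ u v v₄ u₅ t t₁ t₂ t₃ t₄ t₅ →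
            0# * t + u * t₁ + (- v) * t₂ + 1# * t₃ + v₄ * t₄ + u₅ * t₅ ≈ u * t₁ - v * t₂ + t₃ + v₄ * t₄ + u₅ * t₅
          rearrange = solve 10 (λ u v v₄ u₅ t t₁ t₂ t₃ t₄ t₅ →
            con ℤ.0ℤ :* t :+ u :* t₁ :+ (:- v) :* t₂ :+ con ℤ.1ℤ :* t₃ :+ v₄ :* t₄ :+ u₅ :* t₅ :=
            u :* t₁ :- v :* t₂ :+ t₃ :+ v₄ :* t₄ :+ u₅ :* t₅) refl

        -- The inequality says that M t / x is not fixed by σ⁵, hence is not in 𝔽q. As M₅ has no
        -- term in σ⁵t, the q-polynomial x₅M - xM₅ has top coefficient u₅x₅ ≠ 0.
        M-independent : ∀ {x} → x ≉ 0# → ∃ λ t → M t * σ⁵ x ≉ x * σ⁵ (M t)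
        M-independent {x} x≉0 =
          let t , nonroot = linearised-nonroot (- (x * u₅)) (u * σ⁵ x + x * v₅) (- (v * σ⁵ x) - x)
                 (σ⁵ x - x * v₃) (v₄ * σ⁵ x - x * u₄) {u₅ * σ⁵ x}
                 (*-≉0 (σ-≉0 (σ-≉0 (σ-≉0 (σ-≉0 (σ-≉0 u≉0))))) (σ-≉0 (σ-≉0 (σ-≉0 (σ-≉0 (σ-≉0 x≉0)))))) in
          t , λ eq → nonroot (begin
            _
              ≈⟨ rearrange x (σ⁵ x) u u₄ u₅ v v₃ v₄ v₅ t (σ t) (σ² t) (σ³ t) (σ⁴ t) (σ⁵ t) ⟩
            M t * σ⁵ x - x * (u₅ * t - v₅ * σ t + σ² t + v₃ * σ³ t + u₄ * σ⁴ t)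
              ≈⟨ +-cong eq (-‿cong (*-congˡ (sym (M₅ t)))) ⟩
            x * σ⁵ (M t) - x * σ⁵ (M t)
              ≈⟨ -‿inverseʳ _ ⟩
            0# ∎)
          where
          rearrange : ∀ x x₅ u u₄ u₅ v v₃ v₄ v₅ t t₁ t₂ t₃ t₄ t₅ →
            - (x * u₅) * t + (u * x₅ + x * v₅) * t₁ + (- (v * x₅) - x) * t₂ + (x₅ - x * v₃) * t₃ +
              (v₄ * x₅ - x * u₄) * t₄ + u₅ * x₅ * t₅ ≈
            (u * t₁ - v * t₂ + t₃ + v₄ * t₄ + u₅ * t₅) * x₅ - x * (u₅ * t - v₅ * t₁ + t₂ + v₃ * t₃ + u₄ * t₄)
          rearrange = solve 15 (λ x x₅ u u₄ u₅ v v₃ v₄ v₅ t t₁ t₂ t₃ t₄ t₅ →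
            :- (x :* u₅) :* t :+ (u :* x₅ :+ x :* v₅) :* t₁ :+ (:- (v :* x₅) :- x) :* t₂ :+ (x₅ :- x :* v₃) :* t₃ :+
              (v₄ :* x₅ :- x :* u₄) :* t₄ :+ u₅ :* x₅ :* t₅ :=
            (u :* t₁ :- v :* t₂ :+ t₃ :+ v₄ :* t₄ :+ u₅ :* t₅) :* x₅ :- x :* (u₅ :* t :- v₅ :* t₁ :+ t₂ :+ v₃ :* t₃ :+ u₄ :* t₄)) refl

        -- Subtracting l times the relation for x from that for z gives v(l₅ - l)x₅ = u₅(l₂ - l)x₂.
        -- Multiplying by its third conjugate removes x₂x₅ and leaves only vv₃ = a - 1 and u₂u₅ = a.
        kernel-ratio : ∀ {l x z} → x ≉ 0# → l * x ≈ z → v * σ⁵ x + x ≈ u₅ * σ² x → v * σ⁵ z + z ≈ u₅ * σ² z → CrossRatio a l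
        kernel-ratio {l} {x} {z} x≉0 lx≈z x-relation z-relation = begin
          a * ((l₃ - l) * (l₅ - l₂))
            ≈⟨ solve 5 (λ a l l₂ l₃ l₅ → a :* ((l₃ :- l) :* (l₅ :- l₂)) :=
                 (l :- l₅) :* (l₂ :- l₃) :+ (a :* ((l₂ :- l) :* (l₅ :- l₃)) :- (a :- con ℤ.1ℤ) :* ((l₅ :- l) :* (l₂ :- l₃)))) refl a l l₂ l₃ l₅ ⟩
          (l - l₅) * (l₂ - l₃) + (a * ((l₂ - l) * (l₅ - l₃)) - (a - 1#) * ((l₅ - l) * (l₂ - l₃)))
            ≈⟨ +-congˡ (+-congˡ (-‿cong product-relation)) ⟩
          (l - l₅) * (l₂ - l₃) + (a * ((l₂ - l) * (l₅ - l₃)) - a * ((l₂ - l) * (l₅ - l₃)))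
            ≈⟨ solve 2 (λ z t → z :+ (t :- t) := z) refl _ _ ⟩
          (l - l₅) * (l₂ - l₃) ∎
          where
          l₂ = σ² l
          l₃ = σ³ l
          l₅ = σ⁵ l
          x₂≉0 = σ-≉0 (σ-≉0 x≉0)
          x₅≉0 = σ-≉0 (σ-≉0 (σ-≉0 x₂≉0))
          σ²z : σ² z ≈ l₂ * σ² x
          σ²z = trans (σ-cong (σ-cong (sym lx≈z))) (trans (σ-cong (σ-* _ _)) (σ-* _ _))
          σ⁵z : σ⁵ z ≈ l₅ * σ⁵ x
          σ⁵z = trans (σ-cong (trans (σ-cong (trans (σ-cong σ²z) (σ-* _ _))) (σ-* _ _))) (σ-* _ _)
          relation : v * ((l₅ - l) * σ⁵ x) ≈ u₅ * ((l₂ - l) * σ² x)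
          relation = x∙y⁻¹≈ε⇒x≈y _ _ (begin
            v * ((l₅ - l) * x₅) - u₅ * ((l₂ - l) * x₂)
              ≈⟨ solve 8 (λ v u l l₂ l₅ x x₂ x₅ → v :* ((l₅ :- l) :* x₅) :- u :* ((l₂ :- l) :* x₂) :=
                   (v :* (l₅ :* x₅) :+ l :* x :- u :* (l₂ :* x₂)) :- l :* (v :* x₅ :+ x :- u :* x₂)) refl v u₅ l l₂ l₅ x x₂ x₅ ⟩
            (v * (l₅ * x₅) + l * x - u₅ * (l₂ * x₂)) - l * (v * x₅ + x - u₅ * x₂)
              ≈⟨ +-cong (+-cong (+-cong (*-congˡ (sym σ⁵z)) lx≈z) (-‿cong (*-congˡ (sym σ²z))))
                   (-‿cong (*-congˡ (+-congʳ x-relation))) ⟩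
            (v * σ⁵ z + z - u₅ * σ² z) - l * (u₅ * x₂ - u₅ * x₂)
              ≈⟨ +-congʳ (+-congʳ z-relation) ⟩
            (u₅ * σ² z - u₅ * σ² z) - l * (u₅ * x₂ - u₅ * x₂)
              ≈⟨ solve 3 (λ a b l → (a :- a) :- l :* (b :- b) := con ℤ.0ℤ) refl _ _ l ⟩
            0# ∎)
            where
            x₂ = σ² x
            x₅ = σ⁵ x
          relation₃ : v₃ * ((l₂ - l₃) * σ² x) ≈ u₂ * ((l₅ - l₃) * σ⁵ x)
          relation₃ = conjugate (refl σ* ((refl σ- refl) σ* refl)) (refl σ* ((refl σ- refl) σ* refl))
            (conjugate (refl σ* ((refl σ- refl) σ* refl)) (refl σ* ((refl σ- refl) σ* refl))
            (conjugate (refl σ* ((σ⁶ l σ- refl) σ* σ⁶ x)) (σ⁶ u σ* ((refl σ- refl) σ* refl)) relation))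
          product-relation : (a - 1#) * ((l₅ - l) * (l₂ - l₃)) ≈ a * ((l₂ - l) * (l₅ - l₃))
          product-relation = *-cancelˡ (*-≉0 x₂≉0 x₅≉0) (begin
            σ² x * σ⁵ x * ((a - 1#) * ((l₅ - l) * (l₂ - l₃)))
              ≈⟨ *-congˡ (*-congʳ vv₃) ⟨
            σ² x * σ⁵ x * (v * v₃ * ((l₅ - l) * (l₂ - l₃)))
              ≈⟨ solve 6 (λ x₂ x₅ v v₃ d e → x₂ :* x₅ :* (v :* v₃ :* (d :* e)) := v :* (d :* x₅) :* (v₃ :* (e :* x₂)))
                   refl (σ² x) (σ⁵ x) v v₃ (l₅ - l) (l₂ - l₃) ⟩
            v * ((l₅ - l) * σ⁵ x) * (v₃ * ((l₂ - l₃) * σ² x))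
              ≈⟨ *-cong relation relation₃ ⟩
            u₅ * ((l₂ - l) * σ² x) * (u₂ * ((l₅ - l₃) * σ⁵ x))
              ≈⟨ solve 6 (λ x₂ x₅ u₂ u₅ d e → u₅ :* (d :* x₂) :* (u₂ :* (e :* x₅)) := x₂ :* x₅ :* (u₂ :* u₅ :* (d :* e)))
                   refl (σ² x) (σ⁵ x) u₂ u₅ (l₂ - l) (l₅ - l₃) ⟩
            σ² x * σ⁵ x * (u₂ * u₅ * ((l₂ - l) * (l₅ - l₃)))
              ≈⟨ *-congˡ (*-congʳ u₂u₅) ⟩
            σ² x * σ⁵ x * (a * ((l₂ - l) * (l₅ - l₃))) ∎)

        cross-ratio : ∃ λ l → σ l ≉ l × CrossRatio a l
        cross-ratio = ratio M-nonzero
          where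
          ratio : (∃ λ t → M t ≉ 0#) → ∃ λ l → σ l ≉ l × CrossRatio a l
          ratio (s , x≉0) = l , l∉𝔽q , kernel-ratio x≉0 lx≈z (M-relation s) (M-relation t)
            where
            x z l : Carrier
            x = M s
            independent = M-independent x≉0
            t = proj₁ independent
            z = M t
            l = divide z x x≉0
            lx≈z : l * x ≈ z
            lx≈z = divide-* z x≉0
            l∉𝔽q : σ l ≉ l
            l∉𝔽q l₁≈l = proj₂ independent (begin
              z * σ⁵ x            ≈⟨ *-congʳ lx≈z ⟨
              l * x * σ⁵ x        ≈⟨ solve 3 (λ l x y → l :* x :* y := x :* (l :* y)) refl l x (σ⁵ x) ⟩
              x * (l * σ⁵ x)      ≈⟨ *-congˡ (*-congʳ (σ-injective (trans (σ⁶ l) (sym l₁≈l)))) ⟨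
              x * (σ⁵ l * σ⁵ x)   ≈⟨ *-congˡ σ⁵z ⟨
              x * σ⁵ z            ∎)
              where
              σ⁵z : σ⁵ z ≈ σ⁵ l * σ⁵ x
              σ⁵z = conjugate refl (σ-* _ _) (conjugate refl (σ-* _ _) (conjugate refl (σ-* _ _)
                      (conjugate refl (σ-* _ _) (conjugate refl (σ-* _ _) (sym lx≈z)))))

    cross-ratio-exists : ∃ λ l → σ l ≉ l × CrossRatio a l
    cross-ratio-exists =
      let u , u≉0 , uu₃ , uu₂u₄ = norms
          open Kernel u≉0 uu₃ uu₂u₄
          v , _ , vv₁ = v-data
      in Image.cross-ratio vv₁

  -- Scatteredness in terms of cross-ratios.

  f : Carrier → Carrier → Carrier
  f α x = σ⁵ x + α * σ² x

  f₃≈f : ∀ α x → f₃ q F α x ≈ f α x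
  f₃≈f α x = +-cong (^q⁵ x) (*-congˡ (^q² x))

  f-cong : ∀ α {x y} → x ≈ y → f α x ≈ f α y
  f-cong α x≈y = let eq₂ = σ-cong (σ-cong x≈y) in +-cong (σ-cong (σ-cong (σ-cong eq₂))) (*-congˡ eq₂)

  -- f α (l * x) ≈ l * f α x says that l * x and x give the same point of the linear set.
  Injective : Carrier → Set (c ⊔ ℓ)
  Injective α = ∀ {x l} → x ≉ 0# → f α (l * x) ≈ l * f α x → σ l ≈ l

  -- The vectors of x and lx lie on the same point. If its weight is one, both are 𝔽q-multiples of a
  -- single vector, and l is the quotient of the two scalars.
  scattered⇒injective : ∀ {α} → IsScattered q F (f₃ q F α) → Injective α
  scattered⇒injective {α} scattered {x} {l} x≉0 eq =
    from-basis (scattered point (x , x≉0 , (λ z → z) , (λ z → z)))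
    where
    point : Point q F
    point = record { vector = x , f₃ q F α x ; nonzero = λ (x≈0 , _) → x≉0 x≈0 }
    from-basis : HasWeight q F (f₃ q F α) point 1 → σ l ≈ l
    from-basis (b , basis) = σl≈l
      where
      open IsBasis basis
      lx-spanned = spanning (l * x , f₃ q F α (l * x))
        ((l * x , refl , refl) , (l , refl , trans (f₃≈f α _) (trans eq (*-congˡ (sym (f₃≈f α x))))))
      x-spanned = spanning (x , f₃ q F α x) ((x , refl , refl) , (1# , sym (*-identityˡ _) , sym (*-identityˡ _)))
      m = proj₁ x-spanned zero
      k = proj₁ lx-spanned zero
      w = proj₁ (b zero)
      m∈𝔽q : σ m ≈ m
      m∈𝔽q = proj₁ (proj₂ x-spanned) zero
      k∈𝔽q : σ k ≈ k
      k∈𝔽q = proj₁ (proj₂ lx-spanned) zero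
      x≈mw : x ≈ m * w
      x≈mw = trans (proj₁ (proj₂ (proj₂ x-spanned))) (+-identityʳ _)
      lx≈kw : l * x ≈ k * w
      lx≈kw = trans (proj₁ (proj₂ (proj₂ lx-spanned))) (+-identityʳ _)
      m≉0 : m ≉ 0#
      m≉0 m≈0 = x≉0 (trans x≈mw (trans (*-congʳ m≈0) (zeroˡ w)))
      w≉0 : w ≉ 0#
      w≉0 w≈0 = x≉0 (trans x≈mw (trans (*-congˡ w≈0) (zeroʳ m)))
      ml≈k : m * l ≈ k
      ml≈k = *-cancelˡ w≉0 (begin
        w * (m * l)      ≈⟨ solve 3 (λ w m l → w :* (m :* l) := l :* (m :* w)) refl w m l ⟩
        l * (m * w)      ≈⟨ *-congˡ x≈mw ⟨
        l * x            ≈⟨ lx≈kw ⟩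
        k * w            ≈⟨ *-comm k w ⟩
        w * k            ∎)
      σl≈l : σ l ≈ l
      σl≈l = *-cancelˡ m≉0 (begin
        m * σ l          ≈⟨ *-congʳ m∈𝔽q ⟨
        σ m * σ l        ≈⟨ conjugate (σ-* m l) k∈𝔽q ml≈k ⟩
        k                ≈⟨ ml≈k ⟨
        m * l            ∎)

  -- The vector (x, f x) defining the point is itself a basis: any other vector of the graph on that
  -- point is l times it, and injectivity puts l in 𝔽q.
  injective⇒scattered : ∀ {α} → Injective α → IsScattered q F (f₃ q F α)
  injective⇒scattered {α} injective P (x , x≉0 , P⊆x , x⊆P) = (λ _ → x , f₃ q F α x) , record
    { contained   = λ _ → (x , refl , refl) , x⊆P (1# , sym (*-identityˡ _) , sym (*-identityˡ _))
    ; independent = λ a _ (eq , _) → λ { zero → *-cancelˡ-0 x≉0 (trans (*-comm _ _) (trans (sym (+-identityʳ _)) eq)) }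
    ; spanning    = λ { (v₁ , v₂) ((x′ , v₁≈x′ , v₂≈fx′) , v∈P) →
        let l , v₁≈lx , v₂≈lfx = P⊆x v∈P
            x′≈lx = trans (sym v₁≈x′) v₁≈lx
        in (λ _ → l)
         , (λ _ → injective x≉0 (begin
             f α (l * x)         ≈⟨ f-cong α x′≈lx ⟨
             f α x′              ≈⟨ f₃≈f α x′ ⟨
             f₃ q F α x′         ≈⟨ v₂≈fx′ ⟨
             v₂                  ≈⟨ v₂≈lfx ⟩
             l * f₃ q F α x      ≈⟨ *-congˡ (f₃≈f α x) ⟩
             l * f α x           ∎))
         , trans v₁≈lx (sym (+-identityʳ _)) , trans v₂≈lfx (sym (+-identityʳ _)) }
    }

  -- Here `a` stands for the quantity A, given by its defining equation instead of a quotient.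
  module _ {α a} (α≉0 : α ≉ 0#) (δ≉1 : α * σ³ α ≉ 1#) (a[1-δ]≈-δ : a * (1# - α * σ³ α) ≈ - (α * σ³ α)) where
    private
      δ = α * σ³ α
      δ≉0 : δ ≉ 0#
      δ≉0 = *-≉0 α≉0 (σ-≉0 (σ-≉0 (σ-≉0 α≉0)))

      σ³δ≈δ : σ³ δ ≈ δ
      σ³δ≈δ = trans (σ-cong (trans (σ-cong (refl σ* refl)) (refl σ* refl))) (trans (refl σ* σ⁶ α) (*-comm _ _))

      1-δ≉0 : 1# - δ ≉ 0#
      1-δ≉0 = ≉⇒-≉0 (δ≉1 ∘ sym)

    a≉0 : a ≉ 0#
    a≉0 a≈0 = δ≉0 (begin
      δ                      ≈⟨ solve 1 (λ x → x := :- (:- x)) refl δ ⟩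
      - - δ                  ≈⟨ -‿cong a[1-δ]≈-δ ⟨
      - (a * (1# - δ))       ≈⟨ -‿cong (*-congʳ a≈0) ⟩
      - (0# * (1# - δ))      ≈⟨ solve 1 (λ x → :- (con ℤ.0ℤ :* x) := con ℤ.0ℤ) refl _ ⟩
      0#                     ∎)

    a≉1 : a ≉ 1#
    a≉1 a≈1 = 0≉1 (sym (begin
      1#                        ≈⟨ solve 1 (λ d → con ℤ.1ℤ := con ℤ.1ℤ :* (con ℤ.1ℤ :- d) :+ d) refl δ ⟩
      1# * (1# - δ) + δ         ≈⟨ +-congʳ (*-congʳ a≈1) ⟨
      a * (1# - δ) + δ          ≈⟨ +-congʳ a[1-δ]≈-δ ⟩
      - δ + δ                   ≈⟨ -‿inverseˡ δ ⟩
      0#                        ∎))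

    σ³a≈a : σ³ a ≈ a
    σ³a≈a = *-cancelˡ 1-δ≉0 (begin
      (1# - δ) * σ³ a          ≈⟨ *-comm _ _ ⟩
      σ³ a * (1# - δ)          ≈⟨ *-congˡ (+-congˡ (-‿cong σ³δ≈δ)) ⟨
      σ³ a * (1# - σ³ δ)       ≈⟨ conjugate (refl σ* (σ-1 σ- refl)) (σ-: refl) (conjugate (refl σ* (σ-1 σ- refl)) (σ-: refl)
                                    (conjugate (refl σ* (σ-1 σ- refl)) (σ-: refl) a[1-δ]≈-δ)) ⟩
      - σ³ δ                   ≈⟨ -‿cong σ³δ≈δ ⟩
      - δ                      ≈⟨ a[1-δ]≈-δ ⟨
      a * (1# - δ)             ≈⟨ *-comm _ _ ⟩
      (1# - δ) * a             ∎)

    module _ {l : Carrier} where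
      private
        l₂ = σ² l
        l₃ = σ³ l
        l₅ = σ⁵ l
        U V W : Carrier
        U = (l₅ - l) * (l₂ - l₃)
        V = (l₂ - l) * (l₅ - l₃)
        W = (l₃ - l) * (l₅ - l₂)

        -- The three-term relation between the differences of four elements. It trades one
        -- cross-ratio, δ = U/V, for another, A = -U/W.
        V≈U+W : V ≈ U + W
        V≈U+W = solve 4 (λ l l₂ l₃ l₅ → (l₂ :- l) :* (l₅ :- l₃) := (l₅ :- l) :* (l₂ :- l₃) :+ (l₃ :- l) :* (l₅ :- l₂)) refl l l₂ l₃ l₅

        -U≈ : - U ≈ (l - l₅) * (l₂ - l₃)
        -U≈ = solve 4 (λ l l₂ l₃ l₅ → :- ((l₅ :- l) :* (l₂ :- l₃)) := (l :- l₅) :* (l₂ :- l₃)) refl l l₂ l₃ l₅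

      U≈δV⇒cross-ratio : U ≈ δ * V → CrossRatio a l
      U≈δV⇒cross-ratio U≈δV = trans (x∙y⁻¹≈ε⇒x≈y _ _ (*-cancelˡ-0 1-δ≉0 (begin
        (1# - δ) * (a * W - (- U))
          ≈⟨ solve 4 (λ d a w u → (con ℤ.1ℤ :- d) :* (a :* w :- (:- u)) := a :* (con ℤ.1ℤ :- d) :* w :+ (u :- d :* u)) refl δ a W U ⟩
        a * (1# - δ) * W + (U - δ * U)
          ≈⟨ +-cong (*-congʳ a[1-δ]≈-δ) (+-congʳ (trans U≈δV (*-congˡ V≈U+W))) ⟩
        - δ * W + (δ * (U + W) - δ * U)
          ≈⟨ solve 3 (λ d u w → (:- d) :* w :+ (d :* (u :+ w) :- d :* u) := con ℤ.0ℤ) refl δ U W ⟩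
        0# ∎))) -U≈

      cross-ratio⇒U≈δV : CrossRatio a l → U ≈ δ * V
      cross-ratio⇒U≈δV cr = x∙y⁻¹≈ε⇒x≈y _ _ (*-cancelˡ-0 a≉0 (begin
        a * (U - δ * V)
          ≈⟨ *-congˡ (+-congˡ (-‿cong (*-congˡ V≈U+W))) ⟩
        a * (U - δ * (U + W))
          ≈⟨ solve 4 (λ d a w u → a :* (u :- d :* (u :+ w)) := a :* (con ℤ.1ℤ :- d) :* u :- d :* (a :* w)) refl δ a W U ⟩
        a * (1# - δ) * U - δ * (a * W)
          ≈⟨ +-cong (*-congʳ a[1-δ]≈-δ) (-‿cong (*-congˡ (trans cr (sym -U≈)))) ⟩
        - δ * U - δ * (- U)
          ≈⟨ solve 2 (λ d u → (:- d) :* u :- d :* (:- u) := con ℤ.0ℤ) refl δ U ⟩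
        0# ∎))

      -- The equation (l₅ - l)x₅ = -α(l₂ - l)x₂ involves x only through x₂ and x₅, which σ³
      -- interchanges. The product with its third conjugate is therefore free of x.
      semilinear⇒cross-ratio : ∀ {x} → x ≉ 0# → f α (l * x) ≈ l * f α x → CrossRatio a l
      semilinear⇒cross-ratio {x} x≉0 eq = U≈δV⇒cross-ratio (*-cancelˡ (*-≉0 x₂≉0 x₅≉0) (begin
        x₂ * x₅ * U
          ≈⟨ solve 4 (λ x y d e → x :* y :* (d :* e) := d :* y :* (e :* x)) refl x₂ x₅ _ _ ⟩
        (l₅ - l) * x₅ * ((l₂ - l₃) * x₂)
          ≈⟨ *-cong relation relation₃ ⟩
        - (α * ((l₂ - l) * x₂)) * (- (α₃ * ((l₅ - l₃) * x₅)))
          ≈⟨ solve 6 (λ x y d e a b → :- (a :* (d :* x)) :* (:- (b :* (e :* y))) := x :* y :* (a :* b :* (d :* e))) refl x₂ x₅ _ _ α α₃ ⟩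
        x₂ * x₅ * (δ * V) ∎))
        where
        x₂ = σ² x
        x₅ = σ⁵ x
        α₃ = σ³ α
        x₂≉0 : x₂ ≉ 0#
        x₂≉0 = σ-≉0 (σ-≉0 x≉0)
        x₅≉0 : x₅ ≉ 0#
        x₅≉0 = σ-≉0 (σ-≉0 (σ-≉0 x₂≉0))
        σ²[lx] : σ² (l * x) ≈ l₂ * x₂
        σ²[lx] = trans (σ-cong (refl σ* refl)) (refl σ* refl)
        σ⁵[lx] : σ⁵ (l * x) ≈ l₅ * x₅
        σ⁵[lx] = trans (σ-cong (trans (σ-cong (trans (σ-cong σ²[lx]) (refl σ* refl))) (refl σ* refl))) (refl σ* refl)
        relation : (l₅ - l) * x₅ ≈ - (α * ((l₂ - l) * x₂))
        relation = x∙y⁻¹≈ε⇒x≈y _ _ (begin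
          (l₅ - l) * x₅ - (- (α * ((l₂ - l) * x₂)))
            ≈⟨ solve 6 (λ l l₂ l₅ x₂ x₅ α → (l₅ :- l) :* x₅ :- (:- (α :* ((l₂ :- l) :* x₂))) :=
                 (l₅ :* x₅ :+ α :* (l₂ :* x₂)) :- l :* (x₅ :+ α :* x₂)) refl l l₂ l₅ x₂ x₅ α ⟩
          (l₅ * x₅ + α * (l₂ * x₂)) - l * (x₅ + α * x₂)
            ≈⟨ +-congʳ (+-cong σ⁵[lx] (*-congˡ σ²[lx])) ⟨
          f α (l * x) - l * f α x
            ≈⟨ trans (+-congʳ eq) (-‿inverseʳ _) ⟩
          0# ∎)
        relation₃ : (l₂ - l₃) * x₂ ≈ - (α₃ * ((l₅ - l₃) * x₅))
        relation₃ = conjugate ((refl σ- refl) σ* refl) (σ-: (refl σ* ((refl σ- refl) σ* refl)))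
          (conjugate ((refl σ- refl) σ* refl) (σ-: (refl σ* ((refl σ- refl) σ* refl)))
          (conjugate ((σ⁶ l σ- refl) σ* σ⁶ x) (σ-: (refl σ* ((refl σ- refl) σ* refl))) relation))

      -- The equation prescribes the quotient r of x₅ = σ³(x₂) by x₂. U = δV says exactly that r has
      -- norm 1 to 𝔽q³.
      cross-ratio⇒semilinear : CrossRatio a l → σ l ≉ l → ∃ λ x → x ≉ 0# × f α (l * x) ≈ l * f α x
      cross-ratio⇒semilinear cr l∉𝔽q = from-hilbert90 (hilbert90-q³ norm-r)
        where
        l₅-l≉0 : l₅ - l ≉ 0#
        l₅-l≉0 = ≉⇒-≉0 (λ l₅≈l → l∉𝔽q (conjugate refl (σ⁶ l) (sym l₅≈l)))
        i = (l₅ - l) ⁻¹⟨ l₅-l≉0 ⟩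
        i-inverse : (l₅ - l) * i ≈ 1#
        i-inverse = ⁻¹-inverseʳ l₅-l≉0
        r : Carrier
        r = - (α * (l₂ - l)) * i
        [l₅-l]r : (l₅ - l) * r ≈ - (α * (l₂ - l))
        [l₅-l]r = trans (solve 3 (λ d e i → d :* (e :* i) := e :* (d :* i)) refl (l₅ - l) _ i)
                    (trans (*-congˡ i-inverse) (*-identityʳ _))
        [l₂-l₃]r₃ : (l₂ - l₃) * σ³ r ≈ - (σ³ α * (l₅ - l₃))
        [l₂-l₃]r₃ = conjugate ((refl σ- refl) σ* refl) (σ-: (refl σ* (refl σ- refl)))
          (conjugate ((refl σ- refl) σ* refl) (σ-: (refl σ* (refl σ- refl)))
          (conjugate ((σ⁶ l σ- refl) σ* refl) (σ-: (refl σ* (refl σ- refl))) [l₅-l]r))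
        l₂-l₃≉0 : l₂ - l₃ ≉ 0#
        l₂-l₃≉0 = ≉⇒-≉0 (λ eq → l∉𝔽q (sym (σ-injective (σ-injective eq))))
        norm-r : r * σ³ r ≈ 1#
        norm-r = *-cancelˡ (*-≉0 l₅-l≉0 l₂-l₃≉0) (begin
          U * (r * σ³ r)
            ≈⟨ solve 4 (λ d e r s → d :* e :* (r :* s) := d :* r :* (e :* s)) refl (l₅ - l) (l₂ - l₃) r (σ³ r) ⟩
          (l₅ - l) * r * ((l₂ - l₃) * σ³ r)
            ≈⟨ *-cong [l₅-l]r [l₂-l₃]r₃ ⟩
          - (α * (l₂ - l)) * (- (σ³ α * (l₅ - l₃)))
            ≈⟨ solve 4 (λ a d b e → :- (a :* d) :* (:- (b :* e)) := a :* b :* (d :* e)) refl α (l₂ - l) (σ³ α) (l₅ - l₃) ⟩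
          δ * V
            ≈⟨ cross-ratio⇒U≈δV cr ⟨
          U
            ≈⟨ *-identityʳ U ⟨
          U * 1# ∎)
        from-hilbert90 : (∃ λ z → z ≉ 0# × σ³ z ≈ r * z) → ∃ λ x → x ≉ 0# × f α (l * x) ≈ l * f α x
        from-hilbert90 (z , z≉0 , σ³z≈rz) = x , σ-≉0 (σ-≉0 (σ-≉0 (σ-≉0 z≉0))) , x∙y⁻¹≈ε⇒x≈y _ _ (begin
          f α (l * x) - l * f α x
            ≈⟨ +-cong (+-cong σ⁵[lx] (*-congˡ σ²[lx])) (-‿cong (*-congˡ (+-cong x₅≈rz (*-congˡ x₂≈z)))) ⟩
          (l₅ * (r * z) + α * (l₂ * z)) - l * (r * z + α * z)
            ≈⟨ solve 6 (λ l l₂ l₅ r z α → (l₅ :* (r :* z) :+ α :* (l₂ :* z)) :- l :* (r :* z :+ α :* z) :=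
                 ((l₅ :- l) :* r :+ α :* (l₂ :- l)) :* z) refl l l₂ l₅ r z α ⟩
          ((l₅ - l) * r + α * (l₂ - l)) * z
            ≈⟨ *-congʳ (trans (+-congʳ [l₅-l]r) (-‿inverseˡ _)) ⟩
          0# * z
            ≈⟨ zeroˡ z ⟩
          0# ∎)
          where
          -- Hilbert 90 supplies z in the role of x₂, and σ⁴ inverts σ².
          x = σ⁴ z
          x₂≈z : σ² x ≈ z
          x₂≈z = σ⁶ z
          x₅≈rz : σ⁵ x ≈ r * z
          x₅≈rz = trans (σ⁶ (σ³ z)) σ³z≈rz
          σ²[lx] : σ² (l * x) ≈ l₂ * z
          σ²[lx] = trans (σ-cong (refl σ* refl)) (refl σ* x₂≈z)
          σ⁵[lx] : σ⁵ (l * x) ≈ l₅ * (r * z)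
          σ⁵[lx] = trans (σ-cong (trans (σ-cong (trans (σ-cong σ²[lx]) (refl σ* refl))) (refl σ* refl))) (refl σ* σ³z≈rz)

    injective⇒no-cross-ratio : Injective α → ∀ {l} → CrossRatio a l → σ l ≈ l
    injective⇒no-cross-ratio injective {l} cr = decidable-stable (σ l ≟ l) λ l∉𝔽q →
      let x , x≉0 , eq = cross-ratio⇒semilinear cr l∉𝔽q in l∉𝔽q (injective x≉0 eq)

    no-cross-ratio⇒injective : (∀ {l} → CrossRatio a l → σ l ≈ l) → Injective α
    no-cross-ratio⇒injective no-cr x≉0 eq = no-cr (semilinear⇒cross-ratio x≉0 eq)

  -- The alternative for the roots of the quadratic equation.

  IsRoot⇔root-form : ∀ a y → IsRoot q F a y ⇔ (root-form a y ≈ 0#)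
  IsRoot⇔root-form a y = mk⇔ (trans (sym eq)) (trans eq)
    where
    eq : y ^ 2 - (Tr[q³/q] q F a - 1#) * y + N[q³/q] q F a ≈ root-form a y
    eq = begin
      y ^ 2 - (Tr[q³/q] q F a - 1#) * y + N[q³/q] q F a
        ≈⟨ +-cong (+-congˡ (-‿cong (*-congʳ (+-congʳ (+-cong (^q⁰ a) (+-cong (^q¹ a) (+-congʳ (^q² a))))))))
             (*-cong (^q⁰ a) (*-cong (^q¹ a) (*-congʳ (^q² a)))) ⟩
      y * (y * 1#) - (a + (σ a + (σ² a + 0#)) - 1#) * y + a * (σ a * (σ² a * 1#))
        ≈⟨ solve 4 (λ y a b c → y :* (y :* con ℤ.1ℤ) :- (a :+ (b :+ (c :+ con ℤ.0ℤ)) :- con ℤ.1ℤ) :* y :+ a :* (b :* (c :* con ℤ.1ℤ)) :=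
             y :* y :- (a :+ b :+ c :- con ℤ.1ℤ) :* y :+ a :* b :* c) refl y a (σ a) (σ² a) ⟩
      root-form a y ∎

  two-roots : ∀ {a y z} → σ y ≈ y → σ z ≈ z → y ≉ z → root-form a y ≈ 0# → root-form a z ≈ 0# → HasTwoRootsIn𝔽q q F a
  two-roots {a} y∈𝔽q z∈𝔽q y≉z y-root z-root =
    _ , _ , y∈𝔽q , z∈𝔽q , y≉z , Equivalence.from (IsRoot⇔root-form a _) y-root , Equivalence.from (IsRoot⇔root-form a _) z-root

  two-roots⇒no-cross-ratio : ∀ {a} → HasTwoRootsIn𝔽q q F a → ∀ {l} → CrossRatio a l → σ l ≈ l
  two-roots⇒no-cross-ratio {a} (y , z , y∈𝔽q , z∈𝔽q , y≉z , y-root , z-root) {l} cr =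
    decidable-stable (σ l ≟ l) λ l∉𝔽q → y≉z (roots-equal cr l∉𝔽q y∈𝔽q z∈𝔽q
      (Equivalence.to (IsRoot⇔root-form a y) y-root) (Equivalence.to (IsRoot⇔root-form a z) z-root))

  module _ {a : Carrier} (σ³a≈a : σ³ a ≈ a) where
    private
      s n : Carrier
      s = a + σ a + σ² a - 1#
      n = a * σ a * σ² a

      σs≈s : σ s ≈ s
      σs≈s = trans (refl σ+ refl σ+ σ³a≈a σ- σ-1)
        (solve 3 (λ a b c → b :+ c :+ a :- con ℤ.1ℤ := a :+ b :+ c :- con ℤ.1ℤ) refl a (σ a) (σ² a))

      σn≈n : σ n ≈ n
      σn≈n = trans (refl σ* refl σ* σ³a≈a) (solve 3 (λ a b c → b :* c :* a := a :* b :* c) refl a (σ a) (σ² a))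

      -- The case σy = y is allowed: a double root in 𝔽q counts as conjugate to itself, so it falls
      -- on the side that is not scattered.
      Conjugates : Carrier → Set ℓ
      Conjugates y = y + σ y ≈ s × y * σ y ≈ n

      conjugates : ∀ {y z} → z ≈ s - y → σ y ≈ z → root-form a y ≈ 0# → Conjugates y
      conjugates {y} {z} z≈s-y σy≈z root =
        (begin
          y + σ y          ≈⟨ +-congˡ (trans σy≈z z≈s-y) ⟩
          y + (s - y)      ≈⟨ solve 2 (λ y s → y :+ (s :- y) := s) refl y s ⟩
          s                ∎) ,
        (begin
          y * σ y          ≈⟨ *-congˡ (trans σy≈z z≈s-y) ⟩
          y * (s - y)      ≈⟨ solve 3 (λ y s n → y :* (s :- y) := n :- (y :* y :- s :* y :+ n)) refl y s n ⟩
          n - root-form a y  ≈⟨ +-congˡ (-‿cong root) ⟩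
          n - 0#           ≈⟨ solve 1 (λ n → n :- con ℤ.0ℤ := n) refl n ⟩
          n                ∎)

      complement-root : ∀ {y} → root-form a y ≈ 0# → root-form a (s - y) ≈ 0#
      complement-root {y} root = trans
        (solve 3 (λ y s n → (s :- y) :* (s :- y) :- s :* (s :- y) :+ n := y :* y :- s :* y :+ n) refl y s n) root

      root-form≈0 : ∀ {y} → y * y ≈ s * y + - n → root-form a y ≈ 0#
      root-form≈0 {y} eq = trans (+-congʳ (+-congʳ eq))
        (solve 3 (λ y s n → s :* y :+ :- n :- s :* y :+ n := con ℤ.0ℤ) refl y s n)

      2≤q⁶ : 2 ≤ q ℕ.^ 6
      2≤q⁶ = ℕ.≤-trans 2≤q (≡.subst (_≤ q ℕ.^ 6) (ℕ.^-identityʳ q) (ℕ.<⇒≤ (q^i<q^j {1} {6} (s≤s (s≤s z≤n)))))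

      root∈𝔽q? : Dec (∃ λ y → σ y ≈ y × root-form a y ≈ 0#)
      root∈𝔽q? = any?
        (λ x≈y (σx≈x , root) → trans (σ-cong (sym x≈y)) (trans σx≈x x≈y) ,
          trans (+-congʳ (+-cong (*-cong (sym x≈y) (sym x≈y)) (-‿cong (*-congˡ (sym x≈y))))) root)
        (λ y → (σ y ≟ y) ×-dec (root-form a y ≟ 0#))

      root∈𝔽q⇒ : (∃ λ y → σ y ≈ y × root-form a y ≈ 0#) → HasTwoRootsIn𝔽q q F a ⊎ ∃ Conjugates
      root∈𝔽q⇒ (y , y∈𝔽q , root) = decide (y ≟ (s - y))
        where
        decide : Dec (y ≈ s - y) → HasTwoRootsIn𝔽q q F a ⊎ ∃ Conjugates
        decide (yes y≈s-y) = inj₂ (y , conjugates y≈s-y y∈𝔽q root)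
        decide (no  y≉s-y) = inj₁ (two-roots y∈𝔽q (σs≈s σ- y∈𝔽q) y≉s-y root (complement-root root))

      no-root∈𝔽q⇒ : ¬ (∃ λ y → σ y ≈ y × root-form a y ≈ 0#) → ∃ Conjugates
      -- The exponent 3 comes from q⁶ = (q²)³, which is what makes the field contain the roots of
      -- quadratics over 𝔽q. The sign of n is that of the form y² = sy + e.
      no-root∈𝔽q⇒ no-root = from-root (quadratic-root j p-prime p·1≈0 q≡p^j 3 (≡.sym (ℕ.^-*-assoc q 2 3)) 2≤q⁶ σs≈s (σ-: σn≈n))
        where
        from-root : (∃ λ y → y * y ≈ s * y + - n) → ∃ Conjugates
        from-root (y , eq) = y ,
          [ (λ y∈𝔽q → contradiction (y , y∈𝔽q , root-form≈0 eq) no-root)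
          , (λ σy+y≈s → conjugates (x≈z-y σy+y≈s) refl (root-form≈0 eq)) ]′
          (QuadraticConjugate.conjugate-cases commutativeRing {q} σ-+ zero-product eq σs≈s (σ-: σn≈n))
          where
          x≈z-y : ∀ {x y z} → x + y ≈ z → x ≈ z - y
          x≈z-y {x} {y} eq = trans (solve 2 (λ x y → x := x :+ y :- y) refl x y) (+-congʳ eq)

    two-roots-or-conjugates : HasTwoRootsIn𝔽q q F a ⊎ ∃ Conjugates
    two-roots-or-conjugates = decide root∈𝔽q?
      where
      decide : Dec (∃ λ y → σ y ≈ y × root-form a y ≈ 0#) → HasTwoRootsIn𝔽q q F a ⊎ ∃ Conjugates
      decide (yes root)   = root∈𝔽q⇒ root
      decide (no no-root) = inj₂ (no-root∈𝔽q⇒ no-root)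

    no-cross-ratio⇒two-roots : a ≉ 0# → a ≉ 1# → (∀ {l} → CrossRatio a l → σ l ≈ l) → HasTwoRootsIn𝔽q q F a
    no-cross-ratio⇒two-roots a≉0 a≉1 no-cr = [ (λ two → two) , impossible ]′ two-roots-or-conjugates
      where
      impossible : ∃ Conjugates → HasTwoRootsIn𝔽q q F a
      impossible (y , sum-eq , product-eq) =
        let l , l∉𝔽q , cr = Construction.cross-ratio-exists a≉0 a≉1 σ³a≈a sum-eq product-eq
        in contradiction (no-cr cr) l∉𝔽q

  N≈ασ³α : ∀ α → N[q⁶/q³] q F α ≈ α * σ³ α
  N≈ασ³α α = trans (^-homo-* α (q ℕ.^ 3) 1) (trans (*-cong (^q³ α) (*-identityʳ α)) (*-comm _ _))

  module _ {α} (N≉0 : N[q⁶/q³] q F α ≉ 0#) (N≉1 : N[q⁶/q³] q F α ≉ 1#) where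
    private
      N = N[q⁶/q³] q F α
      δ≉1 : α * σ³ α ≉ 1#
      δ≉1 eq = N≉1 (trans (N≈ασ³α α) eq)
      α≉0 : α ≉ 0#
      α≉0 α≈0 = N≉0 (trans (N≈ασ³α α) (trans (*-congʳ α≈0) (zeroˡ _)))

    A[1-δ]≈-δ : A q F α N≉1 * (1# - α * σ³ α) ≈ - (α * σ³ α)
    A[1-δ]≈-δ = begin
      A q F α N≉1 * (1# - α * σ³ α)    ≈⟨ *-congˡ (+-congˡ (-‿cong (N≈ασ³α α))) ⟨
      A q F α N≉1 * (1# - N)           ≈⟨ divide-* (- N) (x≉y⇒y-x≉0 N≉1) ⟩
      - N                              ≈⟨ -‿cong (N≈ασ³α α) ⟩
      - (α * σ³ α)                     ∎

    scattered⇔two-roots : IsScattered q F (f₃ q F α) ⇔ HasTwoRootsIn𝔽q q F (A q F α N≉1)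
    scattered⇔two-roots = mk⇔
      (λ scattered → no-cross-ratio⇒two-roots (σ³a≈a α≉0 δ≉1 A[1-δ]≈-δ) (a≉0 α≉0 δ≉1 A[1-δ]≈-δ) (a≉1 α≉0 δ≉1 A[1-δ]≈-δ)
        (injective⇒no-cross-ratio α≉0 δ≉1 A[1-δ]≈-δ (scattered⇒injective scattered)))
      (λ two → injective⇒scattered (no-cross-ratio⇒injective α≉0 δ≉1 A[1-δ]≈-δ (two-roots⇒no-cross-ratio two)))

  -- Existence of a scattered example for q > 2.

  -- With mᵢ = 1/(1 - lᵢ), and up to factors 1 - lᵢ and signs, r is l - m₂, t is l₂ - m and e is l -
  -- m. In the hexagon l, m₂, l₁, m, l₂, m₁ the conjugates of r and of t are thus the alternate
  -- sides, and those of e the long diagonals.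
  module Existence {l : Carrier} (σ³l≈l : σ³ l ≈ l) (l∉𝔽q : σ l - l ≉ 0#)
    (r₀≉0 : l - l * σ² l - 1# ≉ 0#) (t₀≉0 : σ² l - l * σ² l - 1# ≉ 0#) (e₀≉0 : 1# - l + l * l ≉ 0#) where
    private
      l₁ = σ l
      l₂ = σ² l
      r r₁ r₂ t t₁ t₂ e e₁ e₂ : Carrier
      r = l - l * l₂ - 1#
      r₁ = l₁ - l₁ * l - 1#
      r₂ = l₂ - l₂ * l₁ - 1#
      t = l₂ - l * l₂ - 1#
      t₁ = l - l₁ * l - 1#
      t₂ = l₁ - l₂ * l₁ - 1#
      e = 1# - l + l * l
      e₁ = 1# - l₁ + l₁ * l₁
      e₂ = 1# - l₂ + l₂ * l₂

      σr : σ r ≈ r₁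
      σr = refl σ- refl σ* σ³l≈l σ- σ-1
      σr₁ : σ r₁ ≈ r₂
      σr₁ = refl σ- refl σ* refl σ- σ-1
      σr₂ : σ r₂ ≈ r
      σr₂ = σ³l≈l σ- σ³l≈l σ* refl σ- σ-1
      σt : σ t ≈ t₁
      σt = σ³l≈l σ- refl σ* σ³l≈l σ- σ-1
      σt₁ : σ t₁ ≈ t₂
      σt₁ = refl σ- refl σ* refl σ- σ-1
      σt₂ : σ t₂ ≈ t
      σt₂ = refl σ- σ³l≈l σ* refl σ- σ-1
      σe : σ e ≈ e₁
      σe = σ-1 σ- refl σ+ refl σ* refl
      σe₁ : σ e₁ ≈ e₂
      σe₁ = σ-1 σ- refl σ+ refl σ* refl
      σe₂ : σ e₂ ≈ e
      σe₂ = σ-1 σ- σ³l≈l σ+ σ³l≈l σ* σ³l≈l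

      transfer : ∀ {x x′} → σ x ≈ x′ → x ≉ 0# → x′ ≉ 0#
      transfer eq x≉0 x′≈0 = σ-≉0 x≉0 (trans eq x′≈0)

      e₁≉0 = transfer σe e₀≉0
      e₂≉0 = transfer σe₁ e₁≉0

      E V : Carrier
      E = e * e₁ * e₂
      E≉0 : E ≉ 0#
      E≉0 = *-≉0 (*-≉0 e₀≉0 e₁≉0) e₂≉0
      σE : σ E ≈ E
      σE = trans (σe σ* σe₁ σ* σe₂) (solve 3 (λ a b c → b :* c :* a := a :* b :* c) refl e e₁ e₂)

      V = (l - l₂) * (l - l₂)
      l-l₁≉0 : l - l₁ ≉ 0#
      l-l₁≉0 = ≉⇒-≉0 (λ eq → l∉𝔽q (trans (+-congʳ (sym eq)) (-‿inverseʳ l)))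
      l₁-l₂≉0 : l₁ - l₂ ≉ 0#
      l₁-l₂≉0 = transfer (refl σ- refl) l-l₁≉0
      l₂-l≉0 : l₂ - l ≉ 0#
      l₂-l≉0 = transfer (refl σ- σ³l≈l) l₁-l₂≉0
      V≉0 : V ≉ 0#
      V≉0 = *-≉0 l-l₂≉0 l-l₂≉0
        where
        l-l₂≉0 : l - l₂ ≉ 0#
        l-l₂≉0 = ≉⇒-≉0 (λ eq → l₂-l≉0 (trans (+-congˡ (-‿cong eq)) (-‿inverseʳ l₂)))

      -- The three-term relation for l, l₂, m, m₂; V arises from (l - l₂)(m - m₂). It shows that 1 -
      -- δ = ee₂/V, hence a = rt/(ee₂).
      V+rt≈ee₂ : V + r * t ≈ e * e₂
      V+rt≈ee₂ = solve 2 (λ l m → (l :- m) :* (l :- m) :+ (l :- l :* m :- con ℤ.1ℤ) :* (m :- l :* m :- con ℤ.1ℤ) :=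
        (con ℤ.1ℤ :- l :+ l :* l) :* (con ℤ.1ℤ :- m :+ m :* m)) refl l l₂

      δ : Carrier
      δ = divide (- (r * t)) V V≉0
      δV : δ * V ≈ - (r * t)
      δV = divide-* _ V≉0

      σ³δ≈δ : σ³ δ ≈ δ
      σ³δ≈δ = *-cancelˡ V≉0 (begin
        V * σ³ δ         ≈⟨ *-comm _ _ ⟩
        σ³ δ * V         ≈⟨ conjugate (refl σ* ((σ³l≈l σ- refl) σ* (σ³l≈l σ- refl))) (σ-: (σr₂ σ* σt₂))
                              (conjugate (refl σ* ((refl σ- refl) σ* (refl σ- refl))) (σ-: (σr₁ σ* σt₁))
                              (conjugate (refl σ* ((refl σ- σ³l≈l) σ* (refl σ- σ³l≈l))) (σ-: (σr σ* σt)) δV)) ⟩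
        - (r * t)        ≈⟨ δV ⟨
        δ * V            ≈⟨ *-comm _ _ ⟩
        V * δ            ∎)

      δ≉0 : δ ≉ 0#
      δ≉0 δ≈0 = *-≉0 r₀≉0 t₀≉0 (begin
        r * t            ≈⟨ solve 1 (λ x → x := :- (:- x)) refl _ ⟩
        - - (r * t)      ≈⟨ -‿cong δV ⟨
        - (δ * V)        ≈⟨ -‿cong (*-congʳ δ≈0) ⟩
        - (0# * V)       ≈⟨ solve 1 (λ x → :- (con ℤ.0ℤ :* x) := con ℤ.0ℤ) refl V ⟩
        0#               ∎)

      V[1-δ] : V * (1# - δ) ≈ e * e₂
      V[1-δ] = begin
        V * (1# - δ)     ≈⟨ solve 2 (λ v d → v :* (con ℤ.1ℤ :- d) := v :- d :* v) refl V δ ⟩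
        V - δ * V        ≈⟨ +-congˡ (-‿cong δV) ⟩
        V - (- (r * t))  ≈⟨ solve 2 (λ v x → v :- (:- x) := v :+ x) refl V _ ⟩
        V + r * t        ≈⟨ V+rt≈ee₂ ⟩
        e * e₂           ∎

      δ≉1 : δ ≉ 1#
      δ≉1 δ≈1 = *-≉0 e₀≉0 e₂≉0 (begin
        e * e₂           ≈⟨ V[1-δ] ⟨
        V * (1# - δ)     ≈⟨ *-congˡ (+-congˡ (-‿cong δ≈1)) ⟩
        V * (1# - 1#)    ≈⟨ solve 1 (λ v → v :* (con ℤ.1ℤ :- con ℤ.1ℤ) := con ℤ.0ℤ) refl V ⟩
        0#               ∎)

    norm-value : ∃ λ d → d ≉ 0# × d ≉ 1# × σ³ d ≈ d × (∀ {a} → a * (1# - d) ≈ - d → HasTwoRootsIn𝔽q q F a)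
    norm-value = δ , δ≉0 , δ≉1 , σ³δ≈δ , has-two-roots
      where
      module _ {a : Carrier} (a[1-δ]≈-δ : a * (1# - δ) ≈ - δ) where
        a₁ = σ a
        a₂ = σ² a
        n s P R : Carrier
        n = a * a₁ * a₂
        s = a + a₁ + a₂ - 1#
        P = r * r₁ * r₂
        R = t * t₁ * t₂

        aee₂ : a * (e * e₂) ≈ r * t
        aee₂ = begin
          a * (e * e₂)           ≈⟨ *-congˡ V[1-δ] ⟨
          a * (V * (1# - δ))     ≈⟨ solve 3 (λ a v d → a :* (v :* d) := a :* d :* v) refl a V _ ⟩
          a * (1# - δ) * V       ≈⟨ *-congʳ a[1-δ]≈-δ ⟩
          - δ * V                ≈⟨ solve 2 (λ d v → (:- d) :* v := :- (d :* v)) refl δ V ⟩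
          - (δ * V)              ≈⟨ -‿cong δV ⟩
          - - (r * t)            ≈⟨ solve 1 (λ x → :- (:- x) := x) refl _ ⟩
          r * t                  ∎

        a₁e₁e : a₁ * (e₁ * e) ≈ r₁ * t₁
        a₁e₁e = conjugate (refl σ* (σe σ* σe₂)) (σr σ* σt) aee₂

        a₂e₂e₁ : a₂ * (e₂ * e₁) ≈ r₂ * t₂
        a₂e₂e₁ = conjugate (refl σ* (σe₁ σ* σe)) (σr₁ σ* σt₁) a₁e₁e

        -- The counterpart of `sum-of-roots` for this hexagon: the roots will be -P/E and -R/E, each
        -- of them now fixed by σ.
        Es : E * s ≈ - P + - R
        Es = begin
          E * s
            ≈⟨ solve 6 (λ e f g a b c → e :* f :* g :* (a :+ b :+ c :- con ℤ.1ℤ) :=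
                 a :* (e :* g) :* f :+ b :* (f :* e) :* g :+ c :* (g :* f) :* e :- e :* f :* g) refl e e₁ e₂ a a₁ a₂ ⟩
          a * (e * e₂) * e₁ + a₁ * (e₁ * e) * e₂ + a₂ * (e₂ * e₁) * e - E
            ≈⟨ +-congʳ (+-cong (+-cong (*-congʳ aee₂) (*-congʳ a₁e₁e)) (*-congʳ a₂e₂e₁)) ⟩
          r * t * e₁ + r₁ * t₁ * e₂ + r₂ * t₂ * e - E
            ≈⟨ solve 3 (λ l m k →
                 let r  = l :- l :* k :- con ℤ.1ℤ; r₁ = m :- m :* l :- con ℤ.1ℤ; r₂ = k :- k :* m :- con ℤ.1ℤ
                     t  = k :- l :* k :- con ℤ.1ℤ; t₁ = l :- m :* l :- con ℤ.1ℤ; t₂ = m :- k :* m :- con ℤ.1ℤ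
                     e  = con ℤ.1ℤ :- l :+ l :* l; e₁ = con ℤ.1ℤ :- m :+ m :* m; e₂ = con ℤ.1ℤ :- k :+ k :* k
                 in r :* t :* e₁ :+ r₁ :* t₁ :* e₂ :+ r₂ :* t₂ :* e :- e :* e₁ :* e₂ := :- (r :* r₁ :* r₂) :+ :- (t :* t₁ :* t₂))
                 refl l l₁ l₂ ⟩
          - P + - R ∎

        EEn : E * E * n ≈ - P * - R
        EEn = begin
          E * E * n
            ≈⟨ solve 6 (λ e f g a b c → e :* f :* g :* (e :* f :* g) :* (a :* b :* c) :=
                 a :* (e :* g) :* (b :* (f :* e)) :* (c :* (g :* f))) refl e e₁ e₂ a a₁ a₂ ⟩
          a * (e * e₂) * (a₁ * (e₁ * e)) * (a₂ * (e₂ * e₁))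
            ≈⟨ *-cong (*-cong aee₂ a₁e₁e) a₂e₂e₁ ⟩
          r * t * (r₁ * t₁) * (r₂ * t₂)
            ≈⟨ solve 6 (λ a b c d e f → a :* d :* (b :* e) :* (c :* f) := (:- (a :* b :* c)) :* (:- (d :* e :* f))) refl r r₁ r₂ t t₁ t₂ ⟩
          - P * - R ∎

        root : ∀ {x y y′} → E * x ≈ y → E * s ≈ y + y′ → E * E * n ≈ y * y′ → root-form a x ≈ 0#
        root {x} {y} {y′} Ex sum-eq product-eq = *-cancelˡ-0 (*-≉0 E≉0 E≉0) (begin
          E * E * root-form a x
            ≈⟨ solve 4 (λ e x s n → e :* e :* (x :* x :- s :* x :+ n) := e :* x :* (e :* x) :- e :* s :* (e :* x) :+ e :* e :* n) refl E x s n ⟩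
          E * x * (E * x) - E * s * (E * x) + E * E * n
            ≈⟨ +-cong (+-cong (*-cong Ex Ex) (-‿cong (*-cong sum-eq Ex))) product-eq ⟩
          y * y - (y + y′) * y + y * y′
            ≈⟨ solve 2 (λ y z → y :* y :- (y :+ z) :* y :+ y :* z := con ℤ.0ℤ) refl y y′ ⟩
          0# ∎)

        quotient∈𝔽q : ∀ {x y} → E * x ≈ y → σ y ≈ y → σ x ≈ x
        quotient∈𝔽q Ex σy = *-cancelˡ E≉0 (trans (conjugate (σE σ* refl) σy Ex) (sym Ex))

        y z : Carrier
        y = divide (- P) E E≉0
        z = divide (- R) E E≉0
        Ey : E * y ≈ - P
        Ey = trans (*-comm _ _) (divide-* _ E≉0)
        Ez : E * z ≈ - R
        Ez = trans (*-comm _ _) (divide-* _ E≉0)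
        σP : σ (- P) ≈ - P
        σP = σ-: (trans (σr σ* σr₁ σ* σr₂) (solve 3 (λ a b c → b :* c :* a := a :* b :* c) refl r r₁ r₂))
        σR : σ (- R) ≈ - R
        σR = σ-: (trans (σt σ* σt₁ σ* σt₂) (solve 3 (λ a b c → b :* c :* a := a :* b :* c) refl t t₁ t₂))
        -- With m = 1/(1 - l) the difference R - P is the Vandermonde product of l, l₁, l₂, nonzero
        -- because l is not in 𝔽q.
        y≉z : y ≉ z
        y≉z y≈z = *-≉0 (*-≉0 l-l₁≉0 l₁-l₂≉0) l₂-l≉0 (begin
          (l - l₁) * (l₁ - l₂) * (l₂ - l)
            ≈⟨ solve 3 (λ l m k → (l :- m) :* (m :- k) :* (k :- l) :=
                 let r  = l :- l :* k :- con ℤ.1ℤ; r₁ = m :- m :* l :- con ℤ.1ℤ; r₂ = k :- k :* m :- con ℤ.1ℤ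
                     t  = k :- l :* k :- con ℤ.1ℤ; t₁ = l :- m :* l :- con ℤ.1ℤ; t₂ = m :- k :* m :- con ℤ.1ℤ
                 in (:- (r :* r₁ :* r₂)) :- (:- (t :* t₁ :* t₂))) refl l l₁ l₂ ⟩
          - P - (- R)
            ≈⟨ +-cong (trans (sym Ey) (*-congˡ y≈z)) (-‿cong (sym Ez)) ⟩
          E * z - E * z
            ≈⟨ -‿inverseʳ _ ⟩
          0# ∎)

        has-two-roots : HasTwoRootsIn𝔽q q F a
        has-two-roots = two-roots (quotient∈𝔽q Ey σP) (quotient∈𝔽q Ez σR) y≉z
          (root Ey Es EEn) (root Ez (trans Es (+-comm _ _)) (trans EEn (*-comm _ _)))

  -- Taking l = x + σ³x puts it in 𝔽q³ automatically and turns the condition into one polynomial in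
  -- x with leading coefficient 1, whose degree is below q⁶.
  generic : q ℕ.> 2 → ∃ λ l → σ³ l ≈ l × (σ l - l) * ((l - l * σ² l - 1#) * ((σ² l - l * σ² l - 1#) * (1# - l + l * l))) ≉ 0#
  generic q>2 = let x , nonroot = ¬∀⇒∃≉0 cong vanishing in trace x , trace-fixed x , nonroot
    where
    trace : Carrier → Carrier
    trace x = x + σ³ x
    trace-fixed : ∀ x → σ³ (trace x) ≈ trace x
    trace-fixed x = trans (σ-cong (trans (σ-cong (refl σ+ refl)) (refl σ+ refl))) (trans (refl σ+ σ⁶ x) (+-comm _ _))
    condition : Carrier → Carrier
    condition l = (σ l - l) * ((l - l * σ² l - 1#) * ((σ² l - l * σ² l - 1#) * (1# - l + l * l)))
    cong : ∀ {x y} → x ≈ y → condition (trace x) ≈ condition (trace y)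
    cong {x} {y} x≈y = *-cong (+-cong eq₁ (-‿cong eq)) (*-cong (+-congʳ (+-cong eq (-‿cong (*-cong eq eq₂))))
      (*-cong (+-congʳ (+-cong eq₂ (-‿cong (*-cong eq eq₂)))) (+-cong (+-congˡ (-‿cong eq)) (*-cong eq eq))))
      where
      eq = +-cong x≈y (σ-cong (σ-cong (σ-cong x≈y)))
      eq₁ = σ-cong eq
      eq₂ = σ-cong eq₁

    top-l : HasTop (q ℕ.^ 3) 1# trace
    top-l = top-cong refl (λ x → +-cong (^q⁰ x) (^q³ x)) (top-+ʳ (q^i<q^j {0} {3} (s≤s z≤n)) (top-^ _) (top-^ (q ℕ.^ 3)))
    top-l₁ : HasTop (q ℕ.^ 4) 1# (λ x → σ (trace x))
    top-l₁ = top-cong refl (λ x → sym (trans (refl σ+ refl) (sym (+-cong (^q¹ x) (^q⁴ x)))))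
      (top-+ʳ (q^i<q^j {1} {4} (s≤s (s≤s z≤n))) (top-^ _) (top-^ (q ℕ.^ 4)))
    top-l₂ : HasTop (q ℕ.^ 5) 1# (λ x → σ² (trace x))
    top-l₂ = top-cong refl (λ x → sym (trans (trans (σ-cong (refl σ+ refl)) (refl σ+ refl)) (sym (+-cong (^q² x) (^q⁵ x)))))
      (top-+ʳ (q^i<q^j {2} {5} (s≤s (s≤s (s≤s z≤n)))) (top-^ _) (top-^ (q ℕ.^ 5)))
    top-ll₂ : HasTop (q ℕ.^ 3 ℕ.+ q ℕ.^ 5) (- 1#) (λ x → - (trace x * σ² (trace x)))
    top-ll₂ = top-neg (top-cong (*-identityˡ 1#) (λ _ → refl) (top-* top-l top-l₂))
    top-factor : ∀ {d f} → d < q ℕ.^ 3 ℕ.+ q ℕ.^ 5 → HasTop d 1# f →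
      HasTop (q ℕ.^ 3 ℕ.+ q ℕ.^ 5) (- 1#) (λ x → f x - trace x * σ² (trace x) - 1#)
    top-factor d< f-top = top-cong refl (λ _ → +-comm _ _)
      (top-+ʳ (ℕ.<-≤-trans (q^k≥1 3) (ℕ.m≤m+n _ _)) (top-const (- 1#)) (top-+ʳ d< f-top top-ll₂))
    top-e : HasTop (q ℕ.^ 3 ℕ.+ q ℕ.^ 3) 1# (λ x → 1# - trace x + trace x * trace x)
    top-e = top-+ʳ (ℕ.m<m+n (q ℕ.^ 3) (q^k≥1 3)) (top-+ʳ (q^k≥1 3) (top-const 1#) (top-neg top-l))
              (top-cong (*-identityˡ 1#) (λ _ → refl) (top-* top-l top-l))
    top-condition = top-* (top-cong refl (λ _ → +-comm _ _) (top-+ʳ (q^i<q^j (ℕ.n<1+n 3)) (top-neg top-l) top-l₁))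
      (top-* (top-factor (ℕ.m<m+n _ (q^k≥1 5)) top-l) (top-* (top-factor (ℕ.m<n+m _ (q^k≥1 3)) top-l₂) top-e))
    vanishing : ¬ (∀ x → condition (trace x) ≈ 0#)
    vanishing all≈0 = 0≉1 (sym (trans (solve 0 (con ℤ.1ℤ := con ℤ.1ℤ :* ((:- con ℤ.1ℤ) :* ((:- con ℤ.1ℤ) :* con ℤ.1ℤ))) refl)
      (vanishing⇒top≈0 top-condition (degree<q⁶ q q>2) all≈0)))

  -- The criterion sees α only through its norm, so any α whose norm is the value found in 𝔽q³ will
  -- do.
  scattered-exists : q ℕ.> 2 → ∃ λ α → N[q⁶/q³] q F α ≉ 0# × N[q⁶/q³] q F α ≉ 1# × IsScattered q F (f₃ q F α)
  scattered-exists q>2 = from-generic (generic q>2)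
    where
    from-norm : (∃ λ d → d ≉ 0# × d ≉ 1# × σ³ d ≈ d × (∀ {a} → a * (1# - d) ≈ - d → HasTwoRootsIn𝔽q q F a)) →
      ∃ λ α → N[q⁶/q³] q F α ≉ 0# × N[q⁶/q³] q F α ≉ 1# × IsScattered q F (f₃ q F α)
    from-norm (d , d≉0 , d≉1 , σ³d≈d , has-two-roots) =
      let α , _ , norm≈d = norm-q³-surjective d≉0 σ³d≈d
          N≈d = trans (N≈ασ³α α) norm≈d
          N≉0 = λ N≈0 → d≉0 (trans (sym N≈d) N≈0)
          N≉1 = λ N≈1 → d≉1 (trans (sym N≈d) N≈1)
      in α , N≉0 , N≉1 , Equivalence.from (scattered⇔two-roots N≉0 N≉1)
           (has-two-roots (trans (*-congˡ (+-congˡ (-‿cong (sym norm≈d)))) (trans (A[1-δ]≈-δ N≉0 N≉1) (-‿cong norm≈d))))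
    from-generic : (∃ λ l → σ³ l ≈ l × (σ l - l) * ((l - l * σ² l - 1#) * ((σ² l - l * σ² l - 1#) * (1# - l + l * l))) ≉ 0#) →
      ∃ λ α → N[q⁶/q³] q F α ≉ 0# × N[q⁶/q³] q F α ≉ 1# × IsScattered q F (f₃ q F α)
    from-generic (l , σ³l≈l , nonzero) = from-norm (Existence.norm-value σ³l≈l
      (λ eq → nonzero (trans (*-congʳ eq) (zeroˡ _)))
      (λ eq → nonzero (trans (*-congˡ (trans (*-congʳ eq) (zeroˡ _))) (zeroʳ _)))
      (λ eq → nonzero (trans (*-congˡ (trans (*-congˡ (trans (*-congʳ eq) (zeroˡ _))) (zeroʳ _))) (zeroʳ _)))
      (λ eq → nonzero (trans (*-congˡ (trans (*-congˡ (trans (*-congˡ eq) (zeroʳ _))) (zeroʳ _))) (zeroʳ _))))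

open import Data.Nat.Base using (_^_; _>_)

theorem7p3 : ∀ {c ℓ} (q : ℕ) → IsPrimePower q → (F : FiniteField c ℓ (q ^ 6)) →
    let open FiniteField F in
    (∀ α → N[q⁶/q³] q F α ≉ 0# → (N≉1 : N[q⁶/q³] q F α ≉ 1#) →
    IsScattered q F (f₃ q F α) ⇔ HasTwoRootsIn𝔽q q F (A q F α N≉1))
    × (q > 2 → ∃ λ α → N[q⁶/q³] q F α ≉ 0# × N[q⁶/q³] q F α ≉ 1# × IsScattered q F (f₃ q F α))
theorem7p3 q q-primePower F = (λ α N≉0 N≉1 → scattered⇔two-roots N≉0 N≉1) , scattered-exists
  where open Sextic q q-primePower F
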